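{- Let $p$ be a prime and let $T>0$ be real. Let $$\mathcal{F}(T)=\{\alpha/\beta\in\mathbb{Q} : \gcd(\alpha,\beta)=1,\ 1\leq \alpha,\beta\leq T\}$$ (with $\alpha,\beta$ integers). For an integer $v$, let $R_{T,p}(v)$ denote the number of fractions $\alpha/\beta\in\mathcal{F}(T)$ with $\gcd(\beta,p)=1$ and $\alpha/\beta\equiv v \pmod p$. Then $$\sum_{1\leq v\leq p-1}\left|R_{T,p}(v)-\frac{6}{\pi^2}\cdot\frac{T^2}{p}\right| = O\left(T^2p^{ -1}+T\,p^{1/2+o(1)}\right),$$ where the implied constant is absolute, and $o(1)$ denotes a quantity which tends to zero as $T\to\infty$, uniformly in $p$.
   Context: The elements of $\mathcal{F}(T)$ (the Farey fractions of order $T$) are written in lowest terms $\alpha/\beta$ with positive integers $\alpha,\beta\leq T$. For $\gcd(\beta,p)=1$, the congruence $\alpha/\beta\equiv v\pmod p$ means $\alpha\equiv v\beta\pmod p$. The notation $U=O(V)$ means that $|U|\leq cV$ holds for some constant $c>0$. -}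

module Defs where

open import Level using (0ℓ)
open import Algebra.Bundles using (CommutativeRing; Semiring)
import Algebra.Definitions.RawSemiring as RawSemiringDefinitions
import Algebra.Properties.CommutativeMonoid.Sum as Summation
open import Data.Empty using (⊥-elim)
open import Data.Fin.Base using (toℕ)
open import Data.Integer.Base as ℤ using (ℤ; -[1+_])
import Data.Integer.Divisibility.Signed as ℤ
open import Data.List.Base using (List; length; filter; upTo; cartesianProduct)
open import Data.Nat.Base as ℕ using (ℕ; zero; suc)
import Data.Nat.Properties as ℕ
open import Data.Nat.GCD using (gcd)
open import Data.Nat.Primality using (Prime)
open import Data.Product.Base using (Σ; ∃; _×_; _,_; proj₁; proj₂)
open import Data.Rational.Base as ℚ using (ℚ)
open import Data.Sum.Base using (_⊎_; inj₁; inj₂)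
open import Relation.Binary.Core using (Rel)
open import Relation.Binary.Structures using (IsDecTotalOrder)
open import Relation.Binary.PropositionalEquality.Core using (_≡_)
import Relation.Binary.Construct.NonStrictToStrict as ToStrict
import Relation.Binary.Reasoning.Setoid as SetoidReasoning
open import Relation.Nullary.Negation.Core using (¬_)
open import Relation.Nullary.Decidable.Core using (Dec; yes; no; _×-dec_; does)
open import Relation.Unary using (Pred; Decidable)
open import Data.Bool.Base using (if_then_else_)

-- The real numbers, characterised up to isomorphism as a complete ordered
-- field.  Suprema are approximated by elements of the set, so any instance
-- yields excluded middle for Set (see `em` below); conversely, given excluded
-- middle, the usual constructions of the reals are instances.
record RealNumbers : Set₁ where
  field
    commutativeRing : CommutativeRing 0ℓ 0ℓ

  open CommutativeRing commutativeRing public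

  infix  4 _≤_
  infix  8 _⁻¹
  field
    _≤_             : Rel Carrier 0ℓ
    isDecTotalOrder : IsDecTotalOrder _≈_ _≤_

  open ToStrict _≈_ _≤_ public using (_<_)

  UpperBound : Pred Carrier 0ℓ → Pred Carrier 0ℓ
  UpperBound S b = ∀ x → S x → x ≤ b

  IsSup : Pred Carrier 0ℓ → Pred Carrier 0ℓ
  IsSup S s = UpperBound S s × (∀ t → t < s → ∃ λ x → S x × t < x)

  field
    0<1        : 0# < 1#
    +-monoˡ-≤  : ∀ {x y} z → x ≤ y → x + z ≤ y + z
    *-nonNeg   : ∀ {x y} → 0# ≤ x → 0# ≤ y → 0# ≤ x * y
    _⁻¹        : Carrier → Carrier
    ⁻¹-inverse : ∀ {x} → ¬ (x ≈ 0#) → x * x ⁻¹ ≈ 1#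
    complete   : (S : Pred Carrier 0ℓ) → ∃ S → ∃ (UpperBound S) → ∃ (IsSup S)

module RealAnalysis (𝓡 : RealNumbers) where

  open RealNumbers 𝓡 public renaming (Carrier to ℝ) hiding (zero)
  open RawSemiringDefinitions (Semiring.rawSemiring semiring) public
    using (_^_) renaming (_×_ to _·_)
  open Summation +-commutativeMonoid public using (sum; sum-syntax)
  module ≤ = IsDecTotalOrder isDecTotalOrder

  infixl 7 _/_
  _/_ : ℝ → ℝ → ℝ
  x / y = x * y ⁻¹

  ∣_∣ : ℝ → ℝ
  ∣ x ∣ = if does (0# ≤.≤? x) then x else - x

  fromℕ : ℕ → ℝ
  fromℕ n = n · 1#

  fromℤ : ℤ → ℝ
  fromℤ (ℤ.+ n)  = fromℕ n
  fromℤ -[1+ n ] = - fromℕ (suc n)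

  fromℚ : ℚ → ℝ
  fromℚ q = fromℤ (ℚ.↥ q) / fromℕ (ℚ.↧ₙ q)

  em : (P : Set) → Dec P
  em P = decide (complete S (0# , inj₁ refl) (1# , bound))
    where
    S : Pred ℝ 0ℓ
    S x = x ≈ 0# ⊎ (x ≈ 1# × P)

    bound : UpperBound S 1#
    bound x (inj₁ x≈0)       = ≤.trans (≤.reflexive x≈0) (proj₁ 0<1)
    bound x (inj₂ (x≈1 , _)) = ≤.reflexive x≈1

    decide : ∃ (IsSup S) → Dec P
    decide (s , upper , approx) with s ≤.≤? 0#
    ... | yes s≤0 = no λ p → proj₂ 0<1
          (≤.antisym (proj₁ 0<1) (≤.trans (upper 1# (inj₂ (refl , p))) s≤0))
    ... | no  s≰0 with approx 0# (ToStrict.≰⇒> _≈_ _≤_ sym ≤.reflexive ≤.total s≰0)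
    ...   | x , inj₁ x≈0 , _ , 0≉x = ⊥-elim (0≉x (sym x≈0))
    ...   | x , inj₂ (_ , p) , _   = yes p

  -- The supremum, with value 0# when S is empty or unbounded above.
  sup : Pred ℝ 0ℓ → ℝ
  sup S with em (∃ S × ∃ (UpperBound S))
  ... | yes (inhabited , bounded) = proj₁ (complete S inhabited bounded)
  ... | no  _                     = 0#

  private
    x<x+1 : ∀ x → x < x + 1#
    x<x+1 x = x≤x+1 , x≉x+1
      where
      open SetoidReasoning setoid

      x≤x+1 : x ≤ x + 1#
      x≤x+1 = ≤.trans (≤.reflexive (sym (+-identityˡ x)))
             (≤.trans (+-monoˡ-≤ x (proj₁ 0<1)) (≤.reflexive (+-comm 1# x)))

      x≉x+1 : ¬ (x ≈ x + 1#)
      x≉x+1 x≈x+1 = proj₂ 0<1 (begin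
        0#              ≈⟨ -‿inverseˡ x ⟨
        - x + x         ≈⟨ +-congˡ x≈x+1 ⟩
        - x + (x + 1#)  ≈⟨ +-assoc (- x) x 1# ⟨
        - x + x + 1#    ≈⟨ +-congʳ (-‿inverseˡ x) ⟩
        0# + 1#         ≈⟨ +-identityˡ 1# ⟩
        1#              ∎)

  archimedean : ∀ x → ∃ λ n → x ≤ fromℕ n
  archimedean x with em (∃ λ n → x ≤ fromℕ n)
  ... | yes bounded = bounded
  ... | no  ¬bounded = ⊥-elim (absurd (complete S (0# , 0 , refl) (x , bound)))
    where
    S : Pred ℝ 0ℓ
    S y = ∃ λ n → y ≈ fromℕ n

    bound : UpperBound S x
    bound y (n , y≈n) with ≤.total y x
    ... | inj₁ y≤x = y≤x
    ... | inj₂ x≤y = ⊥-elim (¬bounded (n , ≤.trans x≤y (≤.reflexive y≈n)))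

    absurd : ¬ ∃ (IsSup S)
    absurd (s , upper , approx) = contra (approx (s - 1#) s-1<s)
      where
      s-1+1≈s : s - 1# + 1# ≈ s
      s-1+1≈s = trans (+-assoc s (- 1#) 1#)
                (trans (+-congˡ (-‿inverseˡ 1#)) (+-identityʳ s))

      s-1<s : s - 1# < s
      s-1<s = ≤.trans (proj₁ (x<x+1 (s - 1#))) (≤.reflexive s-1+1≈s)
            , λ e → proj₂ (x<x+1 (s - 1#)) (trans e (sym s-1+1≈s))

      contra : ¬ ∃ λ y → S y × s - 1# < y
      contra (y , (n , y≈n) , s-1≤y , s-1≉y) = s-1≉y (≤.antisym s-1≤y y≤s-1)
        where
        y+1≤s : y + 1# ≤ s
        y+1≤s = upper (y + 1#) (suc n , trans (+-comm y 1#) (+-congˡ y≈n))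

        y≤s-1 : y ≤ s - 1#
        y≤s-1 = ≤.trans (≤.reflexive (sym (trans (+-assoc y 1# (- 1#))
                  (trans (+-congˡ (-‿inverseʳ 1#)) (+-identityʳ y)))))
                (+-monoˡ-≤ (- 1#) y+1≤s)

  -- Leibniz: π/4 = 1 - 1/3 + 1/5 - 1/7 + ⋯.  Grouping the terms in pairs makes
  -- the partial sums increasing, so their limit is their supremum.
  π : ℝ
  π = fromℕ 4 * sup λ x → ∃ λ n → x ≈ partialSum n
    where
    partialSum : ℕ → ℝ
    partialSum n = ∑[ i < n ] (fromℕ (4 ℕ.* toℕ i ℕ.+ 1) ⁻¹ - fromℕ (4 ℕ.* toℕ i ℕ.+ 3) ⁻¹)

  infixr 8 _^ᶻ_ _^ʳ_

  _^ᶻ_ : ℝ → ℤ → ℝ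
  b ^ᶻ (ℤ.+ n)  = b ^ n
  b ^ᶻ -[1+ n ] = (b ^ suc n) ⁻¹

  -- b ^ʳ y = sup { b^q : q ∈ ℚ, q ≤ y }, where b^q is the positive z with
  -- z^(denominator q) = b^(numerator q).  This is the power b^y for b ≥ 1 only.
  _^ʳ_ : ℝ → ℝ → ℝ
  b ^ʳ y = sup λ z → ∃ λ q →
    fromℚ q ≤ y × 0# < z × z ^ ℚ.↧ₙ q ≈ b ^ᶻ ℚ.↥ q

  -- 𝓕 T consists of the pairs (α , β) representing α/β in lowest terms.
  𝓕 : ℝ → Pred (ℕ × ℕ) 0ℓ
  𝓕 T (α , β) = gcd α β ≡ 1
              × (1 ℕ.≤ α × fromℕ α ≤ T)
              × (1 ℕ.≤ β × fromℕ β ≤ T)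

  _/_≡_[mod_] : ℕ → ℕ → ℤ → ℕ → Set
  α / β ≡ v [mod p ] = (ℤ.+ p) ℤ.∣ (ℤ.+ α ℤ.- v ℤ.* ℤ.+ β)

  Counted : ℝ → ℕ → ℤ → Pred (ℕ × ℕ) 0ℓ
  Counted T p v (α , β) = 𝓕 T (α , β) × gcd β p ≡ 1 × α / β ≡ v [mod p ]

  counted? : ∀ T p v → Decidable (Counted T p v)
  counted? T p v (α , β) =
    (gcd α β ℕ.≟ 1
      ×-dec (1 ℕ.≤? α ×-dec fromℕ α ≤.≤? T)
      ×-dec (1 ℕ.≤? β ×-dec fromℕ β ≤.≤? T))
    ×-dec gcd β p ℕ.≟ 1
    ×-dec (ℤ.+ p) ℤ.∣? (ℤ.+ α ℤ.- v ℤ.* ℤ.+ β)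

  -- The count is over a box [0,N]² containing every pair in 𝓕 T.
  R : ℝ → ℕ → ℤ → ℕ
  R T p v = length (filter (counted? T p v) (cartesianProduct range range))
    where
    range : List ℕ
    range = upTo (suc (proj₁ (archimedean T)))

  -- o T p → 0 as T → ∞, uniformly over the primes p.
  IsUniformlyLittleO1 : (ℝ → ℕ → ℝ) → Set
  IsUniformlyLittleO1 o =
    ∀ δ → 0# < δ → ∃ λ T₀ → ∀ T → T₀ ≤ T → ∀ p → Prime p → ∣ o T p ∣ ≤ δ

{-# OPTIONS --safe #-}
module Submission where

open import Defs
open import Algebra.Bundles using (RawRing)
import Algebra.Properties.CommutativeSemiring.Exp as ExpProperties
import Algebra.Properties.Ring as RingProperties
import Algebra.Properties.Semiring.Mult as MultProperties
import Algebra.Solver.Ring as RingSolver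
open import Algebra.Solver.Ring.AlmostCommutativeRing using (fromCommutativeRing; _-Raw-AlmostCommutative⟶_)
open import Data.Bool.Base using (if_then_else_)
open import Data.Empty using (⊥-elim)
open import Data.Fin.Base as Fin using (Fin; toℕ; fromℕ<; remQuot; combine)
import Data.Fin.Properties as Fin
open import Data.Integer.Base as ℤ using (ℤ; +_; -[1+_])
import Data.Integer.DivMod as ℤ
import Data.Integer.Divisibility.Signed as ℤ
open import Data.Integer.Divisibility.Signed using (divides)
import Data.Integer.Properties as ℤ
import Data.Integer.Tactic.RingSolver as ℤ-Solver
open import Data.List.Base using (List; []; _∷_; _++_; map; length; filter; upTo; applyUpTo; cartesianProduct)
open import Data.List.Membership.Propositional using (_∈_)
open import Data.List.Membership.Propositional.Properties using (∈-cartesianProduct⁺; ∈-cartesianProduct⁻)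
open import Data.List.Properties using (applyUpTo-∷ʳ)
open import Data.List.Relation.Binary.Permutation.Propositional using (_↭_; ↭-sym; ↭⇒↭ₛ)
open import Data.List.Relation.Binary.Permutation.Propositional.Properties using (↭-length)
import Data.List.Relation.Binary.Permutation.Setoid.Properties as SetoidPermutation
open import Data.List.Relation.Unary.All as All using (All; []; _∷_)
open import Data.List.Relation.Unary.AllPairs using ([]; _∷_)
open import Data.List.Relation.Unary.Any using (here; there)
open import Data.List.Relation.Unary.Unique.Propositional using (Unique)
open import Data.List.Relation.Unary.Unique.Propositional.Properties using (cartesianProduct⁺)
open import Data.Maybe.Base using (Maybe; just; nothing)
open import Data.Nat.Base as ℕ using (ℕ; zero; suc; pred; NonZero; _∸_)
open import Data.Nat.Coprimality using (Coprime; coprime-Bézout; coprime-divisor)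
import Data.Nat.Coprimality as Coprime
import Data.Nat.DivMod as ℕ
open import Data.Nat.Divisibility using (_∣_; _∣?_; divides; ∣⇒≤; ∣-trans; ∣1⇒≡1; m∣m*n; n∣m*n; ∣-refl)
import Data.Nat.Divisibility as ℕ
open import Data.Nat.GCD using (gcd; gcd[m,n]∣m; gcd[m,n]∣n; gcd-greatest; module Bézout; gcd[m,n]≢0)
open import Data.Nat.ListAction using (product)
open import Data.Nat.ListAction.Properties using (∈⇒∣product)
open import Data.Nat.Primality using (Prime; euclidsLemma; prime⇒nonZero; prime⇒nonTrivial; prime⇒irreducible; ¬prime[1])
open import Data.Nat.Primality.Factorisation using (PrimeFactorisation; factorise; factorisationUnique; factorisationHasAllPrimeFactors)
import Data.Nat.Properties as ℕ
open import Data.Nat.Tactic.RingSolver using (solve-∀)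
open import Data.Product.Base using (∃; _×_; _,_; proj₁; proj₂; ∃₂)
open import Data.Rational.Base as ℚ using (ℚ; mkℚ)
open import Data.Sum.Base using (_⊎_; inj₁; inj₂; [_,_]′)
open import Level using (0ℓ)
import Relation.Binary.Construct.NonStrictToStrict as ToStrict
import Relation.Binary.PropositionalEquality as ≡
open ≡ using (_≡_)
import Relation.Binary.Reasoning.Setoid as SetoidReasoning
open import Relation.Nullary using (¬_; Dec; yes; no; does)
open import Relation.Unary using (Pred; Decidable)

-- Möbius inversion over the common divisor d of α and β reduces the claim to
-- Σ_v |N(v) − U²/p| = O(U p^(1/2) log U) for the number N(v) of all pairs
-- α ≡ v β (mod p) in [1, U]², with U = T/d.  By Thue's lemma v ≡ x/y with x, y
-- coprime and |x|, y ≤ p^(1/2), so the condition becomes p ∣ α y − β x.  On y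
-- consecutive values of β the form α y − β x takes every integer value at most
-- once, and fills an interval of length U y up to an error O(p) at its ends;
-- hence N(v) = U²/p + O(U/y + U y/p + 1), which is summed over all x and y.
-- The logarithms cost p^o(1) if T < p⁴, and otherwise are absorbed by T²/p.
-- The density 6/π² = 1/Σ n⁻² is found from Leibniz' series for π/4 by squaring it.

-- A residue v with Thue denominator y has an error of order U/y + 1, and at most 2√p + 1 residues
-- share a given y: this is why the average over v costs only one logarithm, although single
-- residues can be far worse. The second logarithm is Σ 1/d in the Möbius sum. Two cases escape this
-- argument. For d divisible by p the congruence holds for every pair, which contributes a T²/p of
-- its own; for U < √p the O(1) per residue is too expensive, and a trivial count takes over. No
-- logarithm or exponential function is introduced: logarithmic quantities are compared with B =
-- 2^m, where 16^B ≤ T < 16^(2B) for T ≥ 16, and o(1) is 2m/B. The power of p stands on the larger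
-- side of the claim, so a lower bound for it suffices, and one rational exponent with one root
-- provides it. As π is given only as a supremum of partial sums, both Σ n⁻² and Σ μ(d)/d² are
-- reached through finite identities with explicit errors; no infinite series is manipulated.

-- Arithmetic of the reals and a ring solver for it.

module OrderedField (𝓡 : RealNumbers) where

  open RealAnalysis 𝓡 public
  open RingProperties ring public
    using (-‿involutive; -‿distribˡ-*; -‿distribʳ-*; -0#≈0#; -‿+-comm)
  open MultProperties semiring using (×-homo-+; ×1-homo-*; ×-congˡ)
  open ExpProperties commutativeSemiring public
    using (^-assocʳ)
  open SetoidReasoning setoid

  fromℕ-+ : ∀ m n → fromℕ (m ℕ.+ n) ≈ fromℕ m + fromℕ n
  fromℕ-+ m n = ×-homo-+ 1# m n

  fromℕ-* : ∀ m n → fromℕ (m ℕ.* n) ≈ fromℕ m * fromℕ n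
  fromℕ-* = ×1-homo-*

  fromℕ-cong : ∀ {m n} → m ≡ n → fromℕ m ≈ fromℕ n
  fromℕ-cong = ×-congˡ

  fromℕ-1 : fromℕ 1 ≈ 1#
  fromℕ-1 = +-identityʳ 1#

  -- Coefficients of the ring solver are formal differences (a , b) of natural
  -- numbers, one of which is zero after `reduce`.
  private
    ⟦_⟧ᶜ : ℕ × ℕ → ℝ
    -- `fromℕ 1` unfolds to `1# + 0#`; the separate clause makes the constant `κ 1` mean `1#`
    -- itself.
    ⟦ 1 , 0 ⟧ᶜ     = 1#
    ⟦ a , 0 ⟧ᶜ     = fromℕ a
    ⟦ a , suc b ⟧ᶜ = fromℕ a - fromℕ (suc b)

    ⟦⟧-sub : ∀ a b → ⟦ a , b ⟧ᶜ ≈ fromℕ a - fromℕ b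
    ⟦⟧-sub 0             0       = sym (-‿inverseʳ 0#)
    ⟦⟧-sub 1             0       = sym (trans (+-cong fromℕ-1 -0#≈0#) (+-identityʳ 1#))
    ⟦⟧-sub (suc (suc a)) 0       = sym (trans (+-congˡ -0#≈0#) (+-identityʳ _))
    ⟦⟧-sub 0             (suc b) = refl
    ⟦⟧-sub 1             (suc b) = refl
    ⟦⟧-sub (suc (suc a)) (suc b) = refl

    interchange : ∀ a b c d → (a + b) + (c + d) ≈ (a + c) + (b + d)
    interchange a b c d = begin
      (a + b) + (c + d)  ≈⟨ +-assoc a b (c + d) ⟩
      a + (b + (c + d))  ≈⟨ +-congˡ (+-assoc b c d) ⟨
      a + ((b + c) + d)  ≈⟨ +-congˡ (+-congʳ (+-comm b c)) ⟩
      a + ((c + b) + d)  ≈⟨ +-congˡ (+-assoc c b d) ⟩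
      a + (c + (b + d))  ≈⟨ +-assoc a c (b + d) ⟨
      (a + c) + (b + d)  ∎

    neg-sub : ∀ a b → - (a - b) ≈ b - a
    neg-sub a b = begin
      - (a - b)      ≈⟨ -‿+-comm a (- b) ⟨
      - a + - - b    ≈⟨ +-congˡ (-‿involutive b) ⟩
      - a + b        ≈⟨ +-comm (- a) b ⟩
      b - a          ∎

    sub-+ : ∀ a b c d → (a + c) - (b + d) ≈ (a - b) + (c - d)
    sub-+ a b c d = begin
      (a + c) - (b + d)      ≈⟨ +-congˡ (-‿+-comm b d) ⟨
      (a + c) + (- b - d)    ≈⟨ interchange a c (- b) (- d) ⟩
      (a - b) + (c - d)      ∎

    mul-sub : ∀ a b c d → (a * c + b * d) - (a * d + b * c) ≈ (a - b) * (c - d)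
    mul-sub a b c d = begin
      (a * c + b * d) - (a * d + b * c)            ≈⟨ +-congˡ (-‿cong (+-comm (a * d) (b * c))) ⟩
      (a * c + b * d) - (b * c + a * d)            ≈⟨ sub-+ (a * c) (b * c) (b * d) (a * d) ⟩
      (a * c - b * c) + (b * d - a * d)            ≈⟨ +-cong (distr a b c) (distr b a d) ⟨
      (a - b) * c + (b - a) * d                    ≈⟨ +-congˡ (*-congʳ (neg-sub a b)) ⟨
      (a - b) * c + - (a - b) * d                  ≈⟨ +-congˡ (-‿distribˡ-* (a - b) d) ⟨
      (a - b) * c - (a - b) * d                    ≈⟨ +-congˡ (-‿distribʳ-* (a - b) d) ⟩
      (a - b) * c + (a - b) * - d                  ≈⟨ distribˡ (a - b) c (- d) ⟨
      (a - b) * (c - d)                            ∎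
      where
      distr : ∀ x y z → (x - y) * z ≈ x * z - y * z
      distr x y z = trans (distribʳ z x (- y)) (+-congˡ (sym (-‿distribˡ-* y z)))

    sub≈0 : ∀ a b c d → a + d ≈ c + b → a - b ≈ c - d
    sub≈0 a b c d e = begin
      a - b                    ≈⟨ +-identityʳ _ ⟨
      a - b + 0#               ≈⟨ +-congˡ (-‿inverseʳ d) ⟨
      (a - b) + (d - d)        ≈⟨ interchange a (- b) d (- d) ⟩
      (a + d) + (- b - d)      ≈⟨ +-cong e (+-comm (- b) (- d)) ⟩
      (c + b) + (- d - b)      ≈⟨ interchange c b (- d) (- b) ⟩
      (c - d) + (b - b)        ≈⟨ +-congˡ (-‿inverseʳ b) ⟩
      c - d + 0#               ≈⟨ +-identityʳ _ ⟩
      c - d                    ∎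

    reduce : ℕ → ℕ → ℕ × ℕ
    reduce a b = a ℕ.∸ b , b ℕ.∸ a

    ⟦⟧-reduce : ∀ a b → ⟦ reduce a b ⟧ᶜ ≈ fromℕ a - fromℕ b
    ⟦⟧-reduce a b = trans (⟦⟧-sub (a ℕ.∸ b) (b ℕ.∸ a)) (sub≈0 _ _ _ _
      (trans (sym (fromℕ-+ (a ℕ.∸ b) b)) (trans (fromℕ-cong (∸-balance a b))
        (fromℕ-+ a (b ℕ.∸ a)))))
      where
      ∸-balance : ∀ a b → a ℕ.∸ b ℕ.+ b ≡ a ℕ.+ (b ℕ.∸ a)
      ∸-balance zero    zero    = ≡.refl
      ∸-balance zero    (suc b) = ≡.refl
      ∸-balance (suc a) zero    = ≡.refl
      ∸-balance (suc a) (suc b) = ≡.trans (ℕ.+-suc (a ℕ.∸ b) b) (≡.cong suc (∸-balance a b))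

    differences : RawRing 0ℓ 0ℓ
    differences = record
      { Carrier = ℕ × ℕ
      ; _≈_ = _≡_
      ; _+_ = λ (a , b) (c , d) → reduce (a ℕ.+ c) (b ℕ.+ d)
      ; _*_ = λ (a , b) (c , d) → reduce (a ℕ.* c ℕ.+ b ℕ.* d) (a ℕ.* d ℕ.+ b ℕ.* c)
      ; -_  = λ (a , b) → b , a
      ; 0#  = 0 , 0
      ; 1#  = 1 , 0
      }

    almost = fromCommutativeRing commutativeRing

    evaluation : differences -Raw-AlmostCommutative⟶ almost
    evaluation = record
      { ⟦_⟧ = ⟦_⟧ᶜ
      ; +-homo = λ (a , b) (c , d) →
          trans (⟦⟧-reduce (a ℕ.+ c) (b ℕ.+ d)) (trans (+-cong (fromℕ-+ a c) (-‿cong (fromℕ-+ b d)))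
                (trans (sub-+ (fromℕ a) (fromℕ b) (fromℕ c) (fromℕ d))
                       (sym (+-cong (⟦⟧-sub a b) (⟦⟧-sub c d)))))
      ; *-homo = λ (a , b) (c , d) →
          trans (⟦⟧-reduce (a ℕ.* c ℕ.+ b ℕ.* d) (a ℕ.* d ℕ.+ b ℕ.* c)) (trans (+-cong (prods a c b d) (-‿cong (prods a d b c)))
                (trans (mul-sub (fromℕ a) (fromℕ b) (fromℕ c) (fromℕ d))
                       (sym (*-cong (⟦⟧-sub a b) (⟦⟧-sub c d)))))
      ; -‿homo = λ (a , b) → trans (⟦⟧-sub b a)
          (trans (sym (neg-sub (fromℕ a) (fromℕ b))) (-‿cong (sym (⟦⟧-sub a b))))
      ; 0-homo = refl
      ; 1-homo = refl
      }
      where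
      prods : ∀ a c b d → fromℕ (a ℕ.* c ℕ.+ b ℕ.* d) ≈ fromℕ a * fromℕ c + fromℕ b * fromℕ d
      prods a c b d = trans (fromℕ-+ (a ℕ.* c) (b ℕ.* d)) (+-cong (fromℕ-* a c) (fromℕ-* b d))

    equal? : (c d : ℕ × ℕ) → Maybe (⟦ c ⟧ᶜ ≈ ⟦ d ⟧ᶜ)
    equal? (a , b) (c , d) with a ℕ.+ d ℕ.≟ c ℕ.+ b
    ... | yes e = just (trans (⟦⟧-sub a b) (trans (sub≈0 _ _ _ _ (trans (sym (fromℕ-+ a d))
                    (trans (fromℕ-cong e) (fromℕ-+ c b)))) (sym (⟦⟧-sub c d))))
    ... | no  _ = nothing

    module Solver = RingSolver differences almost evaluation equal?

  open Solver public using (solve; _:=_; _:+_; _:*_; _:-_; :-_; Polynomial)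

  κ : ∀ {m} → ℕ → Polynomial m
  κ n = Solver.con (n , 0)


  -- Order, reciprocals and absolute values.

  infixr 4 _≤≈_ _≈≤_
  _≤≈_ : ∀ {a b c} → a ≤ b → b ≈ c → a ≤ c
  p ≤≈ q = ≤.trans p (≤.reflexive q)

  _≈≤_ : ∀ {a b c} → a ≈ b → b ≤ c → a ≤ c
  p ≈≤ q = ≤.trans (≤.reflexive p) q

  ≤⇒0≤- : ∀ {a b} → a ≤ b → 0# ≤ b - a
  ≤⇒0≤- {a} {b} a≤b = sym (-‿inverseʳ a) ≈≤ +-monoˡ-≤ (- a) a≤b

  0≤-⇒≤ : ∀ {a b} → 0# ≤ b - a → a ≤ b
  0≤-⇒≤ {a} {b} h = sym (+-identityˡ a) ≈≤ +-monoˡ-≤ a h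
    ≤≈ solve 2 (λ a b → b :- a :+ a := b) refl a b

  -- Inequalities and equations are mostly proved from certificates: the
  -- difference of the two sides is rewritten by the ring solver into an
  -- expression which is visibly nonnegative, or zero.
  ≤-cert : ∀ {a b e} → b - a ≈ e → 0# ≤ e → a ≤ b
  ≤-cert b-a≈e 0≤e = 0≤-⇒≤ (0≤e ≤≈ sym b-a≈e)

  ≈-cert : ∀ {a b e} → a - b ≈ e → e ≈ 0# → a ≈ b
  ≈-cert {a} {b} p q = begin
    a           ≈⟨ solve 2 (λ a b → a := (a :- b) :+ b) refl a b ⟩
    a - b + b   ≈⟨ +-congʳ (trans p q) ⟩
    0# + b      ≈⟨ +-identityˡ b ⟩
    b           ∎

  ≈⇒-≈0 : ∀ {a b} → a ≈ b → a - b ≈ 0#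
  ≈⇒-≈0 {a} {b} e = trans (+-congʳ e) (-‿inverseʳ b)

  ≈0-* : ∀ {a} c → a ≈ 0# → c * a ≈ 0#
  ≈0-* c e = trans (*-congˡ e) (zeroʳ c)

  infixl 6 _+0_ _0+0_
  infixl 7 _*0_
  _+0_ : ∀ {a b} → 0# ≤ a → 0# ≤ b → 0# ≤ a + b
  _+0_ {a} {b} p q = ≤.trans q (sym (+-identityˡ b) ≈≤ +-monoˡ-≤ b p)

  _*0_ : ∀ {a b} → 0# ≤ a → 0# ≤ b → 0# ≤ a * b
  _*0_ = *-nonNeg

  _0+0_ : ∀ {a b} → a ≈ 0# → b ≈ 0# → a + b ≈ 0#
  p 0+0 q = trans (+-cong p q) (+-identityʳ 0#)

  +-mono-≤ : ∀ {a b c d} → a ≤ b → c ≤ d → a + c ≤ b + d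
  +-mono-≤ {a} {b} {c} {d} p q = ≤-cert
    (solve 4 (λ a b c d → (b :+ d) :- (a :+ c) := (b :- a) :+ (d :- c)) refl a b c d)
    (≤⇒0≤- p +0 ≤⇒0≤- q)

  neg-mono-≤ : ∀ {a b} → a ≤ b → - b ≤ - a
  neg-mono-≤ {a} {b} p = ≤-cert (solve 2 (λ a b → :- a :- :- b := b :- a) refl a b) (≤⇒0≤- p)

  *-monoˡ-≤ : ∀ {a b} c → 0# ≤ c → a ≤ b → c * a ≤ c * b
  *-monoˡ-≤ {a} {b} c 0≤c p = ≤-cert
    (solve 3 (λ a b c → c :* b :- c :* a := c :* (b :- a)) refl a b c) (0≤c *0 ≤⇒0≤- p)

  *-monoʳ-≤ : ∀ {a b} c → 0# ≤ c → a ≤ b → a * c ≤ b * c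
  *-monoʳ-≤ {a} {b} c 0≤c p = *-comm a c ≈≤ *-monoˡ-≤ c 0≤c p ≤≈ *-comm c b

  *-mono-≤ : ∀ {a b c d} → 0# ≤ a → 0# ≤ d → a ≤ b → c ≤ d → a * c ≤ b * d
  *-mono-≤ {a} {b} {c} {d} 0≤a 0≤d p q = ≤.trans (*-monoˡ-≤ a 0≤a q) (*-monoʳ-≤ d 0≤d p)

  0≤1 : 0# ≤ 1#
  0≤1 = proj₁ 0<1

  0≤fromℕ : ∀ n → 0# ≤ fromℕ n
  0≤fromℕ zero    = ≤.refl
  0≤fromℕ (suc n) = 0≤1 +0 0≤fromℕ n

  fromℕ-mono : ∀ {m n} → m ℕ.≤ n → fromℕ m ≤ fromℕ n
  fromℕ-mono {n = n} ℕ.z≤n = 0≤fromℕ n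
  fromℕ-mono (ℕ.s≤s h) = +-mono-≤ ≤.refl (fromℕ-mono h)

  1≤fromℕ : ∀ {n} → 1 ℕ.≤ n → 1# ≤ fromℕ n
  1≤fromℕ h = sym fromℕ-1 ≈≤ fromℕ-mono h

  ≤⇒≯ : ∀ {a b} → a ≤ b → ¬ (b < a)
  ≤⇒≯ a≤b (b≤a , b≉a) = b≉a (≤.antisym b≤a a≤b)

  ≰⇒> : ∀ {a b} → ¬ (a ≤ b) → b < a
  ≰⇒> = ToStrict.≰⇒> _≈_ _≤_ sym ≤.reflexive ≤.total

  ≰⇒≥ : ∀ {a b} → ¬ (a ≤ b) → b ≤ a
  ≰⇒≥ h = proj₁ (≰⇒> h)

  ≮⇒≥ : ∀ {a b} → ¬ (a < b) → b ≤ a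
  ≮⇒≥ {a} {b} h with b ≤.≤? a
  ... | yes p = p
  ... | no ¬p = ⊥-elim (h (≰⇒> ¬p))

  <⇒≱ : ∀ {a b} → a < b → ¬ (b ≤ a)
  <⇒≱ p q = ≤⇒≯ q p

  1≰0 : ¬ (1# ≤ 0#)
  1≰0 = <⇒≱ 0<1

  fromℕ-cancel-≤ : ∀ {m n} → fromℕ m ≤ fromℕ n → m ℕ.≤ n
  fromℕ-cancel-≤ {m} {n} h with m ℕ.≤? n
  ... | yes p = p
  ... | no ¬p = ⊥-elim (1≰0 (≤-cert
          (solve 1 (λ n → κ 0 :- κ 1 := n :- (κ 1 :+ n)) refl (fromℕ n))
          (≤⇒0≤- (≤.trans (fromℕ-mono (ℕ.≰⇒> ¬p)) h))))

  ≤-≉⇒< : ∀ {a b c} → a < b → b ≤ c → a < c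
  ≤-≉⇒< p q = ≤.trans (proj₁ p) q , λ e → <⇒≱ p (q ≤≈ sym e)

  0<fromℕ : ∀ {n} → 1 ℕ.≤ n → 0# < fromℕ n
  0<fromℕ h = ≤-≉⇒< 0<1 (1≤fromℕ h)

  1≤⇒0< : ∀ {a} → 1# ≤ a → 0# < a
  1≤⇒0< = ≤-≉⇒< 0<1

  *-inverse : ∀ {x} → 0# < x → x * x ⁻¹ ≈ 1#
  *-inverse (_ , 0≉x) = ⁻¹-inverse (λ e → 0≉x (sym e))

  0≤⁻¹ : ∀ {x} → 0# < x → 0# ≤ x ⁻¹
  0≤⁻¹ {x} 0<x with 0# ≤.≤? x ⁻¹
  ... | yes p = p
  ... | no ¬p = ⊥-elim (1≰0 (sym (*-inverse 0<x) ≈≤ ≤-cert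
    (solve 2 (λ x y → κ 0 :- x :* y := x :* (κ 0 :- y)) refl x (x ⁻¹))
    (proj₁ 0<x *0 ≤⇒0≤- (≰⇒≥ ¬p))))

  *-cancelˡ-≤ : ∀ {a b} c → 0# < c → c * a ≤ c * b → a ≤ b
  *-cancelˡ-≤ {a} {b} c 0<c h = un a ≈≤ *-monoˡ-≤ (c ⁻¹) (0≤⁻¹ 0<c) h ≤≈ sym (un b)
    where
    un : ∀ x → x ≈ c ⁻¹ * (c * x)
    un x = sym (trans (sym (*-assoc _ _ _))
      (trans (*-congʳ (trans (*-comm _ _) (*-inverse 0<c))) (*-identityˡ x)))

  *-cancelˡ-≈ : ∀ {a b} c → 0# < c → c * a ≈ c * b → a ≈ b
  *-cancelˡ-≈ c 0<c h = ≤.antisym (*-cancelˡ-≤ c 0<c (≤.reflexive h))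
                                  (*-cancelˡ-≤ c 0<c (≤.reflexive (sym h)))

  -- Only meaningful for n ≥ 1.
  recip : ℕ → ℝ
  recip n = fromℕ n ⁻¹

  recip-inverse : ∀ {n} → 1 ℕ.≤ n → fromℕ n * recip n ≈ 1#
  recip-inverse h = *-inverse (0<fromℕ h)

  0≤recip : ∀ {n} → 1 ℕ.≤ n → 0# ≤ recip n
  0≤recip h = 0≤⁻¹ (0<fromℕ h)

  ⁻¹-unique : ∀ {x y} → 0# < x → x * y ≈ 1# → y ≈ x ⁻¹
  ⁻¹-unique {x} 0<x e = *-cancelˡ-≈ x 0<x (trans e (sym (*-inverse 0<x)))

  recip-antitone : ∀ {m n} → 1 ℕ.≤ m → m ℕ.≤ n → recip n ≤ recip m
  recip-antitone {m} {n} 1≤m m≤n = ≤-cert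
    -- The solver treats reciprocals as atoms, so 1/m - 1/n = (n - m)/(mn) holds only up to
    -- multiples of `m * i - 1` and `1 - n * j`; these are the extra summands, and they vanish.
    (solve 4 (λ m n i j → i :- j := i :* j :* (n :- m)
        :+ (j :* (m :* i :- κ 1) :+ i :* (κ 1 :- n :* j))) refl (fromℕ m) (fromℕ n) (recip m) (recip n))
    ((0≤recip 1≤m *0 0≤recip (ℕ.≤-trans 1≤m m≤n) *0 ≤⇒0≤- (fromℕ-mono m≤n))
      +0 ≤.reflexive (sym (≈0-* _ (≈⇒-≈0 (recip-inverse 1≤m))
          0+0 ≈0-* _ (≈⇒-≈0 (sym (recip-inverse (ℕ.≤-trans 1≤m m≤n)))))))

  recip-≤1 : ∀ {n} → 1 ℕ.≤ n → recip n ≤ 1#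
  recip-≤1 {n} h = recip-antitone ℕ.≤-refl h ≤≈
    sym (⁻¹-unique (0<fromℕ ℕ.≤-refl) (trans (*-identityʳ _) fromℕ-1))

  recip-* : ∀ {m n} → 1 ℕ.≤ m → 1 ℕ.≤ n → recip (m ℕ.* n) ≈ recip m * recip n
  recip-* {m} {n} 1≤m 1≤n = sym (⁻¹-unique (0<fromℕ (ℕ.*-mono-≤ 1≤m 1≤n)) (begin
    fromℕ (m ℕ.* n) * (recip m * recip n)             ≈⟨ *-congʳ (fromℕ-* m n) ⟩
    fromℕ m * fromℕ n * (recip m * recip n)           ≈⟨ solve 4 (λ a b c d → a :* b :* (c :* d) := (a :* c) :* (b :* d)) refl _ _ _ _ ⟩
    (fromℕ m * recip m) * (fromℕ n * recip n)         ≈⟨ *-cong (recip-inverse 1≤m) (recip-inverse 1≤n) ⟩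
    1# * 1#                                           ≈⟨ *-identityʳ 1# ⟩
    1#                                                ∎))

  ∣∣-of-≥0 : ∀ {x} → 0# ≤ x → ∣ x ∣ ≈ x
  ∣∣-of-≥0 {x} h with 0# ≤.≤? x
  ... | yes _ = refl
  ... | no ¬h = ⊥-elim (¬h h)

  ∣∣-of-≤0 : ∀ {x} → x ≤ 0# → ∣ x ∣ ≈ - x
  ∣∣-of-≤0 {x} h with 0# ≤.≤? x
  ... | yes p = trans (≤.antisym h p) (trans (sym -0#≈0#) (-‿cong (≤.antisym p h)))
  ... | no  _ = refl

  x≤∣x∣ : ∀ x → x ≤ ∣ x ∣
  x≤∣x∣ x with ≤.total 0# x
  ... | inj₁ p = ≤.reflexive (sym (∣∣-of-≥0 p))
  ... | inj₂ p = ≤.trans p ((sym -0#≈0# ≈≤ neg-mono-≤ p) ≤≈ sym (∣∣-of-≤0 p))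

  -x≤∣x∣ : ∀ x → - x ≤ ∣ x ∣
  -x≤∣x∣ x with ≤.total 0# x
  ... | inj₁ p = ≤.trans (neg-mono-≤ p ≤≈ -0#≈0#) (p ≤≈ sym (∣∣-of-≥0 p))
  ... | inj₂ p = ≤.reflexive (sym (∣∣-of-≤0 p))

  ∣x∣≤ : ∀ {x b} → x ≤ b → - x ≤ b → ∣ x ∣ ≤ b
  ∣x∣≤ {x} p q with 0# ≤.≤? x
  ... | yes _ = p
  ... | no  _ = q

  0≤∣x∣ : ∀ x → 0# ≤ ∣ x ∣
  0≤∣x∣ x with 0# ≤.≤? x
  ... | yes p = p
  ... | no ¬p = sym -0#≈0# ≈≤ neg-mono-≤ (≰⇒≥ ¬p)

  ∣∣-mono : ∀ {x y b} → x ≈ y → ∣ y ∣ ≤ b → ∣ x ∣ ≤ b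
  ∣∣-mono {x} {y} e h = ∣x∣≤ (e ≈≤ ≤.trans (x≤∣x∣ y) h) (-‿cong e ≈≤ ≤.trans (-x≤∣x∣ y) h)

  ∣∣-cong : ∀ {x y} → x ≈ y → ∣ x ∣ ≈ ∣ y ∣
  ∣∣-cong e = ≤.antisym (∣∣-mono e ≤.refl) (∣∣-mono (sym e) ≤.refl)

  ∣x+y∣≤ : ∀ x y → ∣ x + y ∣ ≤ ∣ x ∣ + ∣ y ∣
  ∣x+y∣≤ x y = ∣x∣≤ (+-mono-≤ (x≤∣x∣ x) (x≤∣x∣ y))
    (sym (-‿+-comm x y) ≈≤ +-mono-≤ (-x≤∣x∣ x) (-x≤∣x∣ y))

  ∣∣-+-≤ : ∀ {x y a b} → ∣ x ∣ ≤ a → ∣ y ∣ ≤ b → ∣ x + y ∣ ≤ a + b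
  ∣∣-+-≤ p q = ≤.trans (∣x+y∣≤ _ _) (+-mono-≤ p q)

  ∣-x∣ : ∀ x → ∣ - x ∣ ≈ ∣ x ∣
  ∣-x∣ x = ≤.antisym (∣x∣≤ (-x≤∣x∣ x) (-‿involutive x ≈≤ x≤∣x∣ x))
    (∣x∣≤ (sym (-‿involutive x) ≈≤ -x≤∣x∣ (- x)) (x≤∣x∣ (- x)))

  ∣∣-sub-≤ : ∀ {x y a b} → ∣ x ∣ ≤ a → ∣ y ∣ ≤ b → ∣ x - y ∣ ≤ a + b
  ∣∣-sub-≤ p q = ∣∣-+-≤ p (∣-x∣ _ ≈≤ q)

  ∣c*x∣ : ∀ {c} x → 0# ≤ c → ∣ c * x ∣ ≈ c * ∣ x ∣
  ∣c*x∣ {c} x 0≤c with ≤.total 0# x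
  ... | inj₁ p = trans (∣∣-of-≥0 (0≤c *0 p)) (*-congˡ (sym (∣∣-of-≥0 p)))
  ... | inj₂ p = trans (∣∣-of-≤0 (*-monoˡ-≤ c 0≤c p ≤≈ zeroʳ c))
                 (trans (-‿distribʳ-* c x) (*-congˡ (sym (∣∣-of-≤0 p))))

  ∣x*y∣ : ∀ x y → ∣ x * y ∣ ≈ ∣ x ∣ * ∣ y ∣
  ∣x*y∣ x y with ≤.total 0# x
  ... | inj₁ p = trans (∣c*x∣ y p) (*-congʳ (sym (∣∣-of-≥0 p)))
  ... | inj₂ p = begin
    ∣ x * y ∣        ≈⟨ ∣-x∣ _ ⟨
    ∣ - (x * y) ∣    ≈⟨ ∣∣-cong (-‿distribˡ-* x y) ⟩
    ∣ - x * y ∣      ≈⟨ ∣c*x∣ y (sym -0#≈0# ≈≤ neg-mono-≤ p) ⟩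
    - x * ∣ y ∣      ≈⟨ *-congʳ (∣∣-of-≤0 p) ⟨
    ∣ x ∣ * ∣ y ∣    ∎

  ∣∣-*-≤ : ∀ {x y a b} → ∣ x ∣ ≤ a → ∣ y ∣ ≤ b → ∣ x * y ∣ ≤ a * b
  ∣∣-*-≤ {x} {y} p q = ∣x*y∣ x y ≈≤ *-mono-≤ (0≤∣x∣ x) (≤.trans (0≤∣x∣ y) q) p q

range : ℕ → List ℕ
range zero    = []
range (suc n) = suc n ∷ range n

∈-range⁻ : ∀ {n k} → k ∈ range n → 1 ℕ.≤ k × k ℕ.≤ n
∈-range⁻ {suc n} (here ≡.refl) = ℕ.s≤s ℕ.z≤n , ℕ.≤-refl
∈-range⁻ {suc n} (there h) with ∈-range⁻ h
... | 1≤k , k≤n = 1≤k , ℕ.m≤n⇒m≤1+n k≤n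

∈-range⁺ : ∀ {n k} → 1 ℕ.≤ k → k ℕ.≤ n → k ∈ range n
∈-range⁺ {zero}  1≤k k≤n = ⊥-elim (ℕ.<⇒≱ 1≤k k≤n)
∈-range⁺ {suc n} {k} 1≤k k≤n with k ℕ.≟ suc n
... | yes ≡.refl = here ≡.refl
... | no  k≢     = there (∈-range⁺ 1≤k (ℕ.s≤s⁻¹ (ℕ.≤∧≢⇒< k≤n k≢)))

range-unique : ∀ n → Unique (range n)
range-unique zero    = []
range-unique (suc n) =
  All.tabulate (λ h e → ℕ.<-irrefl (≡.sym e) (ℕ.s≤s (proj₂ (∈-range⁻ h)))) ∷ range-unique n

module FiniteSums (𝓡 : RealNumbers) where

  open OrderedField 𝓡
  open SetoidReasoning setoid

  private
    variable
      A B : Set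

  Σ : List A → (A → ℝ) → ℝ
  Σ []       f = 0#
  Σ (x ∷ xs) f = f x + Σ xs f

  Σ-cong : ∀ (xs : List A) {f g : A → ℝ} → (∀ {x} → x ∈ xs → f x ≈ g x) → Σ xs f ≈ Σ xs g
  Σ-cong []       h = refl
  Σ-cong (x ∷ xs) h = +-cong (h (here ≡.refl)) (Σ-cong xs (λ m → h (there m)))

  Σ-mono : ∀ (xs : List A) {f g : A → ℝ} → (∀ {x} → x ∈ xs → f x ≤ g x) → Σ xs f ≤ Σ xs g
  Σ-mono []       h = ≤.refl
  Σ-mono (x ∷ xs) h = +-mono-≤ (h (here ≡.refl)) (Σ-mono xs (λ m → h (there m)))

  Σ-0 : ∀ (xs : List A) {f : A → ℝ} → (∀ {x} → x ∈ xs → f x ≈ 0#) → Σ xs f ≈ 0#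
  Σ-0 []       h = refl
  Σ-0 (x ∷ xs) h = h (here ≡.refl) 0+0 Σ-0 xs (λ m → h (there m))

  0≤Σ : ∀ (xs : List A) {f : A → ℝ} → (∀ {x} → x ∈ xs → 0# ≤ f x) → 0# ≤ Σ xs f
  0≤Σ []       h = ≤.refl
  0≤Σ (x ∷ xs) h = h (here ≡.refl) +0 0≤Σ xs (λ m → h (there m))

  Σ-+ : ∀ (xs : List A) (f g : A → ℝ) → Σ xs (λ x → f x + g x) ≈ Σ xs f + Σ xs g
  Σ-+ []       f g = sym (+-identityʳ 0#)
  Σ-+ (x ∷ xs) f g = trans (+-congˡ (Σ-+ xs f g))
    (solve 4 (λ a b c d → a :+ b :+ (c :+ d) := a :+ c :+ (b :+ d)) refl (f x) (g x) _ _)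

  Σ-*ˡ : ∀ (xs : List A) c (f : A → ℝ) → Σ xs (λ x → c * f x) ≈ c * Σ xs f
  Σ-*ˡ []       c f = sym (zeroʳ c)
  Σ-*ˡ (x ∷ xs) c f = trans (+-congˡ (Σ-*ˡ xs c f)) (sym (distribˡ c _ _))

  Σ-neg : ∀ (xs : List A) (f : A → ℝ) → Σ xs (λ x → - f x) ≈ - Σ xs f
  Σ-neg []       f = sym -0#≈0#
  Σ-neg (x ∷ xs) f = trans (+-congˡ (Σ-neg xs f)) (-‿+-comm _ _)

  Σ-sub : ∀ (xs : List A) (f g : A → ℝ) → Σ xs (λ x → f x - g x) ≈ Σ xs f - Σ xs g
  Σ-sub xs f g = trans (Σ-+ xs f (λ x → - g x)) (+-congˡ (Σ-neg xs g))

  Σ-const : ∀ (xs : List A) c → Σ xs (λ _ → c) ≈ fromℕ (length xs) * c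
  Σ-const []       c = sym (zeroˡ c)
  Σ-const (x ∷ xs) c = trans (+-congˡ (Σ-const xs c))
    (solve 2 (λ n c → c :+ n :* c := (κ 1 :+ n) :* c) refl _ c)

  Σ-swap : ∀ (xs : List A) (ys : List B) (f : A → B → ℝ) →
    Σ xs (λ x → Σ ys (f x)) ≈ Σ ys (λ y → Σ xs (λ x → f x y))
  Σ-swap []       ys f = sym (Σ-0 ys (λ _ → refl))
  Σ-swap (x ∷ xs) ys f = trans (+-congˡ (Σ-swap xs ys f))
    (sym (Σ-+ ys (f x) (λ y → Σ xs (λ x → f x y))))

  ∣Σ∣≤ : ∀ (xs : List A) (f : A → ℝ) → ∣ Σ xs f ∣ ≤ Σ xs (λ x → ∣ f x ∣)
  ∣Σ∣≤ []       f = ≤.reflexive (∣∣-of-≥0 ≤.refl)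
  ∣Σ∣≤ (x ∷ xs) f = ∣∣-+-≤ ≤.refl (∣Σ∣≤ xs f)

  ∣Σ∣≤Σ : ∀ (xs : List A) {f g : A → ℝ} → (∀ {x} → x ∈ xs → ∣ f x ∣ ≤ g x) → ∣ Σ xs f ∣ ≤ Σ xs g
  ∣Σ∣≤Σ xs h = ≤.trans (∣Σ∣≤ xs _) (Σ-mono xs h)

  Σ-++ : ∀ (xs ys : List A) (f : A → ℝ) → Σ (xs ++ ys) f ≈ Σ xs f + Σ ys f
  Σ-++ []       ys f = sym (+-identityˡ _)
  Σ-++ (x ∷ xs) ys f = trans (+-congˡ (Σ-++ xs ys f)) (sym (+-assoc _ _ _))

  Σ-map : ∀ (g : A → B) (xs : List A) (f : B → ℝ) → Σ (map g xs) f ≈ Σ xs (λ x → f (g x))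
  Σ-map g []       f = refl
  Σ-map g (x ∷ xs) f = +-congˡ (Σ-map g xs f)

  Σ-cartesianProduct : ∀ (xs : List A) (ys : List B) (f : A × B → ℝ) →
    Σ (cartesianProduct xs ys) f ≈ Σ xs (λ x → Σ ys (λ y → f (x , y)))
  Σ-cartesianProduct []       ys f = refl
  Σ-cartesianProduct (x ∷ xs) ys f = trans (Σ-++ (map (x ,_) ys) _ f)
    (+-cong (Σ-map (x ,_) ys f) (Σ-cartesianProduct xs ys f))

  Σ-range-+ : ∀ m n (f : ℕ → ℝ) →
    Σ (range (m ℕ.+ n)) f ≈ Σ (range m) f + Σ (range n) (λ k → f (m ℕ.+ k))
  Σ-range-+ m zero    f rewrite ℕ.+-identityʳ m = sym (+-identityʳ _)
  Σ-range-+ m (suc n) f rewrite ℕ.+-suc m n = trans (+-congˡ (Σ-range-+ m n f))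
    (solve 3 (λ a b c → a :+ (b :+ c) := b :+ (a :+ c)) refl (f (suc (m ℕ.+ n))) _ _)

  Σ-range-≤ : ∀ {m n} {f : ℕ → ℝ} → m ℕ.≤ n → (∀ {k} → k ∈ range n → 0# ≤ f k) →
    Σ (range m) f ≤ Σ (range n) f
  Σ-range-≤ {m} {n} {f} m≤n h with ℕ.m≤n⇒∃[o]m+o≡n m≤n
  ... | o , ≡.refl = ≤-cert (trans (+-congʳ (Σ-range-+ m o f))
        (solve 2 (λ a b → a :+ b :- a := b) refl _ _))
      (0≤Σ (range o) λ {k} k∈ → h (∈-range⁺
        (ℕ.≤-trans (proj₁ (∈-range⁻ k∈)) (ℕ.m≤n+m k m))
        (ℕ.+-monoʳ-≤ m (proj₂ (∈-range⁻ k∈)))))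

  Σ-range-extend : ∀ {m n} {f : ℕ → ℝ} → m ℕ.≤ n → (∀ {k} → m ℕ.< k → f k ≈ 0#) →
    Σ (range n) f ≈ Σ (range m) f
  Σ-range-extend {m} {n} {f} m≤n h with ℕ.m≤n⇒∃[o]m+o≡n m≤n
  ... | o , ≡.refl = trans (Σ-range-+ m o f) (trans (+-congˡ (Σ-0 (range o) λ {k} k∈ →
          h (ℕ.m<m+n m (proj₁ (∈-range⁻ k∈))))) (+-identityʳ _))

  Σ-upTo : ∀ n (f : ℕ → ℝ) → Σ (upTo (suc n)) f ≈ f 0 + Σ (range n) f
  Σ-upTo n f = +-congˡ (go n)
    where
    go : ∀ n → Σ (applyUpTo suc n) f ≈ Σ (range n) f
    go zero    = refl
    go (suc n) = begin
      Σ (applyUpTo suc (suc n)) f               ≡⟨ ≡.cong (λ xs → Σ xs f) (applyUpTo-∷ʳ suc n) ⟨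
      Σ (applyUpTo suc n ++ suc n ∷ []) f       ≈⟨ Σ-++ (applyUpTo suc n) _ f ⟩
      Σ (applyUpTo suc n) f + (f (suc n) + 0#)  ≈⟨ +-cong (go n) (+-identityʳ _) ⟩
      Σ (range n) f + f (suc n)                 ≈⟨ +-comm _ _ ⟩
      Σ (range (suc n)) f                       ∎

  ∑-range : ∀ n (f : ℕ → ℝ) → (∑[ i < n ] f (suc (toℕ i))) ≈ Σ (range n) f
  ∑-range zero    f = refl
  ∑-range (suc n) f = trans (+-congˡ (∑-range n (λ k → f (suc k)))) (sym (Σ-range-suc n))
    where
    Σ-range-suc : ∀ n → Σ (range (suc n)) f ≈ f 1 + Σ (range n) (λ k → f (suc k))
    Σ-range-suc n = trans (Σ-range-+ 1 n f) (+-congʳ (+-identityʳ _))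

  length-range : ∀ n → length (range n) ≡ n
  length-range zero    = ≡.refl
  length-range (suc n) = ≡.cong suc (length-range n)

  Σ-range-const : ∀ n c → Σ (range n) (λ _ → c) ≈ fromℕ n * c
  Σ-range-const n c = trans (Σ-const (range n) c) (*-congʳ (fromℕ-cong (length-range n)))

  𝟙 : {P : Set} → Dec P → ℝ
  𝟙 P? = if does P? then 1# else 0#

  𝟙-yes : {P : Set} (P? : Dec P) → P → 𝟙 P? ≈ 1#
  𝟙-yes (yes _) p = refl
  𝟙-yes (no ¬p) p = ⊥-elim (¬p p)

  𝟙-no : {P : Set} (P? : Dec P) → ¬ P → 𝟙 P? ≈ 0#
  𝟙-no (yes p) ¬p = ⊥-elim (¬p p)
  𝟙-no (no _)  ¬p = refl

  0≤𝟙 : {P : Set} (P? : Dec P) → 0# ≤ 𝟙 P?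
  0≤𝟙 (yes _) = 0≤1
  0≤𝟙 (no _)  = ≤.refl

  𝟙≤1 : {P : Set} (P? : Dec P) → 𝟙 P? ≤ 1#
  𝟙≤1 (yes _) = ≤.refl
  𝟙≤1 (no _)  = 0≤1

  𝟙-mono : {P Q : Set} (P? : Dec P) (Q? : Dec Q) → (P → Q) → 𝟙 P? ≤ 𝟙 Q?
  𝟙-mono (yes p) Q? h = ≤.reflexive (sym (𝟙-yes Q? (h p)))
  𝟙-mono (no _)  Q? h = 0≤𝟙 Q?

  𝟙-cong : {P Q : Set} (P? : Dec P) (Q? : Dec Q) → (P → Q) → (Q → P) → 𝟙 P? ≈ 𝟙 Q?
  𝟙-cong P? Q? f g = ≤.antisym (𝟙-mono P? Q? f) (𝟙-mono Q? P? g)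

  length-filter : ∀ {P : Pred A _} (P? : Decidable P) xs →
    fromℕ (length (filter P? xs)) ≈ Σ xs (λ x → 𝟙 (P? x))
  length-filter P? []       = refl
  length-filter P? (x ∷ xs) with P? x
  ... | yes _ = +-congˡ (length-filter P? xs)
  ... | no  _ = trans (length-filter P? xs) (sym (+-identityˡ _))

  Σ-𝟙-≤1 : ∀ {P : A → Set} (P? : ∀ x → Dec (P x)) {xs} → Unique xs →
    (∀ {x y} → x ∈ xs → y ∈ xs → P x → P y → x ≡ y) → Σ xs (λ x → 𝟙 (P? x)) ≤ 1#
  Σ-𝟙-≤1 P? {[]} _ _ = 0≤1
  Σ-𝟙-≤1 P? {x ∷ xs} (x∉ ∷ u) h with P? x
  ... | no  _ = +-identityˡ _ ≈≤ Σ-𝟙-≤1 P? u (λ m n → h (there m) (there n))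
  ... | yes p = ≤.reflexive (trans (+-congˡ (Σ-0 xs λ {y} m → 𝟙-no (P? y)
                  λ q → All.lookup x∉ m (h (here ≡.refl) (there m) p q))) (+-identityʳ 1#))

  ≤-Σ : ∀ {xs : List A} {x} {f : A → ℝ} → (∀ {y} → y ∈ xs → 0# ≤ f y) → x ∈ xs → f x ≤ Σ xs f
  ≤-Σ {xs = x ∷ xs} h (here ≡.refl) = sym (+-identityʳ _) ≈≤
    +-mono-≤ ≤.refl (0≤Σ xs (λ m → h (there m)))
  ≤-Σ {xs = x ∷ xs} h (there m) = sym (+-identityˡ _) ≈≤
    +-mono-≤ (h (here ≡.refl)) (≤-Σ (λ m → h (there m)) m)

  -- Double counting along a relation ρ under which every y has at most one x.
  Σ-≤-injective : ∀ {xs : List A} {ys : List B} {ρ : A → B → Set} (ρ? : ∀ x y → Dec (ρ x y))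
    {F : A → ℝ} {G : B → ℝ} → Unique xs →
    (∀ {y} → y ∈ ys → 0# ≤ G y) →
    (∀ {x} → x ∈ xs → F x ≤ 0# ⊎ ∃ λ y → y ∈ ys × ρ x y × F x ≤ G y) →
    (∀ {x x′ y} → x ∈ xs → x′ ∈ xs → y ∈ ys → ρ x y → ρ x′ y → x ≡ x′) →
    Σ xs F ≤ Σ ys G
  Σ-≤-injective {xs = xs} {ys} {ρ} ρ? {F} {G} u 0≤G cover inj =
    ≤.trans (Σ-mono xs bound) (Σ-swap xs ys (λ x y → 𝟙 (ρ? x y) * G y) ≈≤ Σ-mono ys column)
    where
    term≥0 : ∀ x {y} → y ∈ ys → 0# ≤ 𝟙 (ρ? x y) * G y
    term≥0 x {y} m = 0≤𝟙 (ρ? x y) *0 0≤G m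

    bound : ∀ {x} → x ∈ xs → F x ≤ Σ ys (λ y → 𝟙 (ρ? x y) * G y)
    bound {x} m with cover m
    ... | inj₁ F≤0 = ≤.trans F≤0 (0≤Σ ys (term≥0 x))
    ... | inj₂ (y , y∈ , r , F≤G) = ≤.trans F≤G
      (trans (sym (*-identityˡ _)) (*-congʳ (sym (𝟙-yes (ρ? x y) r))) ≈≤ ≤-Σ (term≥0 x) y∈)

    column : ∀ {y} → y ∈ ys → Σ xs (λ x → 𝟙 (ρ? x y) * G y) ≤ G y
    column {y} m = trans (Σ-cong xs (λ _ → *-comm _ _)) (Σ-*ˡ xs (G y) _) ≈≤
      (*-monoˡ-≤ (G y) (0≤G m) (Σ-𝟙-≤1 (λ x → ρ? x y) u (λ a b → inj a b m)) ≤≈ *-identityʳ _)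

  Σ-single : ∀ {xs : List A} {x} {f : A → ℝ} → Unique xs → x ∈ xs →
    (∀ {y} → y ∈ xs → ¬ (y ≡ x) → f y ≈ 0#) → Σ xs f ≈ f x
  Σ-single {xs = x ∷ xs} (x∉ ∷ u) (here ≡.refl) h = trans (+-congˡ (Σ-0 xs λ m →
    h (there m) (λ e → All.lookup x∉ m (≡.sym e)))) (+-identityʳ _)
  Σ-single {xs = z ∷ xs} (z∉ ∷ u) (there m) h = trans
    (+-cong (h (here ≡.refl) (λ e → All.lookup z∉ m e)) (Σ-single u m (λ n → h (there n))))
    (+-identityˡ _)

-- Harmonic and alternating sums.

even-or-odd : ∀ n → ∃ λ m → n ≡ m ℕ.+ m ⊎ n ≡ suc (m ℕ.+ m)
even-or-odd zero = 0 , inj₁ ≡.refl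
even-or-odd (suc n) with even-or-odd n
... | m , inj₁ ≡.refl = m , inj₂ ≡.refl
... | m , inj₂ ≡.refl = suc m , inj₁ (≡.cong suc (≡.sym (ℕ.+-suc m m)))

module Basel (𝓡 : RealNumbers) where

  open OrderedField 𝓡
  open FiniteSums 𝓡
  open SetoidReasoning setoid

  -- Fractions are brought to a common denominator by inserting factors such as `n * recip n`;
  -- afterwards the ring solver only has to rearrange a product.
  ·1 : ∀ {x u} → u ≈ 1# → x ≈ x * u
  ·1 e = sym (trans (*-congˡ e) (*-identityʳ _))

  harmonic : ℕ → ℝ
  harmonic n = Σ (range n) recip

  recip∈ : ∀ {n k} → k ∈ range n → 0# ≤ recip k
  recip∈ k∈ = 0≤recip (proj₁ (∈-range⁻ k∈))

  0≤harmonic : ∀ n → 0# ≤ harmonic n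
  0≤harmonic n = 0≤Σ (range n) (recip∈ {n})

  harmonic-mono : ∀ {m n} → m ℕ.≤ n → harmonic m ≤ harmonic n
  harmonic-mono {n = n} m≤n = Σ-range-≤ m≤n (recip∈ {n})

  recip-1 : recip 1 ≈ 1#
  recip-1 = sym (⁻¹-unique (0<fromℕ ℕ.≤-refl) (trans (*-identityʳ _) fromℕ-1))

  1≤harmonic : ∀ {n} → 1 ℕ.≤ n → 1# ≤ harmonic n
  1≤harmonic h = sym (trans (+-identityʳ _) recip-1) ≈≤ harmonic-mono h

  ε : ℕ → ℝ
  ε zero    = 1#
  ε (suc n) = - ε n

  ε-+ : ∀ m n → ε (m ℕ.+ n) ≈ ε m * ε n
  ε-+ zero    n = sym (*-identityˡ _)
  ε-+ (suc m) n = trans (-‿cong (ε-+ m n)) (-‿distribˡ-* _ _)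

  ε² : ∀ n → ε n * ε n ≈ 1#
  ε² zero    = *-identityʳ 1#
  ε² (suc n) = trans (solve 1 (λ x → :- x :* :- x := x :* x) refl (ε n)) (ε² n)

  ε-even : ∀ n → ε (n ℕ.+ n) ≈ 1#
  ε-even n = trans (ε-+ n n) (ε² n)

  ∣ε∣ : ∀ n → ∣ ε n ∣ ≈ 1#
  ∣ε∣ zero    = ∣∣-of-≥0 0≤1
  ∣ε∣ (suc n) = trans (∣-x∣ _) (∣ε∣ n)

  alt : (ℕ → ℝ) → ℕ → ℝ
  alt f n = Σ (range n) (λ k → ε (pred k) * f (pred k))

  alt-+ : ∀ f m n → alt f (m ℕ.+ n) ≈ alt f m + ε m * alt (λ k → f (m ℕ.+ k)) n
  alt-+ f m n = trans (Σ-range-+ m n _) (+-congˡ (trans (Σ-cong (range n) shift) (Σ-*ˡ (range n) (ε m) _)))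
    where
    shift : ∀ {k} → k ∈ range n → ε (pred (m ℕ.+ k)) * f (pred (m ℕ.+ k))
                                  ≈ ε m * (ε (pred k) * f (m ℕ.+ pred k))
    shift {k} k∈ with k | proj₁ (∈-range⁻ k∈)
    ... | suc i | _ rewrite ℕ.+-suc m i = trans (*-congʳ (ε-+ m i)) (*-assoc _ _ _)

  alt-suc : ∀ f n → alt f (suc n) ≈ f 0 - alt (λ k → f (suc k)) n
  alt-suc f n = trans (alt-+ f 1 n) (solve 2 (λ a b → κ 1 :* a :+ κ 0 :+ :- κ 1 :* b := a :- b) refl _ _)

  -- Splitting off the leading term subtracts the shifted sum, so each bound for `f` comes from the
  -- opposite bound for the shifted sequence; neither can be proved alone.
  alt-bounds : ∀ n {f} → (∀ k → 0# ≤ f k) → (∀ k → f (suc k) ≤ f k) → 0# ≤ alt f n × alt f n ≤ f 0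
  alt-bounds zero    0≤f anti = ≤.refl , 0≤f 0
  alt-bounds (suc n) {f} 0≤f anti with alt-bounds n {λ k → f (suc k)} (λ k → 0≤f (suc k)) (λ k → anti (suc k))
  ... | lo , hi = (≤⇒0≤- (≤.trans hi (anti 0)) ≤≈ sym (alt-suc f n)) ,
                  (alt-suc f n ≈≤ ≤-cert (solve 2 (λ a b → a :- (a :- b) := b) refl _ _) lo)

  alt-close : ∀ m n {f} → (∀ k → 0# ≤ f k) → (∀ k → f (suc k) ≤ f k) → ∣ alt f (m ℕ.+ n) - alt f m ∣ ≤ f m
  alt-close m n {f} 0≤f anti = ∣∣-mono
    (trans (+-congʳ (alt-+ f m n)) (solve 2 (λ a b → a :+ b :- a := b) refl _ _))
    (∣x*y∣ _ _ ≈≤ (*-congʳ (∣ε∣ m) ≈≤ (trans (*-identityˡ _) (∣∣-of-≥0 (proj₁ tail)) ≈≤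
      (proj₂ tail ≤≈ reflexive (≡.cong f (ℕ.+-identityʳ m))))))
    where
    tail = alt-bounds n {λ k → f (m ℕ.+ k)} (λ k → 0≤f (m ℕ.+ k))
      (λ k → reflexive (≡.cong f (ℕ.+-suc m k)) ≈≤ anti (m ℕ.+ k))

  Σ-range-reverse : ∀ n (f : ℕ → ℝ) → Σ (range n) (λ k → f (n ℕ.∸ k)) ≈ Σ (range n) (λ k → f (pred k))
  Σ-range-reverse zero    f = refl
  Σ-range-reverse (suc n) f = begin
    Σ (range (1 ℕ.+ n)) (λ k → f (suc n ℕ.∸ k))
      ≈⟨ Σ-range-+ 1 n _ ⟩
    f n + 0# + Σ (range n) (λ k → f (n ℕ.∸ k))
      ≈⟨ +-cong (+-identityʳ _) (Σ-range-reverse n f) ⟩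
    f n + Σ (range n) (λ k → f (pred k)) ∎

  -- The square of the Leibniz sum as a finite identity.

  r g : ℕ → ℝ
  r i = recip (suc i)
  g i = recip (suc (i ℕ.+ i))

  r-inverse : ∀ i → fromℕ (suc i) * r i ≈ 1#
  r-inverse i = recip-inverse {suc i} (ℕ.s≤s ℕ.z≤n)

  0≤r : ∀ i → 0# ≤ r i
  0≤r i = 0≤recip {suc i} (ℕ.s≤s ℕ.z≤n)

  0≤g : ∀ i → 0# ≤ g i
  0≤g i = 0≤r (i ℕ.+ i)

  r-antitone : ∀ {i j} → i ℕ.≤ j → r j ≤ r i
  r-antitone h = recip-antitone (ℕ.s≤s ℕ.z≤n) (ℕ.s≤s h)

  g-anti : ∀ i → g (suc i) ≤ g i
  g-anti i = r-antitone (ℕ.m≤n⇒m≤1+n (ℕ.+-monoʳ-≤ i (ℕ.n≤1+n i)))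

  P O a : ℕ → ℝ
  P = alt g
  a = alt r
  O n = Σ (range n) (λ k → g (pred k) * g (pred k))

  -- The off-diagonal part of the square. With 1/((2i+1)(2j+1)) split into partial fractions, the
  -- inner sum is Σ (-1)^k/k over k = j - i ≠ 0; opposite values of k cancel, and for i ≥ 0 only the
  -- window N - i ≤ m ≤ N + i of 1 - 1/2 + 1/3 - ⋯ is left, written here as a difference of two
  -- values of `a`.
  Q : ℕ → ℝ
  Q n = Σ (range n) (λ k → g (pred k) * (a (n ℕ.+ pred k) - a (n ℕ.∸ k)))

  a-suc : ∀ n → a (suc n) ≈ a n + ε n * r n
  a-suc n = +-comm _ _

  private
    -- For A = N - i and B = N + i + 1 one has A + B = 2N + 1 and B - A = 2i + 1, and the claim is
    -- (A + B)² = 4AB + (B - A)² divided by AB(A + B)(B - A).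
    partial-fractions : ∀ i j → let N = suc (i ℕ.+ j) in
      g i * (r (N ℕ.+ i) + r j) ≈ fromℕ 4 * (g i * g N) + g N * (r j - r (N ℕ.+ i))
    partial-fractions i j = begin
      gi * (rb + ra)
        ≈⟨ solve 3 (λ gi ra rb → gi :* (rb :+ ra) := gi :* rb :+ gi :* ra) refl gi ra rb ⟩
      gi * rb + gi * ra
        ≈⟨ +-cong (trans (·1 ea) (·1 eN)) (trans (·1 eb) (·1 eN)) ⟩
      gi * rb * (A * ra) * ((A + B) * gN) + gi * ra * (B * rb) * ((A + B) * gN)
        ≈⟨ solve 6 (λ A B ra rb gi gN →
             gi :* rb :* (A :* ra) :* ((A :+ B) :* gN) :+ gi :* ra :* (B :* rb) :* ((A :+ B) :* gN)
          := κ 4 :* (gi :* gN) :* (A :* ra) :* (B :* rb)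
             :+ (gN :* ra :* (B :* rb) :* ((B :- A) :* gi) :- gN :* rb :* (A :* ra) :* ((B :- A) :* gi)))
             refl A B ra rb gi gN ⟩
      fromℕ 4 * (gi * gN) * (A * ra) * (B * rb)
        + (gN * ra * (B * rb) * ((B - A) * gi) - gN * rb * (A * ra) * ((B - A) * gi))
        ≈⟨ +-cong (trans (·1 ea) (·1 eb)) (+-cong (trans (·1 eb) (·1 ei)) (-‿cong (trans (·1 ea) (·1 ei)))) ⟨
      fromℕ 4 * (gi * gN) + (gN * ra - gN * rb)
        ≈⟨ solve 4 (λ gi gN ra rb → κ 4 :* (gi :* gN) :+ (gN :* ra :- gN :* rb)
             := κ 4 :* (gi :* gN) :+ gN :* (ra :- rb)) refl gi gN ra rb ⟩
      fromℕ 4 * (gi * gN) + gN * (ra - rb) ∎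
      where
      N = suc (i ℕ.+ j)
      A = fromℕ (suc j)
      B = fromℕ (suc (N ℕ.+ i))
      ra = r j
      rb = r (N ℕ.+ i)
      gi = g i
      gN = g N
      ea : A * ra ≈ 1#
      ea = r-inverse j
      eb : B * rb ≈ 1#
      eb = r-inverse (N ℕ.+ i)
      eN : (A + B) * gN ≈ 1#
      eN = trans (*-congʳ (trans (sym (fromℕ-+ (suc j) (suc (N ℕ.+ i)))) (fromℕ-cong (lem i j))))
                 (r-inverse (N ℕ.+ N))
        where
        lem : ∀ i j → suc j ℕ.+ suc (suc (i ℕ.+ j) ℕ.+ i) ≡ suc (suc (i ℕ.+ j) ℕ.+ suc (i ℕ.+ j))
        lem = solve-∀
      ei : (B - A) * gi ≈ 1#
      ei = trans (*-congʳ (trans (+-congʳ (trans (fromℕ-cong (lem i j)) (fromℕ-+ (suc (i ℕ.+ i)) (suc j))))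
             (solve 2 (λ x y → x :+ y :- y := x) refl _ _))) (r-inverse (i ℕ.+ i))
        where
        lem : ∀ i j → suc (suc (i ℕ.+ j) ℕ.+ i) ≡ suc (i ℕ.+ i) ℕ.+ suc j
        lem = solve-∀

    -- Raising N moves the window by one place: it loses its first term and gains a new last one.
    -- The window has odd length 2i + 1, so these two carry opposite signs and their contributions
    -- add up to the left side of `partial-fractions`.
    Q-step : ∀ i j → let N = suc (i ℕ.+ j) in
      g i * (a (suc N ℕ.+ i) - a (suc j)) ≈ g i * (a (N ℕ.+ i) - a j)
        + (fromℕ 4 * ε N * g N * (ε i * g i) - (g N * (ε j * r j) + g N * (ε (N ℕ.+ i) * r (N ℕ.+ i))))
    Q-step i j = begin
      g i * (a (suc N ℕ.+ i) - a (suc j))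
        ≈⟨ *-congˡ (+-cong (a-suc (N ℕ.+ i)) (-‿cong (a-suc j))) ⟩
      g i * (a (N ℕ.+ i) + ε (N ℕ.+ i) * r (N ℕ.+ i) - (a j + ε j * r j))
        ≈⟨ *-congˡ (+-cong (+-congˡ (*-congʳ e₁)) (-‿cong (+-congˡ (*-congʳ e₂)))) ⟩
      g i * (a (N ℕ.+ i) + e * r (N ℕ.+ i) - (a j + - e * r j))
        ≈⟨ solve 6 (λ gi x y e rb ra → gi :* (x :+ e :* rb :- (y :+ :- e :* ra))
             := gi :* (x :- y) :+ e :* (gi :* (rb :+ ra))) refl (g i) (a (N ℕ.+ i)) (a j) e (r (N ℕ.+ i)) (r j) ⟩
      g i * (a (N ℕ.+ i) - a j) + e * (g i * (r (N ℕ.+ i) + r j))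
        ≈⟨ +-congˡ (*-congˡ (partial-fractions i j)) ⟩
      g i * (a (N ℕ.+ i) - a j) + e * (fromℕ 4 * (g i * g N) + g N * (r j - r (N ℕ.+ i)))
        ≈⟨ +-congˡ (solve 6 (λ p q gi gN ra rb →
             p :* q :* (κ 4 :* (gi :* gN) :+ gN :* (ra :- rb))
          := κ 4 :* p :* gN :* (q :* gi) :- (gN :* (:- (p :* q) :* ra) :+ gN :* (p :* q :* rb)))
             refl (ε N) (ε i) (g i) (g N) (r j) (r (N ℕ.+ i))) ⟩
      g i * (a (N ℕ.+ i) - a j)
        + (fromℕ 4 * ε N * g N * (ε i * g i) - (g N * (- e * r j) + g N * (e * r (N ℕ.+ i))))
        ≈⟨ +-congˡ (+-congˡ (-‿cong (+-cong (*-congˡ (*-congʳ e₂)) (*-congˡ (*-congʳ e₁))))) ⟨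
      _ ∎
      where
      N = suc (i ℕ.+ j)
      e = ε N * ε i
      e₁ : ε (N ℕ.+ i) ≈ e
      e₁ = ε-+ N i
      e₂ : ε j ≈ - e
      e₂ = sym (begin
        - (- ε (i ℕ.+ j) * ε i)  ≈⟨ solve 2 (λ x y → :- (:- x :* y) := x :* y) refl _ _ ⟩
        ε (i ℕ.+ j) * ε i        ≈⟨ *-congʳ (ε-+ i j) ⟩
        ε i * ε j * ε i          ≈⟨ solve 2 (λ x y → x :* y :* x := x :* x :* y) refl _ _ ⟩
        ε i * ε i * ε j          ≈⟨ *-congʳ (ε² i) ⟩
        1# * ε j                 ≈⟨ *-identityˡ _ ⟩
        ε j                      ∎)

  -- Apart from the multiple of `P N`, the corrections of `Q-step` add up to `g N * a (N + N)`. The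
  -- new summand of index N is `g N * a (suc (N + N))`, whose last term `g N * g N` is all that
  -- survives the cancellation.
  Q-suc : ∀ N → Q (suc N) ≈ Q N + (fromℕ 4 * ε N * g N * P N + g N * g N)
  Q-suc N = begin
    g N * (a (suc N ℕ.+ N) - a (N ℕ.∸ N)) + Σ (range N) (λ k → g (pred k) * (a (suc N ℕ.+ pred k) - a (suc N ℕ.∸ k)))
      ≈⟨ +-cong (*-congˡ (+-congˡ (-‿cong (reflexive (≡.cong a (ℕ.n∸n≡0 N)))))) (Σ-cong (range N) step) ⟩
    g N * (a (suc N ℕ.+ N) - 0#) + Σ (range N) (λ k → old k + (c * p k - (g N * x k + g N * y k)))
      ≈⟨ +-cong (*-congˡ (+-congʳ (trans (a-suc (N ℕ.+ N)) (+-congˡ (trans (*-congʳ (ε-even N)) (*-identityˡ _))))))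
           (trans (Σ-+ (range N) old _) (+-congˡ (trans (Σ-sub (range N) (λ k → c * p k) _)
             (+-cong (Σ-*ˡ (range N) c p) (-‿cong (trans (Σ-+ (range N) _ _)
                (+-cong (trans (Σ-*ˡ (range N) (g N) x) (*-congˡ (Σ-range-reverse N (λ i → ε i * r i))))
                        (trans (Σ-*ˡ (range N) (g N) y) (*-congˡ tail))))))))) ⟩
    g N * (a (N ℕ.+ N) + g N - 0#) + (Q N + (c * P N - (g N * a N + g N * (a (N ℕ.+ N) - a N))))
      ≈⟨ solve 6 (λ gN aa q c p an → gN :* (aa :+ gN :- κ 0) :+ (q :+ (c :* p :- (gN :* an :+ gN :* (aa :- an))))
           := q :+ (c :* p :+ gN :* gN)) refl (g N) (a (N ℕ.+ N)) (Q N) c (P N) (a N) ⟩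
    Q N + (c * P N + g N * g N) ∎
    where
    c = fromℕ 4 * ε N * g N
    old p x y : ℕ → ℝ
    old k = g (pred k) * (a (N ℕ.+ pred k) - a (N ℕ.∸ k))
    p k = ε (pred k) * g (pred k)
    x k = ε (N ℕ.∸ k) * r (N ℕ.∸ k)
    y k = ε (N ℕ.+ pred k) * r (N ℕ.+ pred k)

    tail : Σ (range N) y ≈ a (N ℕ.+ N) - a N
    tail = begin
      Σ (range N) y
        ≈⟨ solve 2 (λ u v → v := u :+ v :- u) refl (a N) _ ⟩
      a N + Σ (range N) y - a N
        ≈⟨ +-congʳ (+-congˡ (Σ-cong (range N) λ {k} k∈ → shift k (proj₁ (∈-range⁻ k∈)))) ⟩
      a N + Σ (range N) (λ k → ε (pred (N ℕ.+ k)) * r (pred (N ℕ.+ k))) - a N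
        ≈⟨ +-congʳ (Σ-range-+ N N _) ⟨
      a (N ℕ.+ N) - a N ∎
      where
      shift : ∀ k → 1 ℕ.≤ k → y k ≈ ε (pred (N ℕ.+ k)) * r (pred (N ℕ.+ k))
      shift (suc i) _ rewrite ℕ.+-suc N i = refl

    step : ∀ {k} → k ∈ range N → g (pred k) * (a (suc N ℕ.+ pred k) - a (suc N ℕ.∸ k))
                                ≈ old k + (c * p k - (g N * x k + g N * y k))
    step {k} k∈ with k | ∈-range⁻ k∈
    ... | suc i | _ , i<N with ℕ.m≤n⇒∃[o]m+o≡n i<N
    ...   | j , ≡.refl rewrite ℕ.m+n∸m≡n i j | ≡.trans (≡.cong (ℕ._∸ i) (≡.sym (ℕ.+-suc i j))) (ℕ.m+n∸m≡n i (suc j)) = Q-step i j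

  -- The partial-fraction expansion of the square of Σ (−1)ⁱ/(2i+1) over
  -- −N ≤ i < N, folded to nonnegative indices; O N is its diagonal.
  leibniz-square : ∀ N → fromℕ 2 * (P N * P N) ≈ O N + Q N
  leibniz-square zero    = solve 0 (κ 2 :* (κ 0 :* κ 0) := κ 0 :+ κ 0) refl
  leibniz-square (suc N) = begin
    fromℕ 2 * ((e * G + P N) * (e * G + P N))
      ≈⟨ solve 3 (λ e G p → κ 2 :* ((e :* G :+ p) :* (e :* G :+ p))
           := κ 2 :* (p :* p) :+ (κ 4 :* e :* G :* p :+ κ 2 :* (e :* e) :* (G :* G))) refl e G (P N) ⟩
    fromℕ 2 * (P N * P N) + (fromℕ 4 * e * G * P N + fromℕ 2 * (e * e) * (G * G))
      ≈⟨ +-cong (leibniz-square N) (+-congˡ (*-congʳ (trans (*-congˡ (ε² N)) (*-identityʳ _)))) ⟩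
    O N + Q N + (fromℕ 4 * e * G * P N + fromℕ 2 * (G * G))
      ≈⟨ solve 4 (λ o q x G → o :+ q :+ (x :+ κ 2 :* (G :* G)) := G :* G :+ o :+ (q :+ (x :+ G :* G)))
           refl (O N) (Q N) _ G ⟩
    O (suc N) + (Q N + (fromℕ 4 * e * G * P N + G * G))
      ≈⟨ +-congˡ (Q-suc N) ⟨
    O (suc N) + Q (suc N) ∎
    where
    e = ε N
    G = g N

  suc-pred : ∀ {n k} → k ∈ range n → suc (pred k) ≡ k
  suc-pred {n} {zero}  k∈ = ⊥-elim (ℕ.<⇒≱ ℕ.z<s (proj₁ (∈-range⁻ {n} k∈)))
  suc-pred {n} {suc k} k∈ = ≡.refl

  g≤r : ∀ i → g i ≤ r i
  g≤r i = r-antitone (ℕ.m≤m+n i i)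

  -- A window is an alternating sum of decreasing terms and hence bounded by its first term 1/(N -
  -- i). Then 1/((2i+1)(N-i)) = (1/(N-i) + 2/(2i+1))/(2N+1), because 2N + 1 = (2i + 1) + 2(N - i);
  -- summed over i this is at most three harmonic sums.
  ∣Q∣≤ : ∀ {N} → ∣ Q N ∣ ≤ fromℕ 3 * (harmonic N * g N)
  ∣Q∣≤ {N} = ≤.trans (∣Σ∣≤Σ (range N) term) (total ≈≤ ≤-cert
      (solve 3 (λ h s gN → κ 3 :* (h :* gN) :- gN :* (h :+ κ 2 :* s) := κ 2 :* gN :* (h :- s)) refl _ _ _)
      (0≤fromℕ 2 *0 0≤g N *0 ≤⇒0≤- g-sum))
    where
    g-sum : Σ (range N) (λ k → g (pred k)) ≤ harmonic N
    g-sum = Σ-mono (range N) λ {k} k∈ → g≤r (pred k) ≤≈ reflexive (≡.cong recip (suc-pred {N} k∈))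

    r-sum : Σ (range N) (λ k → r (N ℕ.∸ k)) ≈ harmonic N
    r-sum = trans (Σ-range-reverse N r) (Σ-cong (range N) λ k∈ → reflexive (≡.cong recip (suc-pred {N} k∈)))

    total : Σ (range N) (λ k → g N * (r (N ℕ.∸ k) + fromℕ 2 * g (pred k)))
      ≈ g N * (harmonic N + fromℕ 2 * Σ (range N) (λ k → g (pred k)))
    total = trans (Σ-*ˡ (range N) (g N) _) (*-congˡ (trans (Σ-+ (range N) _ _)
      (+-cong r-sum (Σ-*ˡ (range N) (fromℕ 2) _))))

    term′ : ∀ i j → let N = suc (i ℕ.+ j) in
      ∣ g i * (a (N ℕ.+ i) - a j) ∣ ≤ g N * (r j + fromℕ 2 * g i)
    term′ i j = ∣c*x∣ _ (0≤g i) ≈≤ (*-monoˡ-≤ (g i) (0≤g i)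
        (≡.subst (λ n → ∣ a n - a j ∣ ≤ r j) (lem i j)
          (alt-close j (suc (i ℕ.+ i)) {r} 0≤r (λ k → r-antitone (ℕ.n≤1+n k)))) ≤≈ split)
      where
      M = suc (i ℕ.+ j)
      lem : ∀ i j → j ℕ.+ suc (i ℕ.+ i) ≡ suc (i ℕ.+ j) ℕ.+ i
      lem = solve-∀
      lem₂ : ∀ i j → suc ((suc (i ℕ.+ j)) ℕ.+ suc (i ℕ.+ j)) ≡ suc (i ℕ.+ i) ℕ.+ 2 ℕ.* suc j
      lem₂ = solve-∀
      X = fromℕ (suc (i ℕ.+ i))
      J = fromℕ (suc j)
      split : g i * r j ≈ g M * (r j + fromℕ 2 * g i)
      split = begin
        g i * r j                                          ≈⟨ ·1 (r-inverse (M ℕ.+ M)) ⟩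
        g i * r j * (fromℕ (suc (M ℕ.+ M)) * g M)          ≈⟨ *-congˡ (*-congʳ (trans (fromℕ-cong (lem₂ i j))
                                                               (trans (fromℕ-+ (suc (i ℕ.+ i)) _) (+-congˡ (fromℕ-* 2 (suc j)))))) ⟩
        g i * r j * ((X + fromℕ 2 * J) * g M)              ≈⟨ solve 5 (λ gi rj X J gN → gi :* rj :* ((X :+ κ 2 :* J) :* gN)
                                                               := gN :* (rj :* (X :* gi) :+ κ 2 :* gi :* (J :* rj)))
                                                               refl (g i) (r j) X J (g M) ⟩
        g M * (r j * (X * g i) + fromℕ 2 * g i * (J * r j)) ≈⟨ *-congˡ (+-cong (·1 (r-inverse (i ℕ.+ i))) (·1 (r-inverse j))) ⟨
        g M * (r j + fromℕ 2 * g i)                        ∎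

    term : ∀ {k} → k ∈ range N → ∣ g (pred k) * (a (N ℕ.+ pred k) - a (N ℕ.∸ k)) ∣
                               ≤ g N * (r (N ℕ.∸ k) + fromℕ 2 * g (pred k))
    term {k} k∈ with k | ∈-range⁻ k∈
    ... | suc i | _ , i<N with ℕ.m≤n⇒∃[o]m+o≡n i<N
    ...   | j , ≡.refl rewrite ℕ.m+n∸m≡n i j = term′ i j

  -- Convergence to π/4 and the value of Σ n⁻².

  sup-isSup : ∀ S → ∃ S → ∃ (UpperBound S) → IsSup S (sup S)
  sup-isSup S inhabited bounded with em (∃ S × ∃ (UpperBound S))
  ... | yes (i , b) = proj₂ (complete S i b)
  ... | no  ¬both   = ⊥-elim (¬both (inhabited , bounded))

  sup-least : ∀ {S s b} → IsSup S s → UpperBound S b → s ≤ b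
  sup-least (_ , approx) ub = ≮⇒≥ λ b<s → let x , Sx , b<x = approx _ b<s in <⇒≱ b<x (ub x Sx)

  Leibniz : Pred ℝ 0ℓ
  Leibniz x = ∃ λ n →
    x ≈ ∑[ i < n ] (fromℕ (4 ℕ.* toℕ i ℕ.+ 1) ⁻¹ - fromℕ (4 ℕ.* toℕ i ℕ.+ 3) ⁻¹)

  s : ℝ
  s = sup Leibniz

  partialSum : ∀ n → (∑[ i < n ] (fromℕ (4 ℕ.* toℕ i ℕ.+ 1) ⁻¹ - fromℕ (4 ℕ.* toℕ i ℕ.+ 3) ⁻¹)) ≈ P (n ℕ.+ n)
  partialSum n = trans (∑-range n (λ k → recip (4 ℕ.* pred k ℕ.+ 1) - recip (4 ℕ.* pred k ℕ.+ 3))) (go n)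
    where
    go : ∀ n → Σ (range n) (λ k → recip (4 ℕ.* pred k ℕ.+ 1) - recip (4 ℕ.* pred k ℕ.+ 3)) ≈ P (n ℕ.+ n)
    go zero    = refl
    go (suc n) rewrite ℕ.+-suc n n = trans (+-cong (+-cong (reflexive (≡.cong recip (lem₁ n)))
      (-‿cong (reflexive (≡.cong recip (lem₃ n))))) (go n)) (sym (begin
        - ε (n ℕ.+ n) * g (suc (n ℕ.+ n)) + (ε (n ℕ.+ n) * g (n ℕ.+ n) + P (n ℕ.+ n))
          ≈⟨ +-cong (*-congʳ (-‿cong (ε-even n))) (+-congʳ (*-congʳ (ε-even n))) ⟩
        - 1# * g (suc (n ℕ.+ n)) + (1# * g (n ℕ.+ n) + P (n ℕ.+ n))
          ≈⟨ solve 3 (λ x y z → :- κ 1 :* y :+ (κ 1 :* x :+ z) := x :- y :+ z) refl _ _ _ ⟩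
        g (n ℕ.+ n) - g (suc (n ℕ.+ n)) + P (n ℕ.+ n) ∎))
      where
      lem₁ : ∀ n → 4 ℕ.* n ℕ.+ 1 ≡ suc ((n ℕ.+ n) ℕ.+ (n ℕ.+ n))
      lem₁ = solve-∀
      lem₃ : ∀ n → 4 ℕ.* n ℕ.+ 3 ≡ suc (suc (n ℕ.+ n) ℕ.+ suc (n ℕ.+ n))
      lem₃ = solve-∀

  P-even-mono : ∀ m n → P (m ℕ.+ m) ≤ P (m ℕ.+ m ℕ.+ n)
  P-even-mono m n = ≤-cert (trans (+-congʳ (alt-+ g (m ℕ.+ m) n))
      (trans (solve 3 (λ x e t → x :+ e :* t :- x := e :* t) refl _ _ _) (trans (*-congʳ (ε-even m)) (*-identityˡ _))))
    (proj₁ (alt-bounds n (λ k → 0≤g (m ℕ.+ m ℕ.+ k))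
      (λ k → ≡.subst (λ i → g i ≤ g (m ℕ.+ m ℕ.+ k)) (≡.sym (ℕ.+-suc (m ℕ.+ m) k)) (g-anti (m ℕ.+ m ℕ.+ k)))))

  P-even≤ : ∀ m n → P (n ℕ.+ n) ≤ P (m ℕ.+ m) + g (m ℕ.+ m)
  P-even≤ m n with ℕ.≤-total (n ℕ.+ n) (m ℕ.+ m)
  ... | inj₂ h with ℕ.m≤n⇒∃[o]m+o≡n h
  ...   | o , e = ≡.subst (λ i → P i ≤ P (m ℕ.+ m) + g (m ℕ.+ m)) e (≤-cert
          (solve 3 (λ p q x → p :+ x :- q := x :- (q :- p)) refl _ _ _)
          (≤⇒0≤- (≤.trans (x≤∣x∣ _) (alt-close (m ℕ.+ m) o 0≤g g-anti))))
  P-even≤ m n | inj₁ h with ℕ.m≤n⇒∃[o]m+o≡n h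
  ... | o , e = ≤.trans (≡.subst (λ i → P (n ℕ.+ n) ≤ P i) e (P-even-mono n o))
          (≤-cert (solve 2 (λ x y → x :+ y :- x := y) refl _ _) (0≤g (m ℕ.+ m)))

  s-isSup : IsSup Leibniz s
  s-isSup = sup-isSup Leibniz (_ , 0 , refl)
    (P 0 + g 0 , λ { x (n , e) → e ≈≤ (partialSum n ≈≤ P-even≤ 0 n) })

  P-even≤s : ∀ n → P (n ℕ.+ n) ≤ s
  P-even≤s n = sym (partialSum n) ≈≤ proj₁ s-isSup _ (n , refl)

  s≤P-even+g : ∀ n → s ≤ P (n ℕ.+ n) + g (n ℕ.+ n)
  s≤P-even+g m = sup-least s-isSup λ { x (n , e) → e ≈≤ (partialSum n ≈≤ P-even≤ m n) }

  g-odd≤recip : ∀ m {n} → 1 ℕ.≤ n → n ℕ.≤ suc (m ℕ.+ m) → g (m ℕ.+ m) ≤ recip n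
  g-odd≤recip m 1≤n h = recip-antitone 1≤n (ℕ.≤-trans h (ℕ.s≤s (ℕ.m≤m+n (m ℕ.+ m) _)))

  ∣P-s∣≤ : ∀ {n} → 1 ℕ.≤ n → ∣ P n - s ∣ ≤ recip n
  ∣P-s∣≤ {n} 1≤n with even-or-odd n
  ... | m , inj₁ ≡.refl = ≤.trans (∣x∣≤
          (≤-cert (solve 3 (λ p s x → x :- (p :- s) := (s :- p) :+ x) refl _ _ _) (≤⇒0≤- (P-even≤s m) +0 0≤g (m ℕ.+ m)))
          (≤-cert (solve 3 (λ p s x → x :- :- (p :- s) := p :+ x :- s) refl _ _ _) (≤⇒0≤- (s≤P-even+g m))))
        (g-odd≤recip m 1≤n (ℕ.n≤1+n _))
  ... | m , inj₂ ≡.refl = ≤.trans (∣∣-mono (+-congʳ (+-congʳ (trans (*-congʳ (ε-even m)) (*-identityˡ _)))) (∣x∣≤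
          (≤-cert (solve 3 (λ p s x → x :- (x :+ p :- s) := (s :- p)) refl _ _ _) (≤⇒0≤- (P-even≤s m)))
          (≤-cert (solve 3 (λ p s x → x :- :- (x :+ p :- s) := (p :+ x :- s) :+ x) refl _ _ _) (≤⇒0≤- (s≤P-even+g m) +0 0≤g (m ℕ.+ m)))))
        (g-odd≤recip m 1≤n ℕ.≤-refl)

  r0≈1 : r 0 ≈ 1#
  r0≈1 = recip-1

  0≤P : ∀ n → 0# ≤ P n
  0≤P n = proj₁ (alt-bounds n 0≤g g-anti)

  P≤1 : ∀ n → P n ≤ 1#
  P≤1 n = proj₂ (alt-bounds n 0≤g g-anti) ≤≈ r0≈1

  0≤s : 0# ≤ s
  0≤s = P-even≤s 0

  s≤1 : s ≤ 1#
  s≤1 = s≤P-even+g 0 ≤≈ trans (+-identityˡ _) r0≈1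

  -- The first pair 1 - 1/3 already gives it. It means π ≥ 8/3, which suffices both for dividing by
  -- π² and for 6/π² ≤ 1.
  2≤3s : fromℕ 2 ≤ fromℕ 3 * s
  2≤3s = two ≈≤ *-monoˡ-≤ (fromℕ 3) (0≤fromℕ 3) (P-even≤s 1)
    where
    two : fromℕ 2 ≈ fromℕ 3 * P 2
    two = sym (trans (solve 2 (λ x y → κ 3 :* (:- κ 1 :* y :+ (κ 1 :* x :+ κ 0)) := κ 3 :* x :- κ 3 :* y) refl (g 0) (g 1))
      (trans (+-cong (*-congˡ r0≈1) (-‿cong (recip-inverse {3} (ℕ.s≤s ℕ.z≤n))))
        (solve 0 (κ 3 :* κ 1 :- κ 1 := κ 2) refl)))

  squares : ℕ → ℝ
  squares n = Σ (range n) (λ k → recip k * recip k)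

  -- The odd indices give `O n`, and the even ones a quarter of `squares n`.
  squares-double : ∀ n → fromℕ 4 * squares (n ℕ.+ n) ≈ fromℕ 4 * O n + squares n
  squares-double zero    = solve 0 (κ 4 :* κ 0 := κ 4 :* κ 0 :+ κ 0) refl
  squares-double (suc n) rewrite ℕ.+-suc n n = begin
    fromℕ 4 * (h * h + (G * G + squares (n ℕ.+ n)))
      ≈⟨ solve 3 (λ h G t → κ 4 :* (h :* h :+ (G :* G :+ t)) := κ 4 :* (G :* G) :+ (κ 2 :* h) :* (κ 2 :* h) :+ κ 4 :* t)
           refl h G _ ⟩
    fromℕ 4 * (G * G) + (fromℕ 2 * h) * (fromℕ 2 * h) + fromℕ 4 * squares (n ℕ.+ n)
      ≈⟨ +-cong (+-congˡ (*-cong half half)) (squares-double n) ⟩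
    fromℕ 4 * (G * G) + r n * r n + (fromℕ 4 * O n + squares n)
      ≈⟨ solve 4 (λ x y o t → κ 4 :* x :+ y :+ (κ 4 :* o :+ t) := κ 4 :* (x :+ o) :+ (y :+ t)) refl _ _ _ _ ⟩
    fromℕ 4 * (G * G + O n) + (r n * r n + squares n) ∎
    where
    h = recip (suc (suc (n ℕ.+ n)))
    G = g n
    half : fromℕ 2 * h ≈ r n
    half = ⁻¹-unique (0<fromℕ {suc n} (ℕ.s≤s ℕ.z≤n)) (begin
      fromℕ (suc n) * (fromℕ 2 * h)      ≈⟨ solve 3 (λ x y z → x :* (y :* z) := y :* x :* z) refl _ _ _ ⟩
      fromℕ 2 * fromℕ (suc n) * h        ≈⟨ *-congʳ (trans (sym (fromℕ-* 2 (suc n))) (fromℕ-cong (lem n))) ⟩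
      fromℕ (suc (suc (n ℕ.+ n))) * h    ≈⟨ recip-inverse {suc (suc (n ℕ.+ n))} (ℕ.s≤s ℕ.z≤n) ⟩
      1#                                 ∎)
      where
      lem : ∀ n → 2 ℕ.* suc n ≡ suc (suc (n ℕ.+ n))
      lem = solve-∀

  squares-tail : ∀ {n} → 1 ℕ.≤ n → 0# ≤ squares (n ℕ.+ n) - squares n × squares (n ℕ.+ n) - squares n ≤ recip n
  squares-tail {n} 1≤n = (0≤Σ (range n) (λ k∈ → pos k∈ *0 pos k∈) ≤≈ sym diff) ,
    (diff ≈≤ (Σ-mono (range n) (λ k∈ → *-mono-≤ (pos k∈) (0≤recip 1≤n) (small k∈) (small k∈))
      ≤≈ trans (Σ-range-const n _) (trans (sym (*-assoc _ _ _)) (trans (*-congʳ (recip-inverse 1≤n)) (*-identityˡ _)))))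
    where
    diff : squares (n ℕ.+ n) - squares n ≈ Σ (range n) (λ k → recip (n ℕ.+ k) * recip (n ℕ.+ k))
    diff = trans (+-congʳ (Σ-range-+ n n _)) (solve 2 (λ x y → x :+ y :- x := y) refl _ _)
    pos : ∀ {k} → k ∈ range n → 0# ≤ recip (n ℕ.+ k)
    pos {k} k∈ = 0≤recip (ℕ.≤-trans 1≤n (ℕ.m≤m+n n k))
    small : ∀ {k} → k ∈ range n → recip (n ℕ.+ k) ≤ recip n
    small {k} k∈ = recip-antitone 1≤n (ℕ.m≤m+n n k)

  -- Eliminating `O n` between `squares-double` and `leibniz-square` leaves three small terms:
  -- `P n - s`, `Q n` and the tail of the squares between n and 2n. The rate is kept explicit
  -- because it is summed over divisors later. The constant is 8·2 + 4·3 + 4 = 32.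
  squares-limit : ∀ {n} → 1 ℕ.≤ n →
    ∣ fromℕ 3 * squares n - fromℕ 8 * (s * s) ∣ ≤ fromℕ 32 * (harmonic n * recip n)
  squares-limit {n} 1≤n = ∣∣-mono rearrange (≤.trans
    (∣∣-sub-≤ (∣∣-sub-≤ (∣∣-*-≤ (abs-fromℕ 8) (∣∣-*-≤ (∣P-s∣≤ 1≤n) ∣P+s∣≤2)) (∣∣-*-≤ (abs-fromℕ 4) (∣Q∣≤ {n})))
      (∣∣-*-≤ (abs-fromℕ 4) (∣∣-of-≥0 (proj₁ tail) ≈≤ proj₂ tail)))
    (≤-cert (solve 3 (λ h t γ → κ 32 :* (h :* t) :- (κ 8 :* (t :* κ 2) :+ κ 4 :* (κ 3 :* (h :* γ)) :+ κ 4 :* t)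
        := κ 20 :* (t :* (h :- κ 1)) :+ κ 12 :* h :* (t :- γ)) refl (harmonic n) (recip n) (g n))
      (0≤fromℕ 20 *0 (0≤recip 1≤n *0 ≤⇒0≤- (1≤harmonic 1≤n))
        +0 0≤fromℕ 12 *0 0≤harmonic n *0 ≤⇒0≤- (recip-antitone 1≤n (ℕ.m≤n⇒m≤1+n (ℕ.m≤m+n n n))))))
    where
    tail = squares-tail 1≤n
    abs-fromℕ : ∀ n → ∣ fromℕ n ∣ ≤ fromℕ n
    abs-fromℕ n = ≤.reflexive (∣∣-of-≥0 (0≤fromℕ n))
    ∣P+s∣≤2 : ∣ P n + s ∣ ≤ fromℕ 2
    ∣P+s∣≤2 = ∣∣-of-≥0 (0≤P n +0 0≤s) ≈≤ (+-mono-≤ (P≤1 n) s≤1 ≤≈ solve 0 (κ 1 :+ κ 1 := κ 2) refl)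
    rearrange : fromℕ 3 * squares n - fromℕ 8 * (s * s)
      ≈ fromℕ 8 * ((P n - s) * (P n + s)) - fromℕ 4 * Q n - fromℕ 4 * (squares (n ℕ.+ n) - squares n)
    rearrange = ≈-cert (solve 6 (λ t d o p q s →
        κ 3 :* t :- κ 8 :* (s :* s) :- (κ 8 :* ((p :- s) :* (p :+ s)) :- κ 4 :* q :- κ 4 :* (d :- t))
          := (κ 4 :* d :- (κ 4 :* o :+ t)) :- κ 4 :* (κ 2 :* (p :* p) :- (o :+ q)))
        refl (squares n) (squares (n ℕ.+ n)) (O n) (P n) (Q n) s)
      (trans (+-cong (≈⇒-≈0 (squares-double n)) (-‿cong (≈0-* _ (≈⇒-≈0 (leibniz-square n)))))
        (-‿inverseʳ 0#))

  6/π² : ℝ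
  6/π² = fromℕ 6 / π ^ 2

  0<π² : 0# < π ^ 2
  0<π² = 1≤⇒0< (≤-cert (solve 1 (λ s → (κ 4 :* s) :* ((κ 4 :* s) :* κ 1) :- κ 1
      := (κ 3 :* s :- κ 2) :* (κ 3 :* s :- κ 2) :+ κ 7 :* (s :* s)  :+ κ 4 :* (κ 3 :* s :- κ 2) :+ κ 3) refl s)
    (x *0 x +0 0≤fromℕ 7 *0 (0≤s *0 0≤s) +0 0≤fromℕ 4 *0 x +0 0≤fromℕ 3))
    where x = ≤⇒0≤- 2≤3s

  8s²*6/π² : fromℕ 8 * (s * s) * 6/π² ≈ fromℕ 3
  8s²*6/π² = *-cancelˡ-≈ (fromℕ 2) (0<fromℕ {2} (ℕ.s≤s ℕ.z≤n)) (begin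
    fromℕ 2 * (fromℕ 8 * (s * s) * (fromℕ 6 * y))
      ≈⟨ solve 2 (λ s y → κ 2 :* (κ 8 :* (s :* s) :* (κ 6 :* y)) := κ 6 :* ((κ 4 :* s) :* ((κ 4 :* s) :* κ 1) :* y)) refl s y ⟩
    fromℕ 6 * (π ^ 2 * y)    ≈⟨ *-congˡ (*-inverse 0<π²) ⟩
    fromℕ 6 * 1#             ≈⟨ solve 0 (κ 6 :* κ 1 := κ 2 :* κ 3) refl ⟩
    fromℕ 2 * fromℕ 3        ∎)
    where
    y = (π ^ 2) ⁻¹

  0≤6/π² : 0# ≤ 6/π²
  0≤6/π² with 0# ≤.≤? 6/π²
  ... | yes p = p
  ... | no ¬p = ⊥-elim (1≰0 (≤-cert (solve 2 (λ c k → κ 0 :- κ 1 := c :* (:- k) :+ (c :* k :- κ 3) :+ κ 2) refl (fromℕ 8 * (s * s)) 6/π²)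
      (0≤fromℕ 8 *0 (0≤s *0 0≤s) *0 (sym -0#≈0# ≈≤ neg-mono-≤ (≰⇒≥ ¬p)) +0 ≤.reflexive (sym (≈⇒-≈0 8s²*6/π²)) +0 0≤fromℕ 2)))

  6/π²≤1 : 6/π² ≤ 1#
  6/π²≤1 = *-cancelˡ-≤ (fromℕ 32) (0<fromℕ {32} (ℕ.s≤s ℕ.z≤n)) (≤-cert
    (solve 2 (λ s k → κ 32 :* κ 1 :- κ 32 :* k
        := κ 8 :* ((κ 3 :* s :- κ 2) :* (κ 3 :* s :- κ 2) :+ κ 4 :* (κ 3 :* s :- κ 2)) :* k
           :+ κ 9 :* (κ 3 :- κ 8 :* (s :* s) :* k) :+ κ 5) refl s 6/π²)
    (0≤fromℕ 8 *0 (x *0 x +0 0≤fromℕ 4 *0 x) *0 0≤6/π² +0 ≤.reflexive (sym (≈0-* _ (≈⇒-≈0 (sym 8s²*6/π²)))) +0 0≤fromℕ 5))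
    where x = ≤⇒0≤- 2≤3s

-- Floor division and the Möbius function.

infixl 7 _÷_
-- Division made total so that it can stand under a sum over `range`, where no instance of
-- nonzeroness is at hand; divisors there are at least 1.
_÷_ : ℕ → ℕ → ℕ
n ÷ zero  = 0
n ÷ suc d = n ℕ./ suc d

*-÷-≤ : ∀ n d → d ℕ.* (n ÷ d) ℕ.≤ n
*-÷-≤ n zero    = ℕ.z≤n
*-÷-≤ n (suc d) = ≡.subst (ℕ._≤ n) (ℕ.*-comm (n ℕ./ suc d) (suc d)) (ℕ.m/n*n≤m n (suc d))

<-*-÷ : ∀ n {d} → 1 ℕ.≤ d → n ℕ.< d ℕ.* suc (n ÷ d)
<-*-÷ n {suc d} _ = begin-strict
  n                                             ≡⟨ ℕ.m≡m%n+[m/n]*n n (suc d) ⟩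
  n ℕ.% suc d ℕ.+ (n ℕ./ suc d) ℕ.* suc d       <⟨ ℕ.+-monoˡ-< _ (ℕ.m%n<n n (suc d)) ⟩
  suc d ℕ.+ (n ℕ./ suc d) ℕ.* suc d             ≡⟨ ℕ.*-comm (suc (n ℕ./ suc d)) (suc d) ⟩
  suc d ℕ.* suc (n ℕ./ suc d)                   ∎
  where open ℕ.≤-Reasoning

≤-÷ : ∀ {n d k} → 1 ℕ.≤ d → d ℕ.* k ℕ.≤ n → k ℕ.≤ n ÷ d
≤-÷ {n} {d} {k} 1≤d h = ℕ.s≤s⁻¹ (ℕ.*-cancelˡ-< d k (suc (n ÷ d)) (ℕ.≤-<-trans h (<-*-÷ n 1≤d)))

÷-≤ : ∀ n {d} → 1 ℕ.≤ d → n ÷ d ℕ.≤ n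
÷-≤ n {suc d} _ = ℕ.m/n≤m n (suc d)

1≤-* : ∀ {m n} → 1 ℕ.≤ m → 1 ℕ.≤ n → 1 ℕ.≤ m ℕ.* n
1≤-* = ℕ.*-mono-≤

1≤-prime : ∀ {p} → Prime p → 1 ℕ.≤ p
1≤-prime pp = ℕ.>-nonZero⁻¹ _ {{prime⇒nonZero pp}}

prime-*-∣ : ∀ {q k n} → Prime q → ¬ (q ∣ k) → q ∣ n → k ∣ n → q ℕ.* k ∣ n
prime-*-∣ {q} {k} pq q∤k q∣n (divides m ≡.refl) with euclidsLemma m k pq q∣n
... | inj₁ (divides t ≡.refl) = divides t (ℕ.*-assoc t q k)
... | inj₂ q∣k = ⊥-elim (q∤k q∣k)

prime-divisor : ∀ n → 1 ℕ.≤ n → ¬ (n ≡ 1) → ∃ λ q → Prime q × q ∣ n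
prime-divisor n 1≤n n≢1 with factorise n {{ℕ.>-nonZero 1≤n}}
... | record { factors = []     ; isFactorisation = e } = ⊥-elim (n≢1 e)
... | record { factors = q ∷ qs ; isFactorisation = ≡.refl ; factorsPrime = pq ∷ _ } =
  q , pq , m∣m*n (product qs)

module Möbius (𝓡 : RealNumbers) where

  open OrderedField 𝓡
  open FiniteSums 𝓡
  open Basel 𝓡
  open SetoidReasoning setoid

  weight : List ℕ → ℝ
  weight qs = 𝟙 (em (Unique qs)) * ε (length qs)

  weight-↭ : ∀ {qs rs} → qs ↭ rs → weight qs ≈ weight rs
  weight-↭ {qs} {rs} π = *-cong (𝟙-cong (em _) (em _) (resp π) (resp (↭-sym π)))
    (reflexive (≡.cong ε (↭-length π)))
    where
    resp : ∀ {qs rs} → qs ↭ rs → Unique qs → Unique rs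
    resp π = SetoidPermutation.Unique-resp-↭ (≡.setoid ℕ) (↭⇒↭ₛ π)

  μ : ℕ → ℝ
  μ zero    = 0#
  μ (suc n) = weight (PrimeFactorisation.factors (factorise (suc n)))

  -- Factorisations agree up to order, which `weight` does not see. So `μ` may be computed from any
  -- factorisation, in particular from one with a chosen prime in front.
  μ-weight : ∀ {n} → 1 ℕ.≤ n → (f : PrimeFactorisation n) → μ n ≈ weight (PrimeFactorisation.factors f)
  μ-weight {suc n} _ f = weight-↭ (factorisationUnique (factorise (suc n)) f)

  ∣μ∣≤1 : ∀ n → ∣ μ n ∣ ≤ 1#
  ∣μ∣≤1 zero    = ∣∣-of-≥0 ≤.refl ≈≤ 0≤1
  ∣μ∣≤1 (suc n) = ∣∣-*-≤ (∣∣-of-≥0 (0≤𝟙 u?) ≈≤ 𝟙≤1 u?) (≤.reflexive (∣ε∣ (length qs))) ≤≈ *-identityʳ 1#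
    where
    qs = PrimeFactorisation.factors (factorise (suc n))
    u? = em (Unique qs)

  private
    extend : ∀ {q n} → Prime q → PrimeFactorisation n → PrimeFactorisation (q ℕ.* n)
    extend {q} pq f = record
      { factors = q ∷ PrimeFactorisation.factors f
      ; isFactorisation = ≡.cong (q ℕ.*_) (PrimeFactorisation.isFactorisation f)
      ; factorsPrime = pq ∷ PrimeFactorisation.factorsPrime f
      }

  μ-prime-* : ∀ {q n} → Prime q → 1 ℕ.≤ n → μ (q ℕ.* n) ≈ - (𝟙 (em (¬ (q ∣ n))) * μ n)
  μ-prime-* {q} {n} pq 1≤n = begin
    μ (q ℕ.* n)                          ≈⟨ μ-weight (1≤-* (1≤-prime pq) 1≤n) (extend pq f) ⟩
    weight (q ∷ qs)                      ≈⟨ *-congʳ unique-∷ ⟩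
    𝟙 q∤n? * 𝟙 (em (Unique qs)) * - e    ≈⟨ solve 3 (λ x y z → x :* y :* :- z := :- (x :* (y :* z))) refl _ _ e ⟩
    - (𝟙 q∤n? * weight qs)               ≈⟨ -‿cong (*-congˡ (μ-weight 1≤n f)) ⟨
    - (𝟙 q∤n? * μ n)                     ∎
    where
    f = factorise n {{ℕ.>-nonZero 1≤n}}
    qs = PrimeFactorisation.factors f
    e = ε (length qs)
    q∤n? = em (¬ (q ∣ n))

    ∈⇒∣ : q ∈ qs → q ∣ n
    ∈⇒∣ m = ≡.subst (q ∣_) (≡.sym (PrimeFactorisation.isFactorisation f)) (∈⇒∣product m)

    ∣⇒∈ : q ∣ n → q ∈ qs
    ∣⇒∈ d = factorisationHasAllPrimeFactors pq
      (≡.subst (q ∣_) (PrimeFactorisation.isFactorisation f) d) (PrimeFactorisation.factorsPrime f)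

    unique-∷ : 𝟙 (em (Unique (q ∷ qs))) ≈ 𝟙 q∤n? * 𝟙 (em (Unique qs))
    unique-∷ with em (¬ (q ∣ n))
    ... | no ¬q∤n = trans (𝟙-no (em _) λ { (q∉ ∷ _) → ¬q∤n λ q∣n → All.lookup q∉ (∣⇒∈ q∣n) ≡.refl }) (sym (zeroˡ _))
    ... | yes q∤n = trans (𝟙-cong (em _) (em (Unique qs)) (λ { (_ ∷ u) → u })
        λ u → All.tabulate (λ { m ≡.refl → q∤n (∈⇒∣ m) }) ∷ u) (sym (*-identityˡ _))

  Σ-multiples : ∀ D {d} → 1 ℕ.≤ d → (h : ℕ → ℝ) →
    Σ (range D) (λ a → 𝟙 (d ∣? a) * h a) ≈ Σ (range (D ÷ d)) (λ k → h (d ℕ.* k))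
  Σ-multiples D {d} 1≤d h = begin
    Σ (range D) (λ a → 𝟙 (d ∣? a) * h a)
      ≈⟨ Σ-cong (range D) row ⟩
    Σ (range D) (λ a → Σ (range (D ÷ d)) (λ k → 𝟙 (a ℕ.≟ d ℕ.* k) * h (d ℕ.* k)))
      ≈⟨ Σ-swap (range D) (range (D ÷ d)) _ ⟩
    Σ (range (D ÷ d)) (λ k → Σ (range D) (λ a → 𝟙 (a ℕ.≟ d ℕ.* k) * h (d ℕ.* k)))
      ≈⟨ Σ-cong (range (D ÷ d)) column ⟩
    Σ (range (D ÷ d)) (λ k → h (d ℕ.* k)) ∎
    where
    column : ∀ {k} → k ∈ range (D ÷ d) → Σ (range D) (λ a → 𝟙 (a ℕ.≟ d ℕ.* k) * h (d ℕ.* k)) ≈ h (d ℕ.* k)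
    column {k} k∈ = trans (Σ-single (range-unique D)
        (∈-range⁺ (1≤-* 1≤d (proj₁ (∈-range⁻ k∈))) (ℕ.≤-trans (ℕ.*-monoʳ-≤ d (proj₂ (∈-range⁻ k∈))) (*-÷-≤ D d)))
        (λ _ a≢ → trans (*-congʳ (𝟙-no (_ ℕ.≟ _) a≢)) (zeroˡ _)))
      (trans (*-congʳ (𝟙-yes (d ℕ.* k ℕ.≟ d ℕ.* k) ≡.refl)) (*-identityˡ _))

    row : ∀ {a} → a ∈ range D → 𝟙 (d ∣? a) * h a ≈ Σ (range (D ÷ d)) (λ k → 𝟙 (a ℕ.≟ d ℕ.* k) * h (d ℕ.* k))
    row {a} a∈ with d ∣? a
    ... | no d∤a = trans (zeroˡ _) (sym (Σ-0 (range (D ÷ d)) λ {k} _ →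
            trans (*-congʳ (𝟙-no (a ℕ.≟ d ℕ.* k) λ { ≡.refl → d∤a (m∣m*n k) })) (zeroˡ _)))
    ... | yes (divides k e′) = sym (trans (Σ-single (range-unique (D ÷ d)) k∈ other) hit)
      where
      e : a ≡ d ℕ.* k
      e = ≡.trans e′ (ℕ.*-comm k d)
      k∈ : k ∈ range (D ÷ d)
      k∈ = ∈-range⁺ (nonzero k e) (≤-÷ 1≤d (≡.subst (ℕ._≤ D) e (proj₂ (∈-range⁻ a∈))))
        where
        nonzero : ∀ k → a ≡ d ℕ.* k → 1 ℕ.≤ k
        nonzero zero    e = ⊥-elim (ℕ.<⇒≱ (proj₁ (∈-range⁻ a∈)) (ℕ.≤-reflexive (≡.trans e (ℕ.*-zeroʳ d))))
        nonzero (suc k) e = ℕ.s≤s ℕ.z≤n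
      other : ∀ {k′} → k′ ∈ range (D ÷ d) → ¬ (k′ ≡ k) → 𝟙 (a ℕ.≟ d ℕ.* k′) * h (d ℕ.* k′) ≈ 0#
      other {k′} _ ≢k = trans (*-congʳ (𝟙-no (a ℕ.≟ d ℕ.* k′) λ e₂ →
        ≢k (ℕ.*-cancelˡ-≡ k′ k d {{ℕ.>-nonZero 1≤d}} (≡.trans (≡.sym e₂) e)))) (zeroˡ _)
      hit : 𝟙 (a ℕ.≟ d ℕ.* k) * h (d ℕ.* k) ≈ 1# * h a
      hit = *-cong (𝟙-yes (a ℕ.≟ d ℕ.* k) e) (reflexive (≡.cong h (≡.sym e)))

  μ-1 : μ 1 ≈ 1#
  μ-1 = trans (*-congʳ (𝟙-yes (em _) [])) (*-identityˡ _)

  -- For a prime q ∣ n the divisors d with q ∤ d cancel against the divisors q d.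
  Σμ-divisors : ∀ {D n} → 1 ℕ.≤ n → n ℕ.≤ D → Σ (range D) (λ d → 𝟙 (d ∣? n) * μ d) ≈ 𝟙 (n ℕ.≟ 1)
  Σμ-divisors {D} {n} 1≤n n≤D with n ℕ.≟ 1
  ... | yes ≡.refl = trans (Σ-single (range-unique D) (∈-range⁺ 1≤n n≤D)
          λ {d} _ d≢1 → trans (*-congʳ (𝟙-no (d ∣? 1) λ d∣1 → d≢1 (∣1⇒≡1 d∣1))) (zeroˡ _))
        (trans (*-congʳ (𝟙-yes (1 ∣? 1) ∣-refl)) (trans (*-identityˡ _) μ-1))
  ... | no n≢1 with prime-divisor n 1≤n n≢1
  ...   | q , pq , q∣n = begin
    Σ (range D) h
      ≈⟨ Σ-cong (range D) (λ {d} _ → split d) ⟩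
    Σ (range D) (λ d → 𝟙 (q ∣? d) * h d + F d)
      ≈⟨ Σ-+ (range D) _ F ⟩
    Σ (range D) (λ d → 𝟙 (q ∣? d) * h d) + Σ (range D) F
      ≈⟨ +-cong (Σ-multiples D (1≤-prime pq) h) (Σ-range-extend (÷-≤ D (1≤-prime pq)) beyond) ⟩
    Σ (range (D ÷ q)) (λ k → h (q ℕ.* k)) + Σ (range (D ÷ q)) F
      ≈⟨ +-congʳ (trans (Σ-cong (range (D ÷ q)) cancel) (Σ-neg (range (D ÷ q)) F)) ⟩
    - Σ (range (D ÷ q)) F + Σ (range (D ÷ q)) F
      ≈⟨ trans (-‿inverseˡ _) (sym (𝟙-no (n ℕ.≟ 1) n≢1)) ⟩
    𝟙 (n ℕ.≟ 1) ∎
    where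
    h F : ℕ → ℝ
    h d = 𝟙 (d ∣? n) * μ d
    F d = 𝟙 (em (¬ (q ∣ d))) * h d

    split : ∀ d → h d ≈ 𝟙 (q ∣? d) * h d + F d
    split d with q ∣? d
    ... | yes q∣d = sym (trans (+-cong (*-identityˡ _) (trans (*-congʳ (𝟙-no (em _) (λ ¬q → ¬q q∣d))) (zeroˡ _))) (+-identityʳ _))
    ... | no q∤d  = sym (trans (+-cong (zeroˡ _) (trans (*-congʳ (𝟙-yes (em _) q∤d)) (*-identityˡ _))) (+-identityˡ _))

    -- A divisor k of n prime to q has q k ∣ n, hence q k ≤ D; so the divisors d with q ∤ d already
    -- lie in the shorter range of the partners q d.
    beyond : ∀ {k} → D ÷ q ℕ.< k → F k ≈ 0#
    beyond {k} D÷q<k with em (¬ (q ∣ k)) | k ∣? n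
    ... | no _    | _       = zeroˡ _
    ... | yes _   | no _    = trans (*-identityˡ _) (zeroˡ _)
    ... | yes q∤k | yes k∣n = ⊥-elim (ℕ.<⇒≱ D÷q<k (≤-÷ (1≤-prime pq)
            (ℕ.≤-trans (∣⇒≤ {{ℕ.>-nonZero 1≤n}} (prime-*-∣ pq q∤k q∣n k∣n)) n≤D)))

    cancel : ∀ {k} → k ∈ range (D ÷ q) → h (q ℕ.* k) ≈ - F k
    cancel {k} k∈ = trans (*-congˡ (μ-prime-* pq (proj₁ (∈-range⁻ k∈)))) (lem (em _))
      where
      lem : (c : Dec (¬ (q ∣ k))) → 𝟙 (q ℕ.* k ∣? n) * - (𝟙 c * μ k) ≈ - (𝟙 c * h k)
      lem (no _)    = solve 3 (λ x y z → x :* :- (κ 0 :* y) := :- (κ 0 :* z)) refl _ _ _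
      lem (yes q∤k) = trans (*-congʳ (𝟙-cong (q ℕ.* k ∣? n) (k ∣? n) (∣-trans (n∣m*n q)) (prime-*-∣ pq q∤k q∣n)))
        (solve 2 (λ x y → x :* :- (κ 1 :* y) := :- (κ 1 :* (x :* y))) refl _ _)

-- The density of coprime pairs.

module Density (𝓡 : RealNumbers) where

  open OrderedField 𝓡
  open FiniteSums 𝓡
  open Basel 𝓡
  open Möbius 𝓡
  open SetoidReasoning setoid

  1≤÷ : ∀ {D d} → d ∈ range D → 1 ℕ.≤ D ÷ d
  1≤÷ {D} {d} d∈ = ≤-÷ (proj₁ (∈-range⁻ d∈)) (≡.subst (ℕ._≤ D) (≡.sym (ℕ.*-identityʳ d)) (proj₂ (∈-range⁻ d∈)))

  fromℕ-÷ : ∀ D {d} → 1 ℕ.≤ d → fromℕ (D ÷ d) ≤ fromℕ D * recip d × fromℕ D * recip d ≤ fromℕ (D ÷ d) + 1#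
  fromℕ-÷ D {d} 1≤d = *-cancelˡ-≤ (fromℕ d) (0<fromℕ 1≤d) (sym (fromℕ-* d (D ÷ d)) ≈≤ (fromℕ-mono (*-÷-≤ D d) ≤≈ un)) ,
    *-cancelˡ-≤ (fromℕ d) (0<fromℕ 1≤d) (sym un ≈≤ (fromℕ-mono (ℕ.<⇒≤ (<-*-÷ D 1≤d)) ≤≈ trans (fromℕ-* d _) (*-congˡ (+-comm _ _))))
    where
    un : fromℕ D ≈ fromℕ d * (fromℕ D * recip d)
    un = trans (·1 (recip-inverse 1≤d)) (solve 3 (λ x y z → x :* (y :* z) := y :* (x :* z)) refl _ _ _)

  ∣Σμ∣≤ : ∀ D {x b : ℕ → ℝ} → (∀ {d} → d ∈ range D → ∣ x d ∣ ≤ b d) →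
    ∣ Σ (range D) (λ d → μ d * x d) ∣ ≤ Σ (range D) b
  ∣Σμ∣≤ D h = ∣Σ∣≤Σ (range D) λ {d} d∈ → ∣∣-*-≤ (∣μ∣≤1 d) (h d∈) ≤≈ *-identityˡ _

  M : ℕ → ℝ
  M D = Σ (range D) (λ d → μ d * (recip d * recip d))

  -- Collecting the terms with d k = n gives 1/n² the weight Σ μ(d) over d ∣ n, so only n = 1
  -- remains. This is the exact finite form of Σ μ(d)/d² · Σ 1/k² = 1.
  M-squares : ∀ {D} → 1 ℕ.≤ D → Σ (range D) (λ d → μ d * (recip d * recip d * squares (D ÷ d))) ≈ 1#
  M-squares {D} 1≤D = begin
    Σ (range D) (λ d → μ d * (recip d * recip d * squares (D ÷ d)))
      ≈⟨ Σ-cong (range D) (λ d∈ → *-congˡ (expand d∈)) ⟩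
    Σ (range D) (λ d → μ d * Σ (range D) (λ n → 𝟙 (d ∣? n) * sq n))
      ≈⟨ Σ-cong (range D) (λ {d} _ → Σ-*ˡ (range D) (μ d) _) ⟨
    Σ (range D) (λ d → Σ (range D) (λ n → μ d * (𝟙 (d ∣? n) * sq n)))
      ≈⟨ Σ-swap (range D) (range D) _ ⟩
    Σ (range D) (λ n → Σ (range D) (λ d → μ d * (𝟙 (d ∣? n) * sq n)))
      ≈⟨ Σ-cong (range D) (λ {n} n∈ → trans (Σ-cong (range D) (λ {d} _ →
           solve 3 (λ x y z → x :* (y :* z) := z :* (y :* x)) refl (μ d) (𝟙 (d ∣? n)) (sq n)))
           (trans (Σ-*ˡ (range D) (sq n) _) (*-congˡ (Σμ-divisors (proj₁ (∈-range⁻ n∈)) (proj₂ (∈-range⁻ n∈)))))) ⟩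
    Σ (range D) (λ n → sq n * 𝟙 (n ℕ.≟ 1))
      ≈⟨ Σ-single (range-unique D) (∈-range⁺ ℕ.≤-refl 1≤D) (λ {n} _ n≢1 → trans (*-congˡ (𝟙-no (n ℕ.≟ 1) n≢1)) (zeroʳ _)) ⟩
    recip 1 * recip 1 * 1#
      ≈⟨ *-congʳ (*-cong recip-1 recip-1) ⟩
    1# * 1# * 1#
      ≈⟨ solve 0 (κ 1 :* κ 1 :* κ 1 := κ 1) refl ⟩
    1# ∎
    where
    sq : ℕ → ℝ
    sq n = recip n * recip n
    expand : ∀ {d} → d ∈ range D → sq d * squares (D ÷ d) ≈ Σ (range D) (λ n → 𝟙 (d ∣? n) * sq n)
    expand {d} d∈ = trans (sym (Σ-*ˡ (range (D ÷ d)) (sq d) _)) (trans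
      (Σ-cong (range (D ÷ d)) (λ {k} k∈ → trans
        (solve 2 (λ x y → x :* x :* (y :* y) := (x :* y) :* (x :* y)) refl (recip d) (recip k))
        (let e = sym (recip-* (proj₁ (∈-range⁻ d∈)) (proj₁ (∈-range⁻ k∈))) in *-cong e e)))
      (sym (Σ-multiples D (proj₁ (∈-range⁻ d∈)) sq)))

  private
    final : ∀ x r h u H → 0# ≤ x → 0# ≤ r → 0# ≤ u → 0# ≤ H → h ≤ H → x * r * u ≤ fromℕ 2 →
      x * (r * r) * (fromℕ 32 * (h * u)) ≤ fromℕ 64 * H * r
    final x r h u H 0≤x 0≤r 0≤u 0≤H h≤H small = ≤-cert
      (solve 5 (λ x r h u H → κ 64 :* H :* r :- x :* (r :* r) :* (κ 32 :* (h :* u))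
            := κ 32 :* x :* (r :* r) :* u :* (H :- h)
               :+ κ 32 :* r :* H :* (κ 2 :- x :* r :* u)) refl x r h u H)
      (0≤fromℕ 32 *0 0≤x *0 (0≤r *0 0≤r) *0 0≤u *0 ≤⇒0≤- h≤H
         +0 0≤fromℕ 32 *0 0≤r *0 0≤H *0 ≤⇒0≤- small)

  -- Replacing each `squares (D ÷ d)` in `M-squares` by its limit 8s²/3 turns the identity into
  -- `8 s² * M D ≈ 3` up to the sum of the errors. By `squares-limit` and D/(d (D ÷ d)) ≤ 2, the
  -- error at d, multiplied by D, is at most 2 · 32 · H/d, where H is `harmonic D`.
  M-limit : ∀ D → fromℕ D * ∣ M D - 6/π² ∣ ≤ fromℕ 64 * (harmonic D * harmonic D)
  M-limit D with 1 ℕ.≤? D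
  ... | no D≱1 = trans (*-congʳ (fromℕ-cong (ℕ.n<1⇒n≡0 (ℕ.≰⇒> D≱1)))) (zeroˡ _)
    ≈≤ (0≤fromℕ 64 *0 (0≤harmonic D *0 0≤harmonic D))
  ... | yes 1≤D = sym (∣c*x∣ _ (0≤fromℕ D)) ≈≤ *-cancelˡ-≤ (fromℕ 3) (0<fromℕ {3} (ℕ.s≤s ℕ.z≤n))
    (sym (∣c*x∣ _ (0≤fromℕ 3)) ≈≤ ∣∣-mono rearrange
      (≤.trans (∣∣-*-≤ (∣∣-of-≥0 0≤6/π² ≈≤ 6/π²≤1) (∣-x∣ _ ≈≤ (∣c*x∣ err (0≤fromℕ D) ≈≤ bound)))
        (≤-cert (solve 1 (λ H → κ 3 :* (κ 64 :* (H :* H)) :- κ 1 :* (κ 64 :* (H :* H)) := κ 128 :* (H :* H)) refl H)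
          (0≤fromℕ 128 *0 (0≤H *0 0≤H)))))
    where
    H = harmonic D
    0≤H = 0≤harmonic D
    δ : ℕ → ℝ
    δ d = recip d * recip d * (fromℕ 3 * squares (D ÷ d) - fromℕ 8 * (s * s))
    err = Σ (range D) (λ d → μ d * δ d)

    err≈ : err ≈ fromℕ 3 - fromℕ 8 * (s * s) * M D
    err≈ = begin
      err
        ≈⟨ Σ-cong (range D) (λ {d} _ → solve 4 (λ m r q t → m :* (r :* (κ 3 :* q :- t))
             := κ 3 :* (m :* (r :* q)) :- t :* (m :* r)) refl (μ d) (recip d * recip d) (squares (D ÷ d)) _) ⟩
      Σ (range D) (λ d → fromℕ 3 * (μ d * (recip d * recip d * squares (D ÷ d))) - fromℕ 8 * (s * s) * (μ d * (recip d * recip d)))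
        ≈⟨ trans (Σ-sub (range D) _ _) (+-cong (Σ-*ˡ (range D) (fromℕ 3) _) (-‿cong (Σ-*ˡ (range D) _ _))) ⟩
      fromℕ 3 * Σ (range D) (λ d → μ d * (recip d * recip d * squares (D ÷ d))) - fromℕ 8 * (s * s) * M D
        ≈⟨ +-congʳ (trans (*-congˡ (M-squares 1≤D)) (*-identityʳ _)) ⟩
      fromℕ 3 - fromℕ 8 * (s * s) * M D ∎

    rearrange : fromℕ 3 * (fromℕ D * (M D - 6/π²)) ≈ 6/π² * - (fromℕ D * err)
    rearrange = ≈-cert (solve 5 (λ d m k t e → κ 3 :* (d :* (m :- k)) :- k :* :- (d :* e)
        := d :* k :* (e :- (κ 3 :- t :* m)) :+ d :* :- m :* (t :* k :- κ 3)) refl (fromℕ D) (M D) 6/π² (fromℕ 8 * (s * s)) err)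
      (≈0-* _ (≈⇒-≈0 err≈) 0+0 ≈0-* _ (≈⇒-≈0 8s²*6/π²))

    term : ∀ {d} → d ∈ range D → ∣ fromℕ D * δ d ∣ ≤ fromℕ 64 * H * recip d
    term {d} d∈ = ∣∣-mono (sym (*-assoc (fromℕ D) (recip d * recip d) Δ)) (∣c*x∣ Δ (0≤fromℕ D *0 (0≤ρ *0 0≤ρ)) ≈≤
      ≤.trans (*-monoˡ-≤ (fromℕ D * (recip d * recip d)) (0≤fromℕ D *0 (0≤ρ *0 0≤ρ)) (squares-limit (1≤÷ d∈)))
        (final (fromℕ D) (recip d) (harmonic U) (recip U) H (0≤fromℕ D) 0≤ρ (0≤recip (1≤÷ d∈))
          0≤H (harmonic-mono (÷-≤ D (proj₁ (∈-range⁻ d∈)))) small))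
      where
      U = D ÷ d
      Δ = fromℕ 3 * squares U - fromℕ 8 * (s * s)
      0≤ρ = recip∈ {D} d∈
      small : fromℕ D * recip d * recip U ≤ fromℕ 2
      small = ≤.trans (*-monoʳ-≤ (recip U) (0≤recip (1≤÷ d∈)) (proj₂ (fromℕ-÷ D (proj₁ (∈-range⁻ d∈)))))
        (≤-cert (solve 2 (λ u v → κ 2 :- (u :+ κ 1) :* v := (κ 1 :- v) :+ (κ 1 :- u :* v)) refl (fromℕ U) (recip U))
          (≤⇒0≤- (recip-≤1 (1≤÷ d∈)) +0 ≤.reflexive (sym (≈⇒-≈0 (sym (recip-inverse (1≤÷ d∈)))))))

    bound : fromℕ D * ∣ err ∣ ≤ fromℕ 64 * (H * H)
    bound = sym (∣c*x∣ err (0≤fromℕ D)) ≈≤ (∣∣-mono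
      (trans (sym (Σ-*ˡ (range D) (fromℕ D) _)) (Σ-cong (range D) (λ _ → solve 3 (λ x y z → x :* (y :* z) := y :* (x :* z)) refl _ _ _)))
      (∣Σμ∣≤ D term) ≤≈ trans (Σ-*ˡ (range D) _ _) (*-assoc _ _ _))

  -- The three error terms come from rounding D/d down, from cutting Σ μ(d)/d² off at D, and from
  -- replacing D by T.
  coprime-density : ∀ {D T} → fromℕ D ≤ T → T ≤ fromℕ (suc D) →
    ∣ Σ (range D) (λ d → μ d * (fromℕ (D ÷ d) * fromℕ (D ÷ d))) - 6/π² * (T * T) ∣
      ≤ fromℕ 2 * T * harmonic D + fromℕ 64 * (T * (harmonic D * harmonic D)) + fromℕ 2 * T
  coprime-density {D} {T} D≤T T≤D+1 = ∣∣-mono rearrange (∣∣-+-≤ (∣∣-+-≤ first second) third)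
    where
    H = harmonic D
    x = fromℕ D
    0≤x = 0≤fromℕ D
    0≤T = ≤.trans 0≤x D≤T
    u : ℕ → ℝ
    u d = fromℕ (D ÷ d)
    S = Σ (range D) (λ d → μ d * (u d * u d))
    E = Σ (range D) (λ d → μ d * (u d * u d - x * recip d * (x * recip d)))

    E≈ : E ≈ S - x * x * M D
    E≈ = trans (Σ-cong (range D) (λ {d} _ → solve 4 (λ m u x r → m :* (u :* u :- x :* r :* (x :* r))
        := m :* (u :* u) :- x :* x :* (m :* (r :* r))) refl (μ d) (u d) x (recip d)))
      (trans (Σ-sub (range D) _ _) (+-congˡ (-‿cong (Σ-*ˡ (range D) _ _))))

    rearrange : S - 6/π² * (T * T) ≈ E + x * (x * (M D - 6/π²)) + 6/π² * ((x - T) * (x + T))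
    rearrange = ≈-cert (solve 6 (λ S E k x T m → S :- k :* (T :* T) :- (E :+ x :* (x :* (m :- k)) :+ k :* ((x :- T) :* (x :+ T)))
      := S :- x :* x :* m :- E) refl S E 6/π² x T (M D)) (≈⇒-≈0 (sym E≈))

    first : ∣ E ∣ ≤ fromℕ 2 * T * H
    first = ∣Σμ∣≤ D term ≤≈ Σ-*ˡ (range D) _ _
      where
      term : ∀ {d} → d ∈ range D → ∣ u d * u d - x * recip d * (x * recip d) ∣ ≤ fromℕ 2 * T * recip d
      term {d} d∈ = ∣x∣≤
        (≤-cert (solve 4 (λ T r u v → κ 2 :* T :* r :- (u :* u :- v :* v) := (κ 2 :* T :* r) :+ ((v :- u) :* (v :+ u))) refl T (recip d) (u d) (x * recip d))
          (0≤fromℕ 2 *0 0≤T *0 0≤ρ +0 (≤⇒0≤- lo *0 (0≤v +0 0≤fromℕ (D ÷ d)))))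
        (≤-cert (solve 4 (λ T r u x → κ 2 :* T :* r :- :- (u :* u :- x :* r :* (x :* r))
             := κ 2 :* ((T :- x) :* r) :+ (x :* r :- u) :+ (u :+ κ 1 :- x :* r) :* (x :* r :+ u)) refl T (recip d) (u d) x)
          (0≤fromℕ 2 *0 (≤⇒0≤- D≤T *0 0≤ρ) +0 ≤⇒0≤- lo +0 ≤⇒0≤- hi *0 (0≤v +0 0≤fromℕ (D ÷ d))))
        where
        lo = proj₁ (fromℕ-÷ D (proj₁ (∈-range⁻ d∈)))
        hi = proj₂ (fromℕ-÷ D (proj₁ (∈-range⁻ d∈)))
        0≤ρ = recip∈ {D} d∈
        0≤v = 0≤x *0 0≤ρ

    second : ∣ x * (x * (M D - 6/π²)) ∣ ≤ fromℕ 64 * (T * (H * H))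
    second = ∣c*x∣ _ 0≤x ≈≤ (*-mono-≤ 0≤x (0≤fromℕ 64 *0 (0≤harmonic D *0 0≤harmonic D)) D≤T
      (∣c*x∣ _ 0≤x ≈≤ M-limit D) ≤≈ solve 2 (λ T H → T :* (κ 64 :* H) := κ 64 :* (T :* H)) refl T (H * H))

    third : ∣ 6/π² * ((x - T) * (x + T)) ∣ ≤ fromℕ 2 * T
    third = ∣c*x∣ _ 0≤6/π² ≈≤ (*-mono-≤ 0≤6/π² (0≤fromℕ 2 *0 0≤T) 6/π²≤1 (∣x∣≤
       (≤-cert (solve 2 (λ x T → κ 2 :* T :- (x :- T) :* (x :+ T) := κ 2 :* T :+ (T :- x) :* (x :+ T)) refl x T)
         (0≤fromℕ 2 *0 0≤T +0 ≤⇒0≤- D≤T *0 (0≤x +0 0≤T)))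
       (≤-cert (solve 2 (λ x T → κ 2 :* T :- :- ((x :- T) :* (x :+ T)) := (T :- x) :+ (κ 1 :+ x :- T) :* (x :+ T)) refl x T)
         (≤⇒0≤- D≤T +0 ≤⇒0≤- T≤D+1 *0 (0≤x +0 0≤T)))) ≤≈ *-identityˡ _)

-- Congruences and Thue's lemma.

∣-resp : ∀ {k z w} → z ≡ w → k ℤ.∣ z → k ℤ.∣ w
∣-resp = ≡.subst (_ ℤ.∣_)

∣∧<⇒≡0 : ∀ {n z} → + n ℤ.∣ z → ℤ.∣ z ∣ ℕ.< n → z ≡ + 0
∣∧<⇒≡0 {n} {z} n∣z z<n with ℤ.∣ z ∣ in e
... | zero  = ℤ.∣i∣≡0⇒i≡0 e
... | suc k = ⊥-elim (ℕ.<⇒≱ z<n (ℕ.∣⇒≤ (≡.subst (n ℕ.∣_) e (ℤ.∣⇒∣ᵤ n∣z))))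

prime-∣-* : ∀ {p} → Prime p → ∀ z w → + p ℤ.∣ z ℤ.* w → + p ℤ.∣ z ⊎ + p ℤ.∣ w
prime-∣-* {p} pp z w h with euclidsLemma ℤ.∣ z ∣ ℤ.∣ w ∣ pp (≡.subst (p ℕ.∣_) (ℤ.abs-* z w) (ℤ.∣⇒∣ᵤ h))
... | inj₁ d = inj₁ (ℤ.∣ᵤ⇒∣ d)
... | inj₂ d = inj₂ (ℤ.∣ᵤ⇒∣ d)

coprime-∣-* : ∀ {x y} → Coprime ℤ.∣ x ∣ y → ∀ z → + y ℤ.∣ z ℤ.* x → + y ℤ.∣ z
coprime-∣-* {x} {y} c z h = ℤ.∣ᵤ⇒∣ (coprime-divisor (Coprime.sym c)
  (≡.subst (y ℕ.∣_) (≡.trans (ℤ.abs-* z x) (ℕ.*-comm ℤ.∣ z ∣ ℤ.∣ x ∣)) (ℤ.∣⇒∣ᵤ h)))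

-- Turns a bounded integer into a natural number, which can then serve as an index into a `range`.
shift-abs : ∀ {w} u → ℤ.∣ u ∣ ℕ.≤ w → ∃ λ e → + w ℤ.+ u ≡ + e × e ℕ.≤ w ℕ.+ w
shift-abs {w} (+ n)    n≤w = w ℕ.+ n , ≡.refl , ℕ.+-monoʳ-≤ w n≤w
shift-abs {w} -[1+ n ] n<w = w ℕ.∸ suc n , ℤ.⊖-≥ n<w , ℕ.≤-trans (ℕ.m∸n≤m w (suc n)) (ℕ.m≤m+n w w)

invertible : ∀ {x y} → Coprime ℤ.∣ x ∣ y → ∃ λ w → + y ℤ.∣ w ℤ.* x ℤ.- + 1
invertible {x} {y} c = fromAbs x (invert (coprime-Bézout c))
  where
  invert : ∀ {m} → Bézout.Identity 1 m y → ∃ λ w → + y ℤ.∣ w ℤ.* + m ℤ.- + 1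
  invert {m} (Bézout.+- u v e) = + u , divides (+ v) (begin
    + u ℤ.* + m ℤ.- + 1          ≡⟨ ≡.cong (ℤ._- + 1) (ℤ.pos-* u m) ⟨
    + (u ℕ.* m) ℤ.- + 1          ≡⟨ ≡.cong (λ t → + t ℤ.- + 1) e ⟨
    + suc (v ℕ.* y) ℤ.- + 1      ≡⟨⟩
    + (v ℕ.* y)                  ≡⟨ ℤ.pos-* v y ⟩
    + v ℤ.* + y                  ∎)
    where open ≡.≡-Reasoning
  invert {m} (Bézout.-+ u v e) = ℤ.- + u , divides (ℤ.- + v) (begin
    ℤ.- + u ℤ.* + m ℤ.- + 1      ≡⟨ lem (+ u) (+ m) ⟩
    ℤ.- (+ 1 ℤ.+ + u ℤ.* + m)    ≡⟨ ≡.cong (λ t → ℤ.- (+ 1 ℤ.+ t)) (ℤ.pos-* u m) ⟨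
    ℤ.- + (1 ℕ.+ u ℕ.* m)        ≡⟨ ≡.cong (λ t → ℤ.- + t) e ⟩
    ℤ.- + (v ℕ.* y)              ≡⟨ ≡.cong ℤ.-_ (ℤ.pos-* v y) ⟩
    ℤ.- (+ v ℤ.* + y)            ≡⟨ ℤ.neg-distribˡ-* (+ v) (+ y) ⟩
    ℤ.- + v ℤ.* + y              ∎)
    where
    open ≡.≡-Reasoning
    lem : ∀ a b → ℤ.- a ℤ.* b ℤ.- + 1 ≡ ℤ.- (+ 1 ℤ.+ a ℤ.* b)
    lem = ℤ-Solver.solve-∀

  fromAbs : ∀ x → (∃ λ w → + y ℤ.∣ w ℤ.* + ℤ.∣ x ∣ ℤ.- + 1) → ∃ λ w → + y ℤ.∣ w ℤ.* x ℤ.- + 1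
  fromAbs (+ n)    h       = h
  fromAbs -[1+ n ] (w , d) = ℤ.- w , ∣-resp (lem w (+ suc n)) d
    where
    lem : ∀ a b → a ℤ.* b ℤ.- + 1 ≡ ℤ.- a ℤ.* ℤ.- b ℤ.- + 1
    lem = ℤ-Solver.solve-∀

residue-hit : ∀ {x y} → Coprime ℤ.∣ x ∣ y → 1 ℕ.≤ y → ∀ c → ∃ λ j → 1 ℕ.≤ j × j ℕ.≤ y × + y ℤ.∣ c ℤ.+ + j ℤ.* x
residue-hit {x} {y} cop 1≤y c = suc j , ℕ.s≤s ℕ.z≤n , ℤ.n%ℕd<d t y , ∣-resp e
  (ℤ.∣m∣n⇒∣m+n (ℤ.∣n⇒∣m*n (ℤ.- c) d) (ℤ.∣n⇒∣m*n (ℤ.- q ℤ.* x) ℤ.∣-refl))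
  where
  instance _ = ℕ.>-nonZero 1≤y
  w = proj₁ (invertible {x} {y} cop)
  d = proj₂ (invertible {x} {y} cop)
  -- The solution is j ≡ -c w modulo y. Subtracting 1 before reduction and adding it afterwards
  -- places j in 1, ..., y rather than 0, ..., y - 1.
  t = ℤ.- c ℤ.* w ℤ.- + 1
  j = t ℤ.%ℕ y
  q = t ℤ./ℕ y
  e : ℤ.- c ℤ.* (w ℤ.* x ℤ.- + 1) ℤ.+ ℤ.- q ℤ.* x ℤ.* + y ≡ c ℤ.+ + suc j ℤ.* x
  e = begin
    ℤ.- c ℤ.* (w ℤ.* x ℤ.- + 1) ℤ.+ ℤ.- q ℤ.* x ℤ.* + y
      ≡⟨ lem₁ c w x q (+ y) ⟩
    c ℤ.+ (+ 1 ℤ.+ (t ℤ.- q ℤ.* + y)) ℤ.* x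
      ≡⟨ ≡.cong (λ u → c ℤ.+ (+ 1 ℤ.+ (u ℤ.- q ℤ.* + y)) ℤ.* x) (ℤ.a≡a%ℕn+[a/ℕn]*n t y) ⟩
    c ℤ.+ (+ 1 ℤ.+ (+ j ℤ.+ q ℤ.* + y ℤ.- q ℤ.* + y)) ℤ.* x
      ≡⟨ lem₂ c (+ j) (q ℤ.* + y) x ⟩
    c ℤ.+ (+ 1 ℤ.+ + j) ℤ.* x ∎
    where
    open ≡.≡-Reasoning
    lem₁ : ∀ c w x q y → ℤ.- c ℤ.* (w ℤ.* x ℤ.- + 1) ℤ.+ ℤ.- q ℤ.* x ℤ.* y
         ≡ c ℤ.+ (+ 1 ℤ.+ (ℤ.- c ℤ.* w ℤ.- + 1 ℤ.- q ℤ.* y)) ℤ.* x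
    lem₁ = ℤ-Solver.solve-∀
    lem₂ : ∀ c j z x → c ℤ.+ (+ 1 ℤ.+ (j ℤ.+ z ℤ.- z)) ℤ.* x ≡ c ℤ.+ (+ 1 ℤ.+ j) ℤ.* x
    lem₂ = ℤ-Solver.solve-∀

∣+-+∣≤ : ∀ {a b r} → a ℕ.≤ r → b ℕ.≤ r → ℤ.∣ + a ℤ.- + b ∣ ℕ.≤ r
∣+-+∣≤ {a} {b} a≤r b≤r = ℕ.≤-trans
  (ℕ.≤-trans (ℕ.≤-reflexive (≡.cong ℤ.∣_∣ (ℤ.m-n≡m⊖n a b))) (ℤ.∣m⊝n∣≤m⊔n a b)) (ℕ.⊔-lub a≤r b≤r)

-- By pigeonhole on the numbers i − v j with 0 ≤ i, j ≤ r.
thue-difference : ∀ {p r} → .{{NonZero p}} → p ℕ.< suc r ℕ.* suc r → ∀ v →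
  ∃₂ λ x y → ℤ.∣ x ∣ ℕ.≤ r × ℤ.∣ y ∣ ℕ.≤ r × + p ℤ.∣ x ℤ.- v ℤ.* y × ¬ (x ≡ + 0 × y ≡ + 0)
thue-difference {p} {r} p<r² v = collision (Fin.pigeonhole p<r² f)
  where
  value : Fin (suc r) × Fin (suc r) → ℤ
  value (i , j) = + toℕ i ℤ.- v ℤ.* + toℕ j
  f : Fin (suc r ℕ.* suc r) → Fin p
  f k = fromℕ< (ℤ.n%ℕd<d (value (remQuot (suc r) k)) p)

  collision : (∃₂ λ k k′ → k Fin.< k′ × f k ≡ f k′) →
    ∃₂ λ x y → ℤ.∣ x ∣ ℕ.≤ r × ℤ.∣ y ∣ ℕ.≤ r × + p ℤ.∣ x ℤ.- v ℤ.* y × ¬ (x ≡ + 0 × y ≡ + 0)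
  collision (k , k′ , k<k′ , e) = x , y , ∣+-+∣≤ (bound i) (bound i′) , ∣+-+∣≤ (bound j) (bound j′) ,
      divides (z ℤ./ℕ p ℤ.- z′ ℤ./ℕ p) eq , distinct
    where
    i  = proj₁ (remQuot {suc r} (suc r) k)
    j  = proj₂ (remQuot {suc r} (suc r) k)
    i′ = proj₁ (remQuot {suc r} (suc r) k′)
    j′ = proj₂ (remQuot {suc r} (suc r) k′)
    x = + toℕ i ℤ.- + toℕ i′
    y = + toℕ j ℤ.- + toℕ j′
    z  = + toℕ i ℤ.- v ℤ.* + toℕ j
    z′ = + toℕ i′ ℤ.- v ℤ.* + toℕ j′

    bound : ∀ (i : Fin (suc r)) → toℕ i ℕ.≤ r
    bound i = ℕ.s≤s⁻¹ (Fin.toℕ<n i)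

    rem≡ : z ℤ.%ℕ p ≡ z′ ℤ.%ℕ p
    rem≡ = Fin.fromℕ<-injective _ _ (ℤ.n%ℕd<d z p) (ℤ.n%ℕd<d z′ p) e

    eq : x ℤ.- v ℤ.* y ≡ (z ℤ./ℕ p ℤ.- z′ ℤ./ℕ p) ℤ.* + p
    eq = begin
      x ℤ.- v ℤ.* y
        ≡⟨ lem₁ (+ toℕ i) (+ toℕ i′) v (+ toℕ j) (+ toℕ j′) ⟩
      z ℤ.- z′
        ≡⟨ ≡.cong₂ ℤ._-_ (ℤ.a≡a%ℕn+[a/ℕn]*n z p) (ℤ.a≡a%ℕn+[a/ℕn]*n z′ p) ⟩
      + (z ℤ.%ℕ p) ℤ.+ z ℤ./ℕ p ℤ.* + p ℤ.- (+ (z′ ℤ.%ℕ p) ℤ.+ z′ ℤ./ℕ p ℤ.* + p)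
        ≡⟨ ≡.cong (λ t → + t ℤ.+ z ℤ./ℕ p ℤ.* + p ℤ.- (+ (z′ ℤ.%ℕ p) ℤ.+ z′ ℤ./ℕ p ℤ.* + p)) rem≡ ⟩
      + (z′ ℤ.%ℕ p) ℤ.+ z ℤ./ℕ p ℤ.* + p ℤ.- (+ (z′ ℤ.%ℕ p) ℤ.+ z′ ℤ./ℕ p ℤ.* + p)
        ≡⟨ lem₂ (+ (z′ ℤ.%ℕ p)) (z ℤ./ℕ p) (z′ ℤ./ℕ p) (+ p) ⟩
      (z ℤ./ℕ p ℤ.- z′ ℤ./ℕ p) ℤ.* + p ∎
      where
      open ≡.≡-Reasoning
      lem₁ : ∀ a a′ v b b′ → a ℤ.- a′ ℤ.- v ℤ.* (b ℤ.- b′) ≡ a ℤ.- v ℤ.* b ℤ.- (a′ ℤ.- v ℤ.* b′)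
      lem₁ = ℤ-Solver.solve-∀
      lem₂ : ∀ c q q′ p → c ℤ.+ q ℤ.* p ℤ.- (c ℤ.+ q′ ℤ.* p) ≡ (q ℤ.- q′) ℤ.* p
      lem₂ = ℤ-Solver.solve-∀

    diff≡0 : ∀ (a b : Fin (suc r)) → + toℕ a ℤ.- + toℕ b ≡ + 0 → a ≡ b
    diff≡0 a b h = Fin.toℕ-injective (ℤ.+-injective (ℤ.i-j≡0⇒i≡j _ _ h))

    distinct : ¬ (x ≡ + 0 × y ≡ + 0)
    distinct (x≡0 , y≡0) = ℕ.<⇒≢ k<k′ (≡.cong toℕ (begin
      k                                    ≡⟨ Fin.combine-remQuot {suc r} (suc r) k ⟨
      combine i j                          ≡⟨ ≡.cong₂ combine (diff≡0 i i′ x≡0) (diff≡0 j j′ y≡0) ⟩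
      combine i′ j′                        ≡⟨ Fin.combine-remQuot {suc r} (suc r) k′ ⟩
      k′                                   ∎))
      where open ≡.≡-Reasoning

gcd-cofactors-coprime : ∀ {m n m′ n′} → 1 ℕ.≤ gcd m n →
  m ≡ m′ ℕ.* gcd m n → n ≡ n′ ℕ.* gcd m n → Coprime m′ n′
gcd-cofactors-coprime {m} {n} 1≤g m≡ n≡ {k} (k∣m′ , k∣n′) =
  ℕ.∣1⇒≡1 (ℕ.*-cancelʳ-∣ g {{ℕ.>-nonZero 1≤g}} (≡.subst (k ℕ.* g ℕ.∣_) (≡.sym (ℕ.*-identityˡ g))
    (gcd-greatest (≡.subst (k ℕ.* g ℕ.∣_) (≡.sym m≡) (ℕ.*-monoˡ-∣ g k∣m′))
                  (≡.subst (k ℕ.* g ℕ.∣_) (≡.sym n≡) (ℕ.*-monoˡ-∣ g k∣n′)))))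
  where g = gcd m n

-- The common divisor is at most y ≤ r < p, so it is invertible modulo p and can be divided out of
-- the congruence.
cancel-gcd : ∀ {p r} → Prime p → r ℕ.< p → ∀ v x {y} → 1 ℕ.≤ y → y ℕ.≤ r → + p ℤ.∣ x ℤ.- v ℤ.* + y →
  ∃₂ λ x′ y′ → ℤ.∣ x′ ∣ ℕ.≤ ℤ.∣ x ∣ × 1 ℕ.≤ y′ × y′ ℕ.≤ y × Coprime ℤ.∣ x′ ∣ y′ × + p ℤ.∣ x′ ℤ.- v ℤ.* + y′
cancel-gcd {p} {r} pp r<p v x {y} 1≤y y≤r d = x′ , y′ ,
    ≡.subst (ℤ.∣ x′ ∣ ℕ.≤_) (≡.sym ∣x∣≡) (ℕ.m≤m*n ℤ.∣ x′ ∣ g) , 1≤y′ ,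
    ≡.subst (y′ ℕ.≤_) (≡.sym y≡) (ℕ.m≤m*n y′ g) , coprime , divisible
  where
  g = gcd ℤ.∣ x ∣ y
  g∣x = ℤ.∣ᵤ⇒∣ {+ g} {x} (gcd[m,n]∣m ℤ.∣ x ∣ y)
  x′ = ℤ._∣_.quotient g∣x
  x≡ : x ≡ x′ ℤ.* + g
  x≡ = ℤ._∣_.equality g∣x
  g∣y = gcd[m,n]∣n ℤ.∣ x ∣ y
  y′ = ℕ.quotient g∣y
  y≡ : y ≡ y′ ℕ.* g
  y≡ = ℕ._∣_.equality g∣y
  ∣x∣≡ : ℤ.∣ x ∣ ≡ ℤ.∣ x′ ∣ ℕ.* g
  ∣x∣≡ = ≡.trans (≡.cong ℤ.∣_∣ x≡) (ℤ.abs-* x′ (+ g))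
  1≤g : 1 ℕ.≤ g
  1≤g = ℕ.n≢0⇒n>0 λ g≡0 → ℕ.<⇒≢ 1≤y (≡.sym (≡.trans y≡ (≡.trans (≡.cong (y′ ℕ.*_) g≡0) (ℕ.*-zeroʳ y′))))
  instance _ = ℕ.>-nonZero 1≤g
  1≤y′ : 1 ℕ.≤ y′
  1≤y′ = ℕ.n≢0⇒n>0 λ y′≡0 → ℕ.<⇒≢ 1≤y (≡.sym (≡.trans y≡ (≡.cong (ℕ._* g) y′≡0)))

  coprime : Coprime ℤ.∣ x′ ∣ y′
  coprime = gcd-cofactors-coprime {ℤ.∣ x ∣} {y} 1≤g ∣x∣≡ y≡

  split : x ℤ.- v ℤ.* + y ≡ + g ℤ.* (x′ ℤ.- v ℤ.* + y′)
  split = begin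
    x ℤ.- v ℤ.* + y                        ≡⟨ ≡.cong₂ (λ a b → a ℤ.- v ℤ.* b) x≡ (≡.trans (≡.cong +_ y≡) (ℤ.pos-* y′ g)) ⟩
    x′ ℤ.* + g ℤ.- v ℤ.* (+ y′ ℤ.* + g)    ≡⟨ lem x′ (+ g) v (+ y′) ⟩
    + g ℤ.* (x′ ℤ.- v ℤ.* + y′)            ∎
    where
    open ≡.≡-Reasoning
    lem : ∀ x g v y → x ℤ.* g ℤ.- v ℤ.* (y ℤ.* g) ≡ g ℤ.* (x ℤ.- v ℤ.* y)
    lem = ℤ-Solver.solve-∀

  divisible : + p ℤ.∣ x′ ℤ.- v ℤ.* + y′
  divisible = [ (λ h → ⊥-elim (ℕ.<⇒≢ 1≤g (≡.sym (ℤ.+-injective (∣∧<⇒≡0 h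
      (ℕ.≤-<-trans (ℕ.∣⇒≤ {{ℕ.>-nonZero 1≤y}} g∣y) (ℕ.≤-<-trans y≤r r<p))))))) , (λ h → h) ]′
    (prime-∣-* pp (+ g) _ (∣-resp split d))

ThueSolution : ℕ → ℕ → ℤ → ℤ → ℕ → Set
ThueSolution p r v x y = ℤ.∣ x ∣ ℕ.≤ r × 1 ℕ.≤ y × y ℕ.≤ r × Coprime ℤ.∣ x ∣ y × + p ℤ.∣ x ℤ.- v ℤ.* + y

thue : ∀ {p r} → Prime p → r ℕ.< p → p ℕ.< suc r ℕ.* suc r → ∀ v → ∃₂ (ThueSolution p r v)
thue {p} {r} pp r<p p<r² v = normalise (thue-difference {{prime⇒nonZero pp}} p<r² v)
  where
  finish : ∀ x y → ℤ.∣ x ∣ ℕ.≤ r → 1 ℕ.≤ y → y ℕ.≤ r → + p ℤ.∣ x ℤ.- v ℤ.* + y → ∃₂ (ThueSolution p r v)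
  finish x y ∣x∣≤r 1≤y y≤r d =
    let x′ , y′ , x′≤ , 1≤y′ , y′≤ , c , d′ = cancel-gcd pp r<p v x {y} 1≤y y≤r d
    in x′ , y′ , ℕ.≤-trans x′≤ ∣x∣≤r , 1≤y′ , ℕ.≤-trans y′≤ y≤r , c , d′

  normalise : (∃₂ λ x y → ℤ.∣ x ∣ ℕ.≤ r × ℤ.∣ y ∣ ℕ.≤ r × + p ℤ.∣ x ℤ.- v ℤ.* y × ¬ (x ≡ + 0 × y ≡ + 0)) →
    ∃₂ (ThueSolution p r v)
  normalise (x , + zero , ∣x∣≤r , _ , d , ≢0) = ⊥-elim (≢0
      (∣∧<⇒≡0 (∣-resp (lem x v) d) (ℕ.≤-<-trans ∣x∣≤r r<p) , ≡.refl))
    where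
    lem : ∀ x v → x ℤ.- v ℤ.* + 0 ≡ x
    lem = ℤ-Solver.solve-∀
  normalise (x , + suc y , ∣x∣≤r , ∣y∣≤r , d , _) = finish x (suc y) ∣x∣≤r (ℕ.s≤s ℕ.z≤n) ∣y∣≤r d
  normalise (x , -[1+ y ] , ∣x∣≤r , ∣y∣≤r , d , _) =
      finish (ℤ.- x) (suc y) (≡.subst (ℕ._≤ r) (≡.sym (ℤ.∣-i∣≡∣i∣ x)) ∣x∣≤r) (ℕ.s≤s ℕ.z≤n) ∣y∣≤r
        (∣-resp (lem x v (+ suc y)) (ℤ.∣m⇒∣-m d))
    where
    lem : ∀ x v y → ℤ.- (x ℤ.- v ℤ.* ℤ.- y) ≡ ℤ.- x ℤ.- v ℤ.* y
    lem = ℤ-Solver.solve-∀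

-- From 1 ≤ y < p, y is a unit modulo p, so multiplying a ≡ v b by y and substituting x for v y is
-- reversible.
congruence-clear : ∀ {p x y v} → Prime p → y ℕ.< p → 1 ℕ.≤ y → + p ℤ.∣ x ℤ.- v ℤ.* + y → ∀ a b →
  (+ p ℤ.∣ a ℤ.- v ℤ.* b → + p ℤ.∣ a ℤ.* + y ℤ.- b ℤ.* x) × (+ p ℤ.∣ a ℤ.* + y ℤ.- b ℤ.* x → + p ℤ.∣ a ℤ.- v ℤ.* b)
congruence-clear {p} {x} {y} {v} pp y<p 1≤y d a b = forth , back
  where
  forth : + p ℤ.∣ a ℤ.- v ℤ.* b → + p ℤ.∣ a ℤ.* + y ℤ.- b ℤ.* x
  forth h = ∣-resp (lem a b v x (+ y)) (ℤ.∣m∣n⇒∣m-n (ℤ.∣n⇒∣m*n (+ y) h) (ℤ.∣n⇒∣m*n b d))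
    where
    lem : ∀ a b v x y → y ℤ.* (a ℤ.- v ℤ.* b) ℤ.- b ℤ.* (x ℤ.- v ℤ.* y) ≡ a ℤ.* y ℤ.- b ℤ.* x
    lem = ℤ-Solver.solve-∀
  back : + p ℤ.∣ a ℤ.* + y ℤ.- b ℤ.* x → + p ℤ.∣ a ℤ.- v ℤ.* b
  back h = [ (λ k → ⊥-elim (ℕ.<⇒≢ 1≤y (≡.sym (ℤ.+-injective (∣∧<⇒≡0 k y<p))))) , (λ k → k) ]′
    (prime-∣-* pp (+ y) (a ℤ.- v ℤ.* b) (∣-resp (lem a b v x (+ y)) (ℤ.∣m∣n⇒∣m+n h (ℤ.∣n⇒∣m*n b d))))
    where
    lem : ∀ a b v x y → a ℤ.* y ℤ.- b ℤ.* x ℤ.+ b ℤ.* (x ℤ.- v ℤ.* y) ≡ y ℤ.* (a ℤ.- v ℤ.* b)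
    lem = ℤ-Solver.solve-∀

-- Counting the pairs for one residue.

module LatticePoints (𝓡 : RealNumbers) where

  open OrderedField 𝓡
  open FiniteSums 𝓡
  open Basel 𝓡 using (harmonic; 0≤harmonic; 1≤harmonic; harmonic-mono; recip∈)
  open Density 𝓡 using (fromℕ-÷)
  open SetoidReasoning setoid

  δ : ℕ → ℤ → ℝ
  δ p z = 𝟙 (+ p ℤ.∣? z)

  0≤δ : ∀ p z → 0# ≤ δ p z
  0≤δ p z = 0≤𝟙 (+ p ℤ.∣? z)

  δ-cong : ∀ p {z w} → z ≡ w → δ p z ≈ δ p w
  δ-cong p e = reflexive (≡.cong (δ p) e)

  multiples : ℕ → ℤ → ℕ → ℝ
  multiples p s n = Σ (range n) (λ k → δ p (s ℤ.+ + k))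

  Residue : ℕ → ℤ → ℕ → Set
  Residue p z ρ = ρ ℕ.< p × + p ℤ.∣ z ℤ.- + ρ

  private
    residue-suc : ∀ {p} → 1 ℕ.≤ p → ∀ z {ρ} → Residue p z ρ →
      ∃ λ ρ′ → Residue p (+ 1 ℤ.+ z) ρ′ × fromℕ p * δ p (+ 1 ℤ.+ z) + fromℕ ρ′ ≈ 1# + fromℕ ρ
    residue-suc {p} 1≤p z {ρ} (ρ<p , d) with suc ρ ℕ.≟ p
    ... | yes ≡.refl = 0 , (1≤p , ∣-resp (lem₂ z (+ ρ)) (ℤ.∣m∣n⇒∣m+n d ℤ.∣-refl)) ,
          trans (+-identityʳ _) (trans (*-congˡ (𝟙-yes (+ suc ρ ℤ.∣? (+ 1 ℤ.+ z)) (∣-resp (lem₁ z (+ ρ)) (ℤ.∣m∣n⇒∣m+n d ℤ.∣-refl)))) (*-identityʳ _))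
      where
      lem₁ : ∀ z ρ → z ℤ.- ρ ℤ.+ (+ 1 ℤ.+ ρ) ≡ + 1 ℤ.+ z
      lem₁ = ℤ-Solver.solve-∀
      lem₂ : ∀ z ρ → z ℤ.- ρ ℤ.+ (+ 1 ℤ.+ ρ) ≡ + 1 ℤ.+ z ℤ.- + 0
      lem₂ = ℤ-Solver.solve-∀
    ... | no ρ≢ = suc ρ , (ℕ.≤∧≢⇒< ρ<p ρ≢ , ∣-resp (lem₁ z (+ ρ)) d) ,
          trans (+-congʳ (trans (*-congˡ (𝟙-no (+ p ℤ.∣? (+ 1 ℤ.+ z)) λ h → ℕ.1+n≢0 (ℤ.+-injective (∣∧<⇒≡0
            (∣-resp (lem₂ z (+ ρ)) (ℤ.∣m∣n⇒∣m-n {+ p} {+ 1 ℤ.+ z} {z ℤ.- + ρ} h d)) (ℕ.≤∧≢⇒< ρ<p ρ≢))))) (zeroʳ _))) (+-identityˡ _)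
      where
      lem₁ : ∀ z ρ → z ℤ.- ρ ≡ + 1 ℤ.+ z ℤ.- (+ 1 ℤ.+ ρ)
      lem₁ = ℤ-Solver.solve-∀
      lem₂ : ∀ z ρ → + 1 ℤ.+ z ℤ.- (z ℤ.- ρ) ≡ + 1 ℤ.+ ρ
      lem₂ = ℤ-Solver.solve-∀

    -- Carrying both end residues makes the count an equation that induction preserves: one step
    -- either raises the residue by 1 or wraps it to 0, and it wraps exactly at a multiple of p.
    multiples-exact : ∀ {p} → 1 ℕ.≤ p → ∀ s {ρ} → Residue p s ρ → ∀ n →
      ∃ λ ρ′ → Residue p (s ℤ.+ + n) ρ′ × fromℕ p * multiples p s n + fromℕ ρ′ ≈ fromℕ n + fromℕ ρ
    multiples-exact {p} 1≤p s {ρ} (ρ<p , d) zero = ρ , (ρ<p , ∣-resp (≡.cong (ℤ._- + ρ) (≡.sym (ℤ.+-identityʳ s))) d) ,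
      +-congʳ (zeroʳ _)
    multiples-exact {p} 1≤p s {ρ} res (suc n) = step (multiples-exact 1≤p s res n)
      where
      lem : ∀ s n → + 1 ℤ.+ (s ℤ.+ n) ≡ s ℤ.+ (+ 1 ℤ.+ n)
      lem = ℤ-Solver.solve-∀
      step : (∃ λ ρ′ → Residue p (s ℤ.+ + n) ρ′ × fromℕ p * multiples p s n + fromℕ ρ′ ≈ fromℕ n + fromℕ ρ) →
        ∃ λ ρ′ → Residue p (s ℤ.+ + suc n) ρ′ × fromℕ p * multiples p s (suc n) + fromℕ ρ′ ≈ fromℕ (suc n) + fromℕ ρ
      step (ρ₁ , res₁ , e₁) with residue-suc 1≤p (s ℤ.+ + n) res₁
      ... | ρ₂ , (ρ₂<p , d₂) , e₂ = ρ₂ , (ρ₂<p , ∣-resp (≡.cong (ℤ._- + ρ₂) (lem s (+ n))) d₂) , ≈-cert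
        (solve 8 (λ p δ m δ₁ ρ₂ ρ₁ n ρ → p :* (δ :+ m) :+ ρ₂ :- (κ 1 :+ n :+ ρ)
            := p :* (δ :- δ₁) :+ (p :* δ₁ :+ ρ₂ :- (κ 1 :+ ρ₁)) :+ (p :* m :+ ρ₁ :- (n :+ ρ)))
          refl (fromℕ p) (δ p (s ℤ.+ + suc n)) (multiples p s n) (δ p (+ 1 ℤ.+ (s ℤ.+ + n))) (fromℕ ρ₂) (fromℕ ρ₁) (fromℕ n) (fromℕ ρ))
        (≈0-* (fromℕ p) (≈⇒-≈0 (δ-cong p (≡.sym (lem s (+ n))))) 0+0 ≈⇒-≈0 e₂ 0+0 ≈⇒-≈0 e₁)

  multiples-bounds : ∀ {p} → 1 ℕ.≤ p → ∀ s n →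
    fromℕ p * multiples p s n ≤ fromℕ n + fromℕ p × fromℕ n ≤ fromℕ p * multiples p s n + fromℕ p
  multiples-bounds {p} 1≤p s n = result (multiples-exact 1≤p s (ℤ.n%ℕd<d s p , res) n)
    where
    instance _ = ℕ.>-nonZero 1≤p
    lem : ∀ a b → b ≡ a ℤ.+ b ℤ.- a
    lem = ℤ-Solver.solve-∀
    res : + p ℤ.∣ s ℤ.- + (s ℤ.%ℕ p)
    res = ∣-resp (≡.trans (lem (+ (s ℤ.%ℕ p)) (s ℤ./ℕ p ℤ.* + p)) (≡.cong (ℤ._- + (s ℤ.%ℕ p)) (≡.sym (ℤ.a≡a%ℕn+[a/ℕn]*n s p))))
            (ℤ.∣n⇒∣m*n (s ℤ./ℕ p) ℤ.∣-refl)
    result : (∃ λ ρ′ → Residue p (s ℤ.+ + n) ρ′ × fromℕ p * multiples p s n + fromℕ ρ′ ≈ fromℕ n + fromℕ (s ℤ.%ℕ p)) →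
      fromℕ p * multiples p s n ≤ fromℕ n + fromℕ p × fromℕ n ≤ fromℕ p * multiples p s n + fromℕ p
    result (ρ′ , (ρ′<p , _) , e) =
      ≤-cert (solve 5 (λ m n p ρ ρ′ → n :+ p :- m := (p :- ρ) :+ ρ′ :+ (n :+ ρ :- (m :+ ρ′))) refl _ _ _ _ _)
        (≤⇒0≤- (fromℕ-mono (ℕ.<⇒≤ (ℤ.n%ℕd<d s p))) +0 0≤fromℕ ρ′ +0 ≤.reflexive (sym (≈⇒-≈0 (sym e)))) ,
      ≤-cert (solve 5 (λ m n p ρ ρ′ → m :+ p :- n := (p :- ρ′) :+ ρ :+ (m :+ ρ′ :- (n :+ ρ))) refl _ _ _ _ _)
        (≤⇒0≤- (fromℕ-mono (ℕ.<⇒≤ ρ′<p)) +0 0≤fromℕ (s ℤ.%ℕ p) +0 ≤.reflexive (sym (≈⇒-≈0 e)))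

  -- The form a y − b x at the point (a , b) = (i , b₀ + j).
  point : ℤ → ℕ → ℕ → ℕ → ℕ → ℤ
  point x y b₀ j i = + i ℤ.* + y ℤ.- + (b₀ ℕ.+ j) ℤ.* x

  column : ℕ → ℤ → ℕ → ℕ → ℕ → ℝ
  column p x y U b = Σ (range U) (λ i → δ p (+ i ℤ.* + y ℤ.- + b ℤ.* x))

  block : ℕ → ℤ → ℕ → ℕ → ℕ → ℝ
  block p x y U b₀ = Σ (range y) (λ j → column p x y U (b₀ ℕ.+ j))

  module Block {p : ℕ} {x : ℤ} {y : ℕ} (1≤p : 1 ℕ.≤ p) (1≤y : 1 ℕ.≤ y)
    (cop : Coprime ℤ.∣ x ∣ y) (small : y ℕ.* ℤ.∣ x ∣ ℕ.≤ p) (U b₀ : ℕ) where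

    private
      box : List (ℕ × ℕ)
      box = cartesianProduct (range y) (range U)

      box-unique : Unique box
      box-unique = cartesianProduct⁺ (range-unique y) (range-unique U)

      value : ℕ × ℕ → ℝ
      value (j , i) = δ p (point x y b₀ j i)

      block≈ : block p x y U b₀ ≈ Σ box value
      block≈ = sym (Σ-cartesianProduct (range y) (range U) value)

      ∣jx∣≤p : ∀ {j} → j ℕ.≤ y → ℤ.∣ + j ℤ.* x ∣ ℕ.≤ p
      ∣jx∣≤p {j} j≤y = ℕ.≤-trans (ℕ.≤-reflexive (ℤ.abs-* (+ j) x)) (ℕ.≤-trans (ℕ.*-monoˡ-≤ ℤ.∣ x ∣ j≤y) small)

      ∣-jx∣≤p : ∀ {j} → j ℕ.≤ y → ℤ.∣ ℤ.- (+ j ℤ.* x) ∣ ℕ.≤ p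
      ∣-jx∣≤p {j} j≤y = ≡.subst (ℕ._≤ p) (≡.sym (ℤ.∣-i∣≡∣i∣ (+ j ℤ.* x))) (∣jx∣≤p j≤y)

      pos : ∀ {n k} → k ∈ range n → 1 ℕ.≤ k
      pos {n} k∈ = proj₁ (∈-range⁻ {n} k∈)

      top : ∀ {n k} → k ∈ range n → k ℕ.≤ n
      top k∈ = proj₂ (∈-range⁻ k∈)

      -- Equal values give (j - j′) x = (i - i′) y. By coprimality y divides j - j′, which is
      -- smaller than y in absolute value.
      point-injective : ∀ {j j′ i i′} → j ℕ.≤ y → j′ ℕ.≤ y → 1 ℕ.≤ j → 1 ℕ.≤ j′ →
        point x y b₀ j i ≡ point x y b₀ j′ i′ → j ≡ j′ × i ≡ i′
      point-injective {j} {j′} {i} {i′} j≤y j′≤y 1≤j 1≤j′ e = j≡j′ , i≡i′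
        where
        lem : ∀ i i′ y b j j′ x → (i ℤ.* y ℤ.- (b ℤ.+ j) ℤ.* x) ℤ.- (i′ ℤ.* y ℤ.- (b ℤ.+ j′) ℤ.* x)
            ℤ.+ (j ℤ.- j′) ℤ.* x ≡ (i ℤ.- i′) ℤ.* y
        lem = ℤ-Solver.solve-∀
        rel : (+ j ℤ.- + j′) ℤ.* x ≡ (+ i ℤ.- + i′) ℤ.* + y
        rel = ≡.trans (≡.sym (≡.trans (≡.cong (ℤ._+ (+ j ℤ.- + j′) ℤ.* x) (ℤ.i≡j⇒i-j≡0 e)) (ℤ.+-identityˡ _)))
                (lem (+ i) (+ i′) (+ y) (+ b₀) (+ j) (+ j′) x)
        y∣ : + y ℤ.∣ + j ℤ.- + j′
        y∣ = coprime-∣-* cop (+ j ℤ.- + j′) (∣-resp (≡.sym rel) (ℤ.∣n⇒∣m*n (+ i ℤ.- + i′) ℤ.∣-refl))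
        distance : ∀ {a b} → 1 ℕ.≤ a → 1 ℕ.≤ b → a ℕ.≤ y → b ℕ.≤ y → ℤ.∣ + a ℤ.- + b ∣ ℕ.< y
        distance {suc a} {suc b} _ _ (ℕ.s≤s {n = y-1} a≤) (ℕ.s≤s b≤) = ℕ.s≤s (≡.subst (ℕ._≤ y-1)
          (≡.cong ℤ.∣_∣ (lem₂ (+ a) (+ b))) (∣+-+∣≤ a≤ b≤))
          where
          lem₂ : ∀ a b → a ℤ.- b ≡ + 1 ℤ.+ a ℤ.- (+ 1 ℤ.+ b)
          lem₂ = ℤ-Solver.solve-∀
        j≡j′ : j ≡ j′
        j≡j′ = ℤ.+-injective (ℤ.i-j≡0⇒i≡j _ _ (∣∧<⇒≡0 y∣ (distance 1≤j 1≤j′ j≤y j′≤y)))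
        i≡i′ : i ≡ i′
        i≡i′ = ℤ.+-injective (ℤ.i-j≡0⇒i≡j _ _ (ℤ.*-cancelʳ-≡ _ _ (+ y) {{ℤ.≢-nonZero λ e → ℕ.<⇒≢ 1≤y (≡.sym (ℤ.+-injective e))}}
          (≡.trans (≡.sym rel) (≡.cong (λ t → t ℤ.* x) (ℤ.i≡j⇒i-j≡0 (≡.cong +_ j≡j′))))))

    upper : fromℕ p * block p x y U b₀ ≤ fromℕ U * fromℕ y + fromℕ 3 * fromℕ p
    upper = ≤.trans (*-monoˡ-≤ (fromℕ p) (0≤fromℕ p) (block≈ ≈≤ inject))
      (≤.trans (proj₁ (multiples-bounds 1≤p s len)) (≤.reflexive (trans
        (+-congʳ (trans (fromℕ-+ (U ℕ.* y) (p ℕ.+ p)) (+-cong (fromℕ-* U y) (fromℕ-+ p p))))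
        (solve 2 (λ u p → u :+ (p :+ p) :+ p := u :+ κ 3 :* p) refl _ _))))
      where
      -- Since y |x| ≤ p, every j x lies within p of 0. Starting p lower and running 2p longer than
      -- U y thus captures all values; the third p in the bound is the rounding in
      -- `multiples-bounds`.
      s = ℤ.- (+ b₀ ℤ.* x) ℤ.- + p
      len = U ℕ.* y ℕ.+ (p ℕ.+ p)
      lem : ∀ i y b j x p → i ℤ.* y ℤ.- (b ℤ.+ j) ℤ.* x
          ≡ ℤ.- (b ℤ.* x) ℤ.- p ℤ.+ (i ℤ.* y ℤ.+ (p ℤ.+ ℤ.- (j ℤ.* x)))
      lem = ℤ-Solver.solve-∀

      find : ∀ {q} → q ∈ box → ∃ λ k → k ∈ range len × point x y b₀ (proj₁ q) (proj₂ q) ≡ s ℤ.+ + k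
      find {j , i} q∈ = i ℕ.* y ℕ.+ e , ∈-range⁺ (ℕ.≤-trans (ℕ.*-mono-≤ (pos i∈) 1≤y) (ℕ.m≤m+n _ e))
            (ℕ.+-mono-≤ (ℕ.*-monoˡ-≤ y (top i∈)) e≤) ,
          ≡.trans (lem (+ i) (+ y) (+ b₀) (+ j) x (+ p)) (≡.cong (ℤ._+_ s) (≡.trans
            (≡.cong₂ ℤ._+_ (≡.sym (ℤ.pos-* i y)) e≡) (≡.sym (ℤ.pos-+ (i ℕ.* y) e))))
        where
        j∈ = proj₁ (∈-cartesianProduct⁻ (range y) (range U) q∈)
        i∈ = proj₂ (∈-cartesianProduct⁻ (range y) (range U) q∈)
        shifted = shift-abs {p} (ℤ.- (+ j ℤ.* x)) (∣-jx∣≤p {j} (top j∈))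
        e = proj₁ shifted
        e≡ = proj₁ (proj₂ shifted)
        e≤ = proj₂ (proj₂ shifted)

      inject : Σ box value ≤ multiples p s len
      inject = Σ-≤-injective {ρ = λ q k → point x y b₀ (proj₁ q) (proj₂ q) ≡ s ℤ.+ + k} (λ q k → _ ℤ.≟ _) box-unique
        (λ {k} _ → 0≤δ p (s ℤ.+ + k))
        (λ q∈ → let k , k∈ , e = find q∈ in inj₂ (k , k∈ , e , ≤.reflexive (δ-cong p e)))
        (λ {q} {q′} q∈ q′∈ _ e e′ →
          let j∈  , _ = ∈-cartesianProduct⁻ (range y) (range U) q∈
              j′∈ , _ = ∈-cartesianProduct⁻ (range y) (range U) q′∈
              j≡ , i≡ = point-injective (top j∈) (top j′∈) (pos j∈) (pos j′∈) (≡.trans e (≡.sym e′))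
          in ≡.cong₂ _,_ j≡ i≡)

    lower : fromℕ U * fromℕ y ≤ fromℕ p * block p x y U b₀ + fromℕ 3 * fromℕ p
    lower = ≤.trans length-bound (≤.trans (+-mono-≤ (≤.trans (proj₂ (multiples-bounds 1≤p s len))
        (+-mono-≤ (*-monoˡ-≤ (fromℕ p) (0≤fromℕ p) (inject ≤≈ sym block≈)) ≤.refl)) ≤.refl)
        (≤.reflexive (solve 2 (λ u p → u :+ p :+ (p :+ p) := u :+ κ 3 :* p) refl _ _)))
      where
      -- Now p is cut off at either end: for k ≤ U y - 2p and j with y ∣ p + k + j x, the number p +
      -- k + j x lies between 1 and U y, so its quotient by y is an admissible i. If U y ≤ 2p the
      -- truncated length is 0 and there is no k to treat.
      s = ℤ.- (+ b₀ ℤ.* x) ℤ.+ + p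
      len = U ℕ.* y ℕ.∸ (p ℕ.+ p)

      length-bound : fromℕ U * fromℕ y ≤ fromℕ len + (fromℕ p + fromℕ p)
      length-bound = sym (fromℕ-* U y) ≈≤ (fromℕ-mono (ℕ.≤-trans (ℕ.m≤n+m∸n (U ℕ.* y) (p ℕ.+ p)) (ℕ.≤-reflexive (ℕ.+-comm (p ℕ.+ p) len)))
        ≤≈ trans (fromℕ-+ len (p ℕ.+ p)) (+-congˡ (fromℕ-+ p p)))

      lem : ∀ k p b j x → k ℤ.+ (p ℤ.+ j ℤ.* x) ℤ.- (b ℤ.+ j) ℤ.* x ≡ ℤ.- (b ℤ.* x) ℤ.+ p ℤ.+ k
      lem = ℤ-Solver.solve-∀
      lem₂ : ∀ k p z → p ℤ.+ k ℤ.+ z ≡ k ℤ.+ (p ℤ.+ z)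
      lem₂ = ℤ-Solver.solve-∀

      find : ∀ {k} → k ∈ range len → ∃ λ q → q ∈ box × point x y b₀ (proj₁ q) (proj₂ q) ≡ s ℤ.+ + k
      find {k} k∈ = (j , i) , ∈-cartesianProduct⁺ (∈-range⁺ 1≤j j≤y) (∈-range⁺ 1≤i i≤U) , eq
        where
        hit = residue-hit {x} {y} cop 1≤y (+ p ℤ.+ + k)
        j = proj₁ hit
        1≤j = proj₁ (proj₂ hit)
        j≤y = proj₁ (proj₂ (proj₂ hit))
        y∣ : + y ℤ.∣ + p ℤ.+ + k ℤ.+ + j ℤ.* x
        y∣ = proj₂ (proj₂ (proj₂ hit))
        shifted = shift-abs {p} (+ j ℤ.* x) (∣jx∣≤p {j} j≤y)
        e = proj₁ shifted
        e≡ : + p ℤ.+ + j ℤ.* x ≡ + e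
        e≡ = proj₁ (proj₂ shifted)
        total : + p ℤ.+ + k ℤ.+ + j ℤ.* x ≡ + (k ℕ.+ e)
        total = ≡.trans (lem₂ (+ k) (+ p) (+ j ℤ.* x)) (≡.trans (≡.cong (ℤ._+_ (+ k)) e≡) (≡.sym (ℤ.pos-+ k e)))
        y∣ₙ : y ℕ.∣ k ℕ.+ e
        y∣ₙ = ℤ.∣⇒∣ᵤ (∣-resp total y∣)
        i = ℕ.quotient y∣ₙ
        i*y : k ℕ.+ e ≡ i ℕ.* y
        i*y = ℕ._∣_.equality y∣ₙ
        1≤k = pos k∈
        1≤i : 1 ℕ.≤ i
        1≤i = ℕ.n≢0⇒n>0 λ i≡0 → ℕ.<⇒≢ (ℕ.≤-trans 1≤k (ℕ.m≤m+n k e)) (≡.sym (≡.trans i*y (≡.cong (ℕ._* y) i≡0)))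
        i≤U : i ℕ.≤ U
        i≤U = ℕ.*-cancelʳ-≤ i U y {{ℕ.>-nonZero 1≤y}} (ℕ.≤-trans (ℕ.≤-reflexive (≡.sym i*y))
          (ℕ.≤-trans (ℕ.+-mono-≤ (top k∈) (proj₂ (proj₂ shifted)))
            (ℕ.≤-reflexive (ℕ.m∸n+n≡m {U ℕ.* y} {p ℕ.+ p} (ℕ.<⇒≤ (ℕ.m∸n≢0⇒n<m {U ℕ.* y} {p ℕ.+ p} λ e → ℕ.<⇒≢ (ℕ.≤-trans 1≤k (top k∈)) (≡.sym e)))))))
        eq : point x y b₀ j i ≡ s ℤ.+ + k
        eq = ≡.trans (≡.cong (ℤ._- + (b₀ ℕ.+ j) ℤ.* x) (≡.trans (≡.sym (ℤ.pos-* i y)) (≡.trans (≡.cong +_ (≡.sym i*y))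
               (≡.trans (ℤ.pos-+ k e) (≡.cong (ℤ._+_ (+ k)) (≡.sym e≡)))))) (lem (+ k) (+ p) (+ b₀) (+ j) x)

      inject : multiples p s len ≤ Σ box value
      inject = Σ-≤-injective {ρ = λ k q → point x y b₀ (proj₁ q) (proj₂ q) ≡ s ℤ.+ + k} (λ k q → _ ℤ.≟ _) (range-unique len)
        (λ {q} _ → 0≤δ p (point x y b₀ (proj₁ q) (proj₂ q)))
        (λ k∈ → let q , q∈ , e = find k∈ in inj₂ (q , q∈ , e , ≤.reflexive (δ-cong p (≡.sym e))))
        (λ _ _ _ e e′ → ℤ.+-injective (+-cancelˡ (≡.trans (≡.sym e) e′)))
        where
        lem₃ : ∀ s k → s ℤ.+ k ℤ.- s ≡ k
        lem₃ = ℤ-Solver.solve-∀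
        +-cancelˡ : ∀ {k k′} → s ℤ.+ k ≡ s ℤ.+ k′ → k ≡ k′
        +-cancelˡ {k} {k′} e = ≡.trans (≡.sym (lem₃ s k)) (≡.trans (≡.cong (ℤ._- s) e) (lem₃ s k′))

  module RationalSlope {p : ℕ} {x : ℤ} {y : ℕ} (1≤p : 1 ℕ.≤ p) (1≤y : 1 ℕ.≤ y)
    (cop : Coprime ℤ.∣ x ∣ y) (small : y ℕ.* ℤ.∣ x ∣ ℕ.≤ p) (U : ℕ) where

    private
      columns : ℕ → ℝ
      columns n = Σ (range n) (column p x y U)

      columns-suc : ∀ m → columns (suc m ℕ.* y) ≈ columns (m ℕ.* y) + block p x y U (m ℕ.* y)
      columns-suc m = trans (reflexive (≡.cong columns (ℕ.+-comm y (m ℕ.* y)))) (Σ-range-+ (m ℕ.* y) y _)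

      upper : ∀ m → fromℕ p * columns (m ℕ.* y) ≤ fromℕ m * (fromℕ U * fromℕ y + fromℕ 3 * fromℕ p)
      upper zero    = ≤.reflexive (trans (zeroʳ _) (sym (zeroˡ _)))
      upper (suc m) = trans (*-congˡ (columns-suc m)) (distribˡ _ _ _) ≈≤
        (+-mono-≤ (upper m) (Block.upper 1≤p 1≤y cop small U (m ℕ.* y))
          ≤≈ solve 2 (λ m c → m :* c :+ c := (κ 1 :+ m) :* c) refl (fromℕ m) _)

      lower : ∀ m → fromℕ m * (fromℕ U * fromℕ y) ≤ fromℕ p * columns (m ℕ.* y) + fromℕ m * (fromℕ 3 * fromℕ p)
      lower zero    = ≤.reflexive (solve 3 (λ u p q → κ 0 :* u := p :* κ 0 :+ κ 0 :* q) refl _ _ _)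
      lower (suc m) = solve 2 (λ m c → (κ 1 :+ m) :* c := m :* c :+ c) refl (fromℕ m) _ ≈≤
        (+-mono-≤ (lower m) (Block.lower 1≤p 1≤y cop small U (m ℕ.* y)) ≤≈
          trans (solve 5 (λ p c b m q → p :* c :+ m :* q :+ (p :* b :+ q) := p :* (c :+ b) :+ (κ 1 :+ m) :* q)
                  refl (fromℕ p) (columns (m ℕ.* y)) (block p x y U (m ℕ.* y)) (fromℕ m) (fromℕ 3 * fromℕ p))
                (+-congʳ (*-congˡ (sym (columns-suc m)))))

      0≤column : ∀ b → 0# ≤ column p x y U b
      0≤column b = 0≤Σ (range U) (λ {i} _ → 0≤δ p (+ i ℤ.* + y ℤ.- + b ℤ.* x))

    -- The U columns contain `U ÷ y` complete blocks and are contained in one more. Each block costs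
    -- 3p, and the summand U y pays for the incomplete one.
    error : ∣ fromℕ p * Σ (range U) (column p x y U) - fromℕ U * fromℕ U ∣
      ≤ fromℕ U * fromℕ y + fromℕ 3 * (fromℕ p * (fromℕ (U ÷ y) + 1#))
    error = ∣x∣≤
      (≤-cert (solve 6 (λ N u y p m N′ → u :* y :+ κ 3 :* (p :* (m :+ κ 1)) :- (p :* N :- u :* u)
          := p :* (N′ :- N) :+ ((κ 1 :+ m) :* (u :* y :+ κ 3 :* p) :- p :* N′) :+ u :* (u :- y :* m))
          refl (columns U) (fromℕ U) (fromℕ y) (fromℕ p) (fromℕ m) (columns (suc m ℕ.* y)))
        (0≤fromℕ p *0 ≤⇒0≤- (Σ-range-≤ (ℕ.<⇒≤ (≡.subst (U ℕ.<_) (ℕ.*-comm y (suc m)) (<-*-÷ U 1≤y))) (λ {b} _ → 0≤column b))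
          +0 ≤⇒0≤- (upper (suc m)) +0 0≤fromℕ U *0 ≤⇒0≤- (sym (fromℕ-* y m) ≈≤ fromℕ-mono (*-÷-≤ U y))))
      (≤-cert (solve 6 (λ N u y p m N′ → u :* y :+ κ 3 :* (p :* (m :+ κ 1)) :- :- (p :* N :- u :* u)
          := p :* (N :- N′) :+ (p :* N′ :+ m :* (κ 3 :* p) :- m :* (u :* y)) :+ u :* (y :* (κ 1 :+ m) :- u) :+ κ 3 :* p)
          refl (columns U) (fromℕ U) (fromℕ y) (fromℕ p) (fromℕ m) (columns (m ℕ.* y)))
        (0≤fromℕ p *0 ≤⇒0≤- (Σ-range-≤ (≡.subst (ℕ._≤ U) (ℕ.*-comm y m) (*-÷-≤ U y)) (λ {b} _ → 0≤column b))
          +0 ≤⇒0≤- (lower m) +0 0≤fromℕ U *0 ≤⇒0≤- (fromℕ-mono (ℕ.<⇒≤ (<-*-÷ U 1≤y)) ≤≈ fromℕ-* y (suc m))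
          +0 0≤fromℕ 3 *0 0≤fromℕ p))
      where m = U ÷ y

  -- Averaging over the residues v.

  points : ℕ → ℤ → ℕ → ℝ
  points p v U = Σ (range U) (λ a → Σ (range U) (λ b → δ p (+ a ℤ.- v ℤ.* + b)))

  module Average {p r : ℕ} (pp : Prime p) (r<p : r ℕ.< p) (r²≤p : r ℕ.* r ℕ.≤ p) (p<r² : p ℕ.< suc r ℕ.* suc r) where

    private
      1≤p : 1 ℕ.≤ p
      1≤p = ℕ.≤-trans (ℕ.s≤s ℕ.z≤n) r<p

      1≤r : 1 ℕ.≤ r
      1≤r = ℕ.n≢0⇒n>0 λ { ≡.refl → ℕ.<⇒≱ (ℕ.<-≤-trans p<r² 1≤p) ℕ.≤-refl }

      same-slope : ∀ {v v′ y} → v ∈ range (p ℕ.∸ 1) → v′ ∈ range (p ℕ.∸ 1) → 1 ℕ.≤ y → y ℕ.< p → ∀ x →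
        + p ℤ.∣ x ℤ.- + v ℤ.* + y → + p ℤ.∣ x ℤ.- + v′ ℤ.* + y → v ≡ v′
      same-slope {v} {v′} {y} v∈ v′∈ 1≤y y<p x d d′ =
        [ (λ h → ℤ.+-injective (ℤ.i-j≡0⇒i≡j _ _ (∣∧<⇒≡0 h (ℕ.≤-<-trans (∣+-+∣≤ (below v∈) (below v′∈)) p-1<p))))
        , (λ h → ⊥-elim (ℕ.<⇒≢ 1≤y (≡.sym (ℤ.+-injective (∣∧<⇒≡0 h y<p))))) ]′
        (prime-∣-* pp (+ v ℤ.- + v′) (+ y) (∣-resp (lem x (+ v) (+ v′) (+ y)) (ℤ.∣m∣n⇒∣m-n d′ d)))
        where
        lem : ∀ x v v′ y → (x ℤ.- v′ ℤ.* y) ℤ.- (x ℤ.- v ℤ.* y) ≡ (v ℤ.- v′) ℤ.* y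
        lem = ℤ-Solver.solve-∀
        below : ∀ {v} → v ∈ range (p ℕ.∸ 1) → v ℕ.≤ p ℕ.∸ 1
        below v∈ = proj₂ (∈-range⁻ v∈)
        p-1<p : p ℕ.∸ 1 ℕ.< p
        p-1<p = ℕ.≤-reflexive (ℕ.m+[n∸m]≡n 1≤p)

      numerators : List ℕ
      numerators = range (suc (r ℕ.+ r))

      -- Encodes -r ≤ x ≤ r by 1 ≤ k ≤ 2r + 1, in keeping with ranges that start at 1.
      numerator : ℕ → ℤ
      numerator k = + k ℤ.- + suc r

      numerator-hit : ∀ x → ℤ.∣ x ∣ ℕ.≤ r → ∃ λ k → k ∈ numerators × numerator k ≡ x
      numerator-hit x ∣x∣≤r = let e , e≡ , e≤ = shift-abs {r} x ∣x∣≤r in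
        suc e , ∈-range⁺ (ℕ.s≤s ℕ.z≤n) (ℕ.s≤s e≤) ,
        ≡.trans (≡.cong (λ t → (+ 1 ℤ.+ t) ℤ.- + suc r) (≡.sym e≡)) (lem (+ r) x)
        where
        lem : ∀ r x → + 1 ℤ.+ (r ℤ.+ x) ℤ.- (+ 1 ℤ.+ r) ≡ x
        lem = ℤ-Solver.solve-∀

    module _ (U : ℕ) where

      bound : ℕ → ℝ
      bound y = fromℕ U * fromℕ y + fromℕ 3 * (fromℕ p * (fromℕ (U ÷ y) + 1#))

      0≤bound : ∀ y → 0# ≤ bound y
      0≤bound y = 0≤fromℕ U *0 0≤fromℕ y +0 0≤fromℕ 3 *0 (0≤fromℕ p *0 (0≤fromℕ (U ÷ y) +0 0≤1))

      deviation : ℕ → ℝ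
      deviation v = ∣ fromℕ p * points p (+ v) U - fromℕ U * fromℕ U ∣

      private
        slopes : List (ℕ × ℕ)
        slopes = cartesianProduct (range r) numerators

        deviation≤bound : ∀ v {x y} → ThueSolution p r (+ v) x y → deviation v ≤ bound y
        deviation≤bound v {x} {y} (∣x∣≤r , 1≤y , y≤r , cop , d) = ∣∣-mono (+-congʳ (*-congˡ (trans
            (Σ-cong (range U) (λ {a} _ → Σ-cong (range U) (λ {b} _ → entry a b))) (Σ-swap (range U) (range U) _))))
          (RationalSlope.error 1≤p 1≤y cop (ℕ.≤-trans (ℕ.*-mono-≤ y≤r ∣x∣≤r) r²≤p) U)
          where
          entry : ∀ a b → δ p (+ a ℤ.- + v ℤ.* + b) ≈ δ p (+ a ℤ.* + y ℤ.- + b ℤ.* x)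
          entry a b = 𝟙-cong (+ p ℤ.∣? (+ a ℤ.- + v ℤ.* + b)) (+ p ℤ.∣? (+ a ℤ.* + y ℤ.- + b ℤ.* x)) (proj₁ clear) (proj₂ clear)
            where
            clear = congruence-clear {p} {x} {y} {+ v} pp (ℕ.≤-<-trans y≤r r<p) 1≤y d (+ a) (+ b)

      -- Each residue is charged to a Thue solution (x, y). As y is a unit modulo p, a pair
      -- determines its residue, so no pair is charged twice and the sum may be extended to all
      -- pairs in the box.
      deviation-sum : Σ (range (p ℕ.∸ 1)) deviation ≤ fromℕ (suc (r ℕ.+ r)) * Σ (range r) bound
      deviation-sum = ≤.trans
        (Σ-≤-injective {ρ = λ v q → + p ℤ.∣ numerator (proj₂ q) ℤ.- + v ℤ.* + proj₁ q} (λ v q → _ ℤ.∣? _)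
          {deviation} {λ q → bound (proj₁ q)} (range-unique (p ℕ.∸ 1)) (λ {q} _ → 0≤bound (proj₁ q))
          (λ {v} _ → cover v (thue pp r<p p<r² (+ v)))
          (λ {v} {v′} {q} v∈ v′∈ q∈ d d′ → let y∈ , _ = ∈-cartesianProduct⁻ (range r) numerators q∈ in
            same-slope v∈ v′∈ (proj₁ (∈-range⁻ y∈)) (ℕ.≤-<-trans (proj₂ (∈-range⁻ y∈)) r<p) (numerator (proj₂ q)) d d′))
        (≤.reflexive (trans (Σ-cartesianProduct (range r) numerators _)
          (trans (Σ-cong (range r) (λ _ → Σ-range-const (suc (r ℕ.+ r)) _)) (Σ-*ˡ (range r) _ bound))))
        where
        cover : ∀ v → (∃ λ x → ∃ (ThueSolution p r (+ v) x)) → deviation v ≤ 0# ⊎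
          ∃ λ q → q ∈ slopes × + p ℤ.∣ numerator (proj₂ q) ℤ.- + v ℤ.* + proj₁ q × deviation v ≤ bound (proj₁ q)
        cover v (x , y , sol@(∣x∣≤r , 1≤y , y≤r , _ , d)) = let k , k∈ , e = numerator-hit x ∣x∣≤r in
          inj₂ ((y , k) , ∈-cartesianProduct⁺ (∈-range⁺ 1≤y y≤r) k∈ ,
            ∣-resp (≡.cong (λ t → t ℤ.- + v ℤ.* + y) (≡.sym e)) d , deviation≤bound v {x} {y} sol)

      bound-sum : Σ (range r) bound ≤ fromℕ r * (fromℕ U * fromℕ r) + fromℕ 3 * (fromℕ p * (fromℕ U * harmonic r + fromℕ r))
      bound-sum = Σ-mono (range r) termwise ≤≈ trans (Σ-+ (range r) _ _) (+-cong (Σ-range-const r _)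
          (trans (Σ-*ˡ (range r) (fromℕ 3) _) (*-congˡ (trans (Σ-*ˡ (range r) (fromℕ p) _) (*-congˡ
            (trans (Σ-+ (range r) _ _) (+-cong (Σ-*ˡ (range r) (fromℕ U) recip)
              (trans (Σ-range-const r 1#) (*-identityʳ _)))))))))
        where
        termwise : ∀ {y} → y ∈ range r → bound y ≤ fromℕ U * fromℕ r + fromℕ 3 * (fromℕ p * (fromℕ U * recip y + 1#))
        termwise {y} y∈ = +-mono-≤ (*-monoˡ-≤ _ (0≤fromℕ U) (fromℕ-mono (proj₂ (∈-range⁻ y∈))))
          (*-monoˡ-≤ _ (0≤fromℕ 3) (*-monoˡ-≤ _ (0≤fromℕ p) (+-mono-≤ (proj₁ (fromℕ-÷ U (proj₁ (∈-range⁻ y∈)))) ≤.refl)))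

      points-sum : U ℕ.< p → Σ (range (p ℕ.∸ 1)) (λ v → points p (+ v) U) ≤ fromℕ U * fromℕ U
      points-sum U<p = trans (Σ-swap (range (p ℕ.∸ 1)) (range U) _)
          (Σ-cong (range U) (λ _ → Σ-swap (range (p ℕ.∸ 1)) (range U) _)) ≈≤
        (Σ-mono (range U) (λ {a} _ → Σ-mono (range U) (λ {b} b∈ → Σ-𝟙-≤1 (λ v → + p ℤ.∣? (+ a ℤ.- + v ℤ.* + b))
          (range-unique (p ℕ.∸ 1)) (λ v∈ v′∈ → same-slope v∈ v′∈ (proj₁ (∈-range⁻ b∈)) (ℕ.≤-<-trans (proj₂ (∈-range⁻ b∈)) U<p) (+ a))))
        ≤≈ trans (Σ-cong (range U) (λ _ → trans (Σ-range-const U 1#) (*-identityʳ _))) (Σ-range-const U _))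

      -- With b ≤ U < p each pair (a, b) satisfies the congruence for at most one v, so the triangle
      -- inequality is enough. It serves for U < r, where the 3p per residue in `bound` would add up
      -- to order p r² and exceed p U r.
      deviation-sum-small : U ℕ.< p → Σ (range (p ℕ.∸ 1)) deviation ≤ fromℕ 2 * (fromℕ p * (fromℕ U * fromℕ U))
      deviation-sum-small U<p = ≤.trans
        (Σ-mono (range (p ℕ.∸ 1)) (λ {v} _ → ∣∣-sub-≤ (≤.reflexive (∣∣-of-≥0 (0≤fromℕ p *0 0≤points v))) (≤.reflexive (∣∣-of-≥0 (0≤fromℕ U *0 0≤fromℕ U)))))
        ((trans (Σ-+ (range (p ℕ.∸ 1)) _ _) (+-cong (Σ-*ˡ (range (p ℕ.∸ 1)) (fromℕ p) _) (Σ-range-const (p ℕ.∸ 1) _)) ≈≤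
          +-mono-≤ (*-monoˡ-≤ _ (0≤fromℕ p) (points-sum U<p)) (*-monoʳ-≤ _ (0≤fromℕ U *0 0≤fromℕ U) (fromℕ-mono (ℕ.m∸n≤m p 1))))
         ≤≈ solve 2 (λ p u → p :* u :+ p :* u := κ 2 :* (p :* u)) refl (fromℕ p) _)
        where
        0≤points : ∀ v → 0# ≤ points p (+ v) U
        0≤points v = 0≤Σ (range U) (λ {a} _ → 0≤Σ (range U) (λ {b} _ → 0≤δ p (+ a ℤ.- + v ℤ.* + b)))

    lattice-bound : ∀ {U D} → 1 ℕ.≤ U → U ℕ.≤ D →
      Σ (range (p ℕ.∸ 1)) (deviation U) ≤ fromℕ 21 * (fromℕ p * (fromℕ U * (fromℕ r * harmonic D)))
    lattice-bound {U} {D} 1≤U U≤D with r ℕ.≤? U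
    ... | no r≰U = ≤.trans (deviation-sum-small U (ℕ.<-trans U<r r<p)) (≤-cert
          (solve 4 (λ p u r h → κ 21 :* (p :* (u :* (r :* h))) :- κ 2 :* (p :* (u :* u))
             := κ 19 :* (p :* (u :* (r :* h))) :+ κ 2 :* (p :* (u :* (r :* (h :- κ 1)))) :+ κ 2 :* (p :* (u :* (r :- u))))
             refl (fromℕ p) (fromℕ U) (fromℕ r) (harmonic D))
          (0≤fromℕ 19 *0 (0≤fromℕ p *0 (0≤fromℕ U *0 (0≤fromℕ r *0 0≤harmonic D)))
           +0 0≤fromℕ 2 *0 (0≤fromℕ p *0 (0≤fromℕ U *0 (0≤fromℕ r *0 1≤H)))
           +0 0≤fromℕ 2 *0 (0≤fromℕ p *0 (0≤fromℕ U *0 ≤⇒0≤- (fromℕ-mono (ℕ.<⇒≤ U<r))))))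
      where
      U<r = ℕ.≰⇒> r≰U
      1≤H = ≤⇒0≤- (1≤harmonic (ℕ.≤-trans 1≤U U≤D))
    ... | yes r≤U = ≤.trans (deviation-sum U) (≤.trans (*-mono-≤ (0≤fromℕ (suc (r ℕ.+ r))) 0≤b slopes≤3r (bound-sum U)) (final (fromℕ p) (fromℕ U) (fromℕ r) (harmonic r) (harmonic D)
          (0≤fromℕ p) (0≤fromℕ U) (0≤fromℕ r) (sym (fromℕ-* r r) ≈≤ fromℕ-mono r²≤p) (fromℕ-mono r≤U)
          (harmonic-mono (ℕ.≤-trans r≤U U≤D)) (1≤harmonic (ℕ.≤-trans 1≤U U≤D))))
      where
      0≤b = 0≤fromℕ r *0 (0≤fromℕ U *0 0≤fromℕ r) +0 0≤fromℕ 3 *0 (0≤fromℕ p *0 (0≤fromℕ U *0 0≤harmonic r +0 0≤fromℕ r))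
      slopes≤3r : fromℕ (suc (r ℕ.+ r)) ≤ fromℕ 3 * fromℕ r
      slopes≤3r = ≤-cert (trans (+-congˡ (-‿cong (+-congˡ (fromℕ-+ r r))))
        (solve 1 (λ r → κ 3 :* r :- (κ 1 :+ (r :+ r)) := r :- κ 1) refl (fromℕ r))) (≤⇒0≤- (1≤fromℕ 1≤r))
      -- The constant is 21 = 3 + 9 + 9: the three products are reduced to p u r H by r² ≤ p, by h ≤
      -- H and by r ≤ u, with 1 ≤ H supplying the missing factor.
      final : ∀ p u r h H → 0# ≤ p → 0# ≤ u → 0# ≤ r → r * r ≤ p → r ≤ u → h ≤ H → 1# ≤ H →
        fromℕ 3 * r * (r * (u * r) + fromℕ 3 * (p * (u * h + r))) ≤ fromℕ 21 * (p * (u * (r * H)))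
      final p u r h H 0≤p 0≤u 0≤r r²≤p r≤u h≤H 1≤H = ≤-cert
        (solve 5 (λ p u r h H → κ 21 :* (p :* (u :* (r :* H))) :- κ 3 :* r :* (r :* (u :* r) :+ κ 3 :* (p :* (u :* h :+ r)))
          := κ 3 :* r :* u :* (p :- r :* r) :+ κ 9 :* r :* p :* u :* (H :- h) :+ κ 9 :* r :* p :* (u :- r)
             :+ κ 12 :* r :* p :* u :* (H :- κ 1)) refl p u r h H)
        (0≤fromℕ 3 *0 0≤r *0 0≤u *0 ≤⇒0≤- r²≤p +0 0≤fromℕ 9 *0 0≤r *0 0≤p *0 0≤u *0 ≤⇒0≤- h≤H
          +0 0≤fromℕ 9 *0 0≤r *0 0≤p *0 ≤⇒0≤- r≤u +0 0≤fromℕ 12 *0 0≤r *0 0≤p *0 0≤u *0 ≤⇒0≤- 1≤H)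

-- From Farey fractions to sums over common divisors.

module Farey (𝓡 : RealNumbers) where

  open OrderedField 𝓡
  open FiniteSums 𝓡
  open Basel 𝓡 using (harmonic; 0≤harmonic; 1≤harmonic; harmonic-mono; recip∈; squares; r; 0≤r; r-inverse; recip-1; ·1; 6/π²)
  open Möbius 𝓡
  open Density 𝓡
  open LatticePoints 𝓡
  open SetoidReasoning setoid

  IsFloor : ℝ → ℕ → Set
  IsFloor T D = fromℕ D ≤ T × T < fromℕ (suc D)

  -- The Archimedean property yields some natural number above T, not the least one. Searching
  -- downwards from it also shows that the floor lies inside the box over which `R` counts.
  floorBelow : ℝ → ℕ → ℕ
  floorBelow T zero    = 0
  floorBelow T (suc n) = if does (fromℕ (suc n) ≤.≤? T) then suc n else floorBelow T n

  floorBelow-spec : ∀ {T} → 0# ≤ T → ∀ n → T < fromℕ (suc n) → floorBelow T n ℕ.≤ n × IsFloor T (floorBelow T n)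
  floorBelow-spec 0≤T zero T<1 = ℕ.≤-refl , 0≤T , T<1
  floorBelow-spec {T} 0≤T (suc n) T<n+2 with fromℕ (suc n) ≤.≤? T
  ... | yes n+1≤T = ℕ.≤-refl , n+1≤T , T<n+2
  ... | no  n+1≰T with floorBelow-spec 0≤T n (≰⇒> n+1≰T)
  ...   | D≤n , fl = ℕ.m≤n⇒m≤1+n D≤n , fl

  <-fromℕ-suc : ∀ {T n} → T ≤ fromℕ n → T < fromℕ (suc n)
  <-fromℕ-suc {T} {n} T≤n = ≤.trans T≤n (fromℕ-mono (ℕ.n≤1+n n)) ,
    λ e → ℕ.<⇒≱ (ℕ.n<1+n n) (fromℕ-cancel-≤ (sym e ≈≤ T≤n))

  floor : ℝ → ℕ
  floor T = floorBelow T (proj₁ (archimedean T))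

  floor-spec : ∀ {T} → 0# ≤ T → floor T ℕ.≤ proj₁ (archimedean T) × IsFloor T (floor T)
  floor-spec {T} 0≤T = floorBelow-spec 0≤T (proj₁ (archimedean T)) (<-fromℕ-suc {n = proj₁ (archimedean T)} (proj₂ (archimedean T)))

  beyond-floor : ∀ {T D α} → IsFloor T D → D ℕ.< α → ¬ (fromℕ α ≤ T)
  beyond-floor (_ , T<D+1) D<α α≤T = <⇒≱ T<D+1 (≤.trans (fromℕ-mono D<α) α≤T)

  coprimePoints : ℕ → ℤ → ℕ → ℝ
  coprimePoints p v D = Σ (range D) (λ a → Σ (range D) (λ b → 𝟙 (gcd a b ℕ.≟ 1) * δ p (+ a ℤ.- v ℤ.* + b)))

  R≈ : ∀ {T D p} → Prime p → IsFloor T D → D ℕ.≤ proj₁ (archimedean T) → ∀ v →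
    fromℕ (R T p v) ≈ coprimePoints p v D
  R≈ {T} {D} {p} pp fl D≤N v = begin
    fromℕ (R T p v)
      ≈⟨ length-filter (counted? T p v) (cartesianProduct (upTo (suc N)) (upTo (suc N))) ⟩
    Σ (cartesianProduct (upTo (suc N)) (upTo (suc N))) (λ q → 𝟙 (counted? T p v q))
      ≈⟨ Σ-cartesianProduct (upTo (suc N)) (upTo (suc N)) _ ⟩
    Σ (upTo (suc N)) (λ a → Σ (upTo (suc N)) (λ b → c a b))
      ≈⟨ restrict (λ a → Σ (upTo (suc N)) (c a)) (λ a out → Σ-0 (upTo (suc N)) (λ {b} _ →
           𝟙-no (counted? T p v (a , b)) (λ { ((_ , h , _) , _) → out h }))) ⟩
    Σ (range D) (λ a → Σ (upTo (suc N)) (λ b → c a b))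
      ≈⟨ Σ-cong (range D) (λ {a} _ → restrict (c a) (λ b out → 𝟙-no (counted? T p v (a , b)) (λ { ((_ , _ , h) , _) → out h }))) ⟩
    Σ (range D) (λ a → Σ (range D) (λ b → c a b))
      ≈⟨ Σ-cong (range D) (λ a∈ → Σ-cong (range D) (λ b∈ → entry a∈ b∈)) ⟩
    coprimePoints p v D ∎
    where
    N = proj₁ (archimedean T)
    c : ℕ → ℕ → ℝ
    c a b = 𝟙 (counted? T p v (a , b))

    restrict : (f : ℕ → ℝ) → (∀ α → ¬ (1 ℕ.≤ α × fromℕ α ≤ T) → f α ≈ 0#) → Σ (upTo (suc N)) f ≈ Σ (range D) f
    restrict f h = trans (Σ-upTo N f) (trans (+-cong (h 0 λ ()) (Σ-range-extend D≤N (λ D<k → h _ (λ { (_ , k≤T) → beyond-floor fl D<k k≤T }))))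
      (+-identityˡ _))

    entry : ∀ {a b} → a ∈ range D → b ∈ range D → c a b ≈ 𝟙 (gcd a b ℕ.≟ 1) * δ p (+ a ℤ.- v ℤ.* + b)
    entry {a} {b} a∈ b∈ = cases (gcd a b ℕ.≟ 1) (+ p ℤ.∣? (+ a ℤ.- v ℤ.* + b))
      where
      inside : ∀ {k} → k ∈ range D → 1 ℕ.≤ k × fromℕ k ≤ T
      inside k∈ = proj₁ (∈-range⁻ k∈) , ≤.trans (fromℕ-mono (proj₂ (∈-range⁻ k∈))) (proj₁ fl)

      -- If p divided b, the congruence would make it divide a as well, against coprimality of a and
      -- b.
      p∤b : gcd a b ≡ 1 → + p ℤ.∣ + a ℤ.- v ℤ.* + b → gcd b p ≡ 1
      p∤b g≡1 d = [ (λ e → e) , (λ e → ⊥-elim (p≢1 (∣1⇒≡1 (≡.subst (p ∣_) g≡1 (gcd-greatest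
            (ℤ.∣⇒∣ᵤ {+ p} {+ a} (∣-resp (lem (+ a) (v ℤ.* + b)) (ℤ.∣m∣n⇒∣m+n d (ℤ.∣n⇒∣m*n v (ℤ.∣ᵤ⇒∣ {+ p} {+ b} (p∣b e))))))
            (p∣b e)))))) ]′
          (prime⇒irreducible pp (gcd[m,n]∣n b p))
        where
        lem : ∀ a z → a ℤ.- z ℤ.+ z ≡ a
        lem = ℤ-Solver.solve-∀
        p∣b : gcd b p ≡ p → p ∣ b
        p∣b e = ≡.subst (_∣ b) e (gcd[m,n]∣m b p)
        p≢1 : ¬ (p ≡ 1)
        p≢1 ≡.refl = ¬prime[1] pp

      cases : (g? : Dec (gcd a b ≡ 1)) (d? : Dec (+ p ℤ.∣ + a ℤ.- v ℤ.* + b)) → c a b ≈ 𝟙 g? * 𝟙 d?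
      cases (yes g) (yes d) = trans (𝟙-yes (counted? T p v (a , b)) ((g , inside a∈ , inside b∈) , p∤b g d , d)) (sym (*-identityʳ 1#))
      cases (yes g) (no ¬d) = trans (𝟙-no (counted? T p v (a , b)) (λ (_ , _ , d) → ¬d d)) (sym (zeroʳ _))
      cases (no ¬g) d?      = trans (𝟙-no (counted? T p v (a , b)) (λ ((g , _) , _) → ¬g g)) (sym (zeroˡ _))

  multiplePoints : ℕ → ℤ → ℕ → ℕ → ℝ
  multiplePoints p v D d = Σ (range (D ÷ d)) (λ a → Σ (range (D ÷ d)) (λ b → δ p (+ (d ℕ.* a) ℤ.- v ℤ.* + (d ℕ.* b))))

  coprimePoints≈ : ∀ p v D → coprimePoints p v D ≈ Σ (range D) (λ d → μ d * multiplePoints p v D d)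
  coprimePoints≈ p v D = begin
    Σ (range D) (λ a → Σ (range D) (λ b → 𝟙 (gcd a b ℕ.≟ 1) * f a b))
      ≈⟨ Σ-cong (range D) (λ a∈ → Σ-cong (range D) (λ b∈ → expand a∈ b∈)) ⟩
    Σ (range D) (λ a → Σ (range D) (λ b → Σ (range D) (λ d → μ d * (𝟙 (d ∣? a) * (𝟙 (d ∣? b) * f a b)))))
      ≈⟨ Σ-cong (range D) (λ _ → Σ-swap (range D) (range D) _) ⟩
    Σ (range D) (λ a → Σ (range D) (λ d → Σ (range D) (λ b → μ d * (𝟙 (d ∣? a) * (𝟙 (d ∣? b) * f a b)))))
      ≈⟨ Σ-swap (range D) (range D) _ ⟩
    Σ (range D) (λ d → Σ (range D) (λ a → Σ (range D) (λ b → μ d * (𝟙 (d ∣? a) * (𝟙 (d ∣? b) * f a b)))))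
      ≈⟨ Σ-cong (range D) collect ⟩
    Σ (range D) (λ d → μ d * multiplePoints p v D d) ∎
    where
    f : ℕ → ℕ → ℝ
    f a b = δ p (+ a ℤ.- v ℤ.* + b)

    expand : ∀ {a b} → a ∈ range D → b ∈ range D →
      𝟙 (gcd a b ℕ.≟ 1) * f a b ≈ Σ (range D) (λ d → μ d * (𝟙 (d ∣? a) * (𝟙 (d ∣? b) * f a b)))
    expand {a} {b} a∈ b∈ = begin
      𝟙 (gcd a b ℕ.≟ 1) * f a b
        ≈⟨ *-congʳ (Σμ-divisors {D} {gcd a b} 1≤g (ℕ.≤-trans (∣⇒≤ {{ℕ.>-nonZero (proj₁ (∈-range⁻ a∈))}} (gcd[m,n]∣m a b)) (proj₂ (∈-range⁻ a∈)))) ⟨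
      Σ (range D) (λ d → 𝟙 (d ∣? gcd a b) * μ d) * f a b
        ≈⟨ *-comm _ _ ⟩
      f a b * Σ (range D) (λ d → 𝟙 (d ∣? gcd a b) * μ d)
        ≈⟨ Σ-*ˡ (range D) (f a b) _ ⟨
      Σ (range D) (λ d → f a b * (𝟙 (d ∣? gcd a b) * μ d))
        ≈⟨ Σ-cong (range D) (λ {d} _ → trans (*-congˡ (*-congʳ (both d)))
             (solve 4 (λ f x y m → f :* (x :* y :* m) := m :* (x :* (y :* f))) refl (f a b) (𝟙 (d ∣? a)) (𝟙 (d ∣? b)) (μ d))) ⟩
      Σ (range D) (λ d → μ d * (𝟙 (d ∣? a) * (𝟙 (d ∣? b) * f a b))) ∎
      where
      1≤g : 1 ℕ.≤ gcd a b
      1≤g = ℕ.n≢0⇒n>0 (gcd[m,n]≢0 a b (inj₁ λ a≡0 → ℕ.<⇒≢ (proj₁ (∈-range⁻ a∈)) (≡.sym a≡0)))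
      both : ∀ d → 𝟙 (d ∣? gcd a b) ≈ 𝟙 (d ∣? a) * 𝟙 (d ∣? b)
      both d = cases (d ∣? a) (d ∣? b)
        where
        cases : (x : Dec (d ∣ a)) (y : Dec (d ∣ b)) → 𝟙 (d ∣? gcd a b) ≈ 𝟙 x * 𝟙 y
        cases (yes x) (yes y) = trans (𝟙-yes (d ∣? gcd a b) (gcd-greatest x y)) (sym (*-identityʳ 1#))
        cases (yes x) (no ¬y) = trans (𝟙-no (d ∣? gcd a b) (λ h → ¬y (∣-trans h (gcd[m,n]∣n a b)))) (sym (zeroʳ _))
        cases (no ¬x) y       = trans (𝟙-no (d ∣? gcd a b) (λ h → ¬x (∣-trans h (gcd[m,n]∣m a b)))) (sym (zeroˡ _))

    collect : ∀ {d} → d ∈ range D →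
      Σ (range D) (λ a → Σ (range D) (λ b → μ d * (𝟙 (d ∣? a) * (𝟙 (d ∣? b) * f a b)))) ≈ μ d * multiplePoints p v D d
    collect {d} d∈ = trans
      (Σ-cong (range D) (λ _ → trans (Σ-*ˡ (range D) (μ d) _) (*-congˡ (trans (Σ-*ˡ (range D) _ _) (*-congˡ (Σ-multiples D 1≤d _))))))
      (trans (Σ-*ˡ (range D) (μ d) _) (*-congˡ (Σ-multiples D 1≤d _)))
      where 1≤d = proj₁ (∈-range⁻ d∈)

  squares≤2 : ∀ n → squares n ≤ fromℕ 2
  squares≤2 zero    = 0≤fromℕ 2
  squares≤2 (suc n) = ≤.trans (≤-cert (solve 2 (λ x y → x :+ y :- x := y) refl _ _) (0≤r n)) (go n)
    where
    -- Adding 1/(n+1) makes the induction close, because 1/(n+2)² ≤ 1/(n+1) - 1/(n+2).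
    go : ∀ n → squares (suc n) + r n ≤ fromℕ 2
    go zero    = ≤.reflexive (trans (+-cong (trans (+-identityʳ _) (*-cong recip-1 recip-1)) recip-1)
      (solve 0 (κ 1 :* κ 1 :+ κ 1 := κ 2) refl))
    go (suc n) = ≤.trans (≤-cert
      (solve 4 (λ x a b m → x :+ a :- (b :* b :+ x :+ b)
          := b :* (a :- b) :+ a :* (κ 1 :- (κ 1 :+ m) :* b) :+ b :* (m :* a :- κ 1))
          refl (squares (suc n)) (r n) (r (suc n)) (fromℕ (suc n)))
      (0≤r (suc n) *0 ≤⇒0≤- (recip-antitone {suc n} (ℕ.s≤s ℕ.z≤n) (ℕ.n≤1+n (suc n)))
        +0 zero-≤ (≈0-* _ (≈⇒-≈0 (sym (r-inverse (suc n))))) +0 zero-≤ (≈0-* _ (≈⇒-≈0 (r-inverse n))))) (go n)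
      where
      zero-≤ : ∀ {x} → x ≈ 0# → 0# ≤ x
      zero-≤ e = ≤.reflexive (sym e)

  -- Summing the errors over all common divisors.

  module ErrorBound {p q D : ℕ} {T : ℝ} (pp : Prime p) (q<p : q ℕ.< p) (q²≤p : q ℕ.* q ℕ.≤ p) (p<q² : p ℕ.< suc q ℕ.* suc q)
    (0≤T : 0# ≤ T) (fl : IsFloor T D) (D≤N : D ℕ.≤ proj₁ (archimedean T)) where

    private
      H = harmonic D
      1≤p = 1≤-prime pp
      u : ℕ → ℝ
      u d = fromℕ (D ÷ d)
      A : ℕ → ℕ → ℝ
      A d v = multiplePoints p (+ v) D d
      residues = range (p ℕ.∸ 1)

      deviationAt : ℕ → ℕ → ℝ
      deviationAt d v = ∣ fromℕ p * A d v - u d * u d ∣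

      lem : ∀ d a v b → d ℤ.* a ℤ.- v ℤ.* (d ℤ.* b) ≡ d ℤ.* (a ℤ.- v ℤ.* b)
      lem = ℤ-Solver.solve-∀

      factor : ∀ d a v b → + (d ℕ.* a) ℤ.- + v ℤ.* + (d ℕ.* b) ≡ + d ℤ.* (+ a ℤ.- + v ℤ.* + b)
      factor d a v b = ≡.trans (≡.cong₂ (λ s t → s ℤ.- + v ℤ.* t) (ℤ.pos-* d a) (ℤ.pos-* d b)) (lem (+ d) (+ a) (+ v) (+ b))

      A-coprime : ∀ {d} v → ¬ (p ∣ d) → A d v ≈ points p (+ v) (D ÷ d)
      A-coprime {d} v p∤d = Σ-cong (range (D ÷ d)) (λ {a} _ → Σ-cong (range (D ÷ d)) (λ {b} _ →
        𝟙-cong (+ p ℤ.∣? _) (+ p ℤ.∣? _)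
          (λ h → [ (λ k → ⊥-elim (p∤d (ℤ.∣⇒∣ᵤ {+ p} {+ d} k))) , (λ k → k) ]′ (prime-∣-* pp (+ d) _ (∣-resp (factor d a v b) h)))
          (λ h → ∣-resp (≡.sym (factor d a v b)) (ℤ.∣n⇒∣m*n (+ d) h))))

      A-multiple : ∀ {d} v → p ∣ d → A d v ≈ u d * u d
      A-multiple {d} v p∣d = trans (Σ-cong (range (D ÷ d)) (λ {a} _ → trans (Σ-cong (range (D ÷ d)) (λ {b} _ →
          𝟙-yes (+ p ℤ.∣? _) (∣-resp (≡.sym (factor d a v b)) (ℤ.∣m⇒∣m*n _ (ℤ.∣ᵤ⇒∣ {+ p} {+ d} p∣d)))))
          (trans (Σ-range-const (D ÷ d) 1#) (*-identityʳ _)))) (Σ-range-const (D ÷ d) _)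

      -- Majorants for the deviation at d, summed over the residues, when p ∤ d and when p ∣ d. In
      -- the second case all pairs are counted for every v, at a cost of p² (D/d)²; over the
      -- multiples d of p this adds up to 2D², which after division by p is of the size T²/p.
      coprime-part multiple-part : ℕ → ℝ
      coprime-part d = fromℕ 21 * (fromℕ p * (fromℕ D * (fromℕ q * H))) * recip d
      multiple-part d = fromℕ p * fromℕ p * (fromℕ D * fromℕ D) * (𝟙 (p ∣? d) * (recip d * recip d))

      0≤coprime-part : ∀ {d} → d ∈ range D → 0# ≤ coprime-part d
      0≤coprime-part d∈ = 0≤fromℕ 21 *0 (0≤fromℕ p *0 (0≤fromℕ D *0 (0≤fromℕ q *0 0≤harmonic D))) *0 recip∈ {D} d∈

      deviation-at-sum : ∀ {d} → d ∈ range D → Σ residues (deviationAt d) ≤ coprime-part d + multiple-part d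
      deviation-at-sum {d} d∈ = cases (p ∣? d)
        where
        1≤d = proj₁ (∈-range⁻ d∈)
        u≤ : u d ≤ fromℕ D * recip d
        u≤ = proj₁ (fromℕ-÷ D 1≤d)
        cases : (c : Dec (p ∣ d)) → Σ residues (deviationAt d)
              ≤ coprime-part d + fromℕ p * fromℕ p * (fromℕ D * fromℕ D) * (𝟙 c * (recip d * recip d))
        cases (no p∤d) = ≤.trans (Σ-mono residues (λ {v} _ → ≤.reflexive (∣∣-cong (+-congʳ (*-congˡ (A-coprime v p∤d))))))
          (≤.trans (Average.lattice-bound pp q<p q²≤p p<q² (1≤÷ d∈) (÷-≤ D 1≤d)) (≤-cert
            (solve 6 (λ p x ρ u q h → κ 21 :* (p :* (x :* (q :* h))) :* ρ :+ p :* p :* (x :* x) :* (κ 0 :* (ρ :* ρ)) :- κ 21 :* (p :* (u :* (q :* h)))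
               := κ 21 :* (p :* (q :* h :* (x :* ρ :- u)))) refl (fromℕ p) (fromℕ D) (recip d) (u d) (fromℕ q) H)
            (0≤fromℕ 21 *0 (0≤fromℕ p *0 (0≤fromℕ q *0 0≤harmonic D *0 ≤⇒0≤- u≤)))))
        cases (yes p∣d) = ≤.trans (Σ-mono residues {g = λ _ → fromℕ p * (u d * u d)} (λ {v} _ → ∣∣-mono (+-congʳ (*-congˡ (A-multiple v p∣d)))
            (∣x∣≤ (≤-cert (solve 2 (λ p u → p :* u :- (p :* u :- u) := u) refl (fromℕ p) (u d * u d)) 0≤uu)
                  (≤-cert (solve 2 (λ p u → p :* u :- :- (p :* u :- u) := p :* u :+ (p :- κ 1) :* u) refl (fromℕ p) (u d * u d))
                    (0≤fromℕ p *0 0≤uu +0 ≤⇒0≤- (1≤fromℕ 1≤p) *0 0≤uu)))))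
          (Σ-range-const (p ℕ.∸ 1) _ ≈≤ ≤.trans (*-monoʳ-≤ _ (0≤fromℕ p *0 0≤uu) (fromℕ-mono (ℕ.m∸n≤m p 1))) (≤-cert
            (solve 5 (λ p x ρ u c → c :+ p :* p :* (x :* x) :* (κ 1 :* (ρ :* ρ)) :- p :* (p :* (u :* u))
               := c :+ p :* p :* ((x :* ρ :- u) :* (x :* ρ :+ u))) refl (fromℕ p) (fromℕ D) (recip d) (u d) (coprime-part d))
            (0≤coprime-part d∈ +0 0≤fromℕ p *0 0≤fromℕ p *0 (≤⇒0≤- u≤ *0 (0≤fromℕ D *0 recip∈ {D} d∈ +0 0≤fromℕ (D ÷ d))))))
          where
          0≤uu = 0≤fromℕ (D ÷ d) *0 0≤fromℕ (D ÷ d)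

      multiple-sum : Σ (range D) multiple-part ≤ fromℕ 2 * (fromℕ D * fromℕ D)
      multiple-sum = trans (Σ-*ˡ (range D) _ _) (trans (*-congˡ (trans (Σ-multiples D 1≤p _)
          (trans (Σ-cong (range (D ÷ p)) (λ k∈ → trans (*-cong (recip-* 1≤p (proj₁ (∈-range⁻ k∈))) (recip-* 1≤p (proj₁ (∈-range⁻ k∈))))
              (solve 2 (λ x y → x :* y :* (x :* y) := x :* x :* (y :* y)) refl _ _)))
            (Σ-*ˡ (range (D ÷ p)) (recip p * recip p) _))))
          (trans (solve 4 (λ p i x s → p :* p :* (x :* x) :* (i :* i :* s) := s :* (x :* x) :* (p :* i) :* (p :* i)) refl (fromℕ p) (recip p) (fromℕ D) _)
            (sym (trans (·1 (recip-inverse 1≤p)) (·1 (recip-inverse 1≤p)))))) ≈≤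
        *-monoʳ-≤ _ (0≤fromℕ D *0 0≤fromℕ D) (squares≤2 (D ÷ p))

      total-deviation : Σ (range D) (λ d → Σ residues (deviationAt d))
        ≤ fromℕ 21 * (fromℕ p * (fromℕ D * (fromℕ q * H))) * H + fromℕ 2 * (fromℕ D * fromℕ D)
      total-deviation = ≤.trans (Σ-mono (range D) deviation-at-sum) (Σ-+ (range D) coprime-part multiple-part ≈≤
        +-mono-≤ (≤.reflexive (Σ-*ˡ (range D) _ recip)) multiple-sum)

      -- The error of `coprime-density`. It does not depend on v: p - 1 residues, followed by the
      -- division by p, leave at most one copy.
      Δ : ℝ
      Δ = fromℕ 2 * T * H + fromℕ 64 * (T * (H * H)) + fromℕ 2 * T

      deviationR : ℕ → ℝ
      deviationR v = ∣ fromℕ (R T p (+ v)) - 6/π² * (T * T * recip p) ∣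

      pointwise : ∀ v → fromℕ p * deviationR v ≤ Σ (range D) (λ d → deviationAt d v) + Δ
      pointwise v = sym (∣c*x∣ _ (0≤fromℕ p)) ≈≤ ∣∣-mono rearrange
        (∣∣-+-≤ (∣Σμ∣≤ D (λ _ → ≤.refl)) (coprime-density {D} (proj₁ fl) (proj₁ (proj₂ fl))))
        where
        S = Σ (range D) (λ d → μ d * (u d * u d))
        rearrange : fromℕ p * (fromℕ (R T p (+ v)) - 6/π² * (T * T * recip p))
          ≈ Σ (range D) (λ d → μ d * (fromℕ p * A d v - u d * u d)) + (S - 6/π² * (T * T))
        rearrange = begin
          fromℕ p * (fromℕ (R T p (+ v)) - 6/π² * (T * T * recip p))
            ≈⟨ *-congˡ (+-congʳ (trans (R≈ pp fl D≤N (+ v)) (coprimePoints≈ p (+ v) D))) ⟩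
          fromℕ p * (X - 6/π² * (T * T * recip p))
            ≈⟨ solve 5 (λ p x k t i → p :* (x :- k :* (t :* i)) := p :* x :- k :* t :* (p :* i)) refl (fromℕ p) X 6/π² (T * T) (recip p) ⟩
          fromℕ p * X - 6/π² * (T * T) * (fromℕ p * recip p)
            ≈⟨ +-congˡ (-‿cong (·1 (recip-inverse 1≤p))) ⟨
          fromℕ p * X - 6/π² * (T * T)
            ≈⟨ solve 3 (λ x s k → x :- k := x :- s :+ (s :- k)) refl (fromℕ p * X) S (6/π² * (T * T)) ⟩
          fromℕ p * X - S + (S - 6/π² * (T * T))
            ≈⟨ +-congʳ (+-congʳ (Σ-*ˡ (range D) (fromℕ p) _)) ⟨
          Σ (range D) (λ d → fromℕ p * (μ d * A d v)) - S + (S - 6/π² * (T * T))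
            ≈⟨ +-congʳ (Σ-sub (range D) _ _) ⟨
          Σ (range D) (λ d → fromℕ p * (μ d * A d v) - μ d * (u d * u d)) + (S - 6/π² * (T * T))
            ≈⟨ +-congʳ (Σ-cong (range D) (λ {d} _ → solve 4 (λ p m a u → p :* (m :* a) :- m :* u := m :* (p :* a :- u)) refl (fromℕ p) (μ d) (A d v) (u d * u d))) ⟩
          _ ∎
          where X = Σ (range D) (λ d → μ d * A d v)

    error-bound : Σ residues deviationR ≤ fromℕ 21 * (T * (fromℕ q * (H * H))) + fromℕ 2 * (T * T * recip p) + Δ
    error-bound = *-cancelˡ-≤ (fromℕ p) (0<fromℕ 1≤p) (sym (Σ-*ˡ residues (fromℕ p) deviationR) ≈≤
      ≤.trans (Σ-mono residues (λ {v} _ → pointwise v)) ((trans (Σ-+ residues _ _) (+-cong (Σ-swap residues (range D) _) (Σ-range-const (p ℕ.∸ 1) Δ))) ≈≤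
        ≤.trans (+-mono-≤ total-deviation (*-monoʳ-≤ Δ 0≤Δ (fromℕ-mono (ℕ.m∸n≤m p 1)))) final))
      where
      0≤Δ : 0# ≤ Δ
      0≤Δ = 0≤fromℕ 2 *0 0≤T *0 0≤harmonic D +0 0≤fromℕ 64 *0 (0≤T *0 (0≤harmonic D *0 0≤harmonic D)) +0 0≤fromℕ 2 *0 0≤T
      final : fromℕ 21 * (fromℕ p * (fromℕ D * (fromℕ q * H))) * H + fromℕ 2 * (fromℕ D * fromℕ D) + fromℕ p * Δ
        ≤ fromℕ p * (fromℕ 21 * (T * (fromℕ q * (H * H))) + fromℕ 2 * (T * T * recip p) + Δ)
      final = ≤-cert (solve 7 (λ p x q H t i Δ →
          p :* (κ 21 :* (t :* (q :* (H :* H))) :+ κ 2 :* (t :* t :* i) :+ Δ) :- (κ 21 :* (p :* (x :* (q :* H))) :* H :+ κ 2 :* (x :* x) :+ p :* Δ)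
          := κ 21 :* p :* q :* H :* H :* (t :- x) :+ κ 2 :* (t :- x) :* (t :+ x) :+ κ 2 :* (t :* t) :* (p :* i :- κ 1))
          refl (fromℕ p) (fromℕ D) (fromℕ q) H T (recip p) Δ)
        (0≤fromℕ 21 *0 0≤fromℕ p *0 0≤fromℕ q *0 0≤harmonic D *0 0≤harmonic D *0 ≤⇒0≤- (proj₁ fl)
          +0 0≤fromℕ 2 *0 ≤⇒0≤- (proj₁ fl) *0 (0≤T +0 0≤fromℕ D) +0 ≤.reflexive (sym (≈0-* _ (≈⇒-≈0 (recip-inverse 1≤p)))))

-- Roots and real powers.

-- Provides the shape in which a rational number has to be constructed, and keeps the common factor
-- for comparing powers before and after reduction.
reduce-fraction : ∀ m n → 1 ℕ.≤ n → ∃₂ λ m′ n′ → ∃ λ g →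
  1 ℕ.≤ g × m ≡ m′ ℕ.* g × n ≡ suc n′ ℕ.* g × Coprime m′ (suc n′)
reduce-fraction m n 1≤n = positive n′ n≡ coprime
  where
  g = gcd m n
  m′ = ℕ.quotient (gcd[m,n]∣m m n)
  n′ = ℕ.quotient (gcd[m,n]∣n m n)
  m≡ : m ≡ m′ ℕ.* g
  m≡ = ℕ._∣_.equality (gcd[m,n]∣m m n)
  n≡ : n ≡ n′ ℕ.* g
  n≡ = ℕ._∣_.equality (gcd[m,n]∣n m n)
  1≤g : 1 ℕ.≤ g
  1≤g = ℕ.n≢0⇒n>0 λ g≡0 → ℕ.<⇒≢ 1≤n (≡.sym (≡.trans n≡ (≡.trans (≡.cong (n′ ℕ.*_) g≡0) (ℕ.*-zeroʳ n′))))

  coprime : Coprime m′ n′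
  coprime = gcd-cofactors-coprime {m} {n} 1≤g m≡ n≡

  positive : ∀ n′ → n ≡ n′ ℕ.* g → Coprime m′ n′ → ∃₂ λ m′ n′ → ∃ λ g →
    1 ℕ.≤ g × m ≡ m′ ℕ.* g × n ≡ suc n′ ℕ.* g × Coprime m′ (suc n′)
  positive zero     n≡0 _ = ⊥-elim (ℕ.<⇒≢ 1≤n (≡.sym n≡0))
  positive (suc n′) n≡  c = m′ , n′ , g , 1≤g , m≡ , n≡ , c

module Power (𝓡 : RealNumbers) where

  open OrderedField 𝓡
  open Basel 𝓡 using (·1; sup-isSup)
  open SetoidReasoning setoid

  0≤^ : ∀ {x} n → 0# ≤ x → 0# ≤ x ^ n
  0≤^ zero    0≤x = 0≤1
  0≤^ (suc n) 0≤x = 0≤x *0 0≤^ n 0≤x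

  0<* : ∀ {x y} → 0# < x → 0# < y → 0# < x * y
  0<* {x} {y} 0<x 0<y = (proj₁ 0<x *0 proj₁ 0<y) , λ e → proj₂ 0<y (sym (begin
    y                  ≈⟨ trans (·1 (*-inverse 0<x)) (*-comm _ _) ⟩
    x * x ⁻¹ * y       ≈⟨ solve 3 (λ x i y → x :* i :* y := i :* (x :* y)) refl x (x ⁻¹) y ⟩
    x ⁻¹ * (x * y)     ≈⟨ *-congˡ e ⟨
    x ⁻¹ * 0#          ≈⟨ zeroʳ _ ⟩
    0#                 ∎))

  0<^ : ∀ {x} n → 0# < x → 0# < x ^ n
  0<^ zero    0<x = 0<1
  0<^ (suc n) 0<x = 0<* 0<x (0<^ n 0<x)

  ^-mono : ∀ {x y} n → 0# ≤ x → x ≤ y → x ^ n ≤ y ^ n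
  ^-mono zero    0≤x x≤y = ≤.refl
  ^-mono (suc n) 0≤x x≤y = *-mono-≤ 0≤x (0≤^ n (≤.trans 0≤x x≤y)) x≤y (^-mono n 0≤x x≤y)

  1≤^ : ∀ {x} n → 1# ≤ x → 1# ≤ x ^ n
  1≤^ zero    1≤x = ≤.refl
  1≤^ {x} (suc n) 1≤x = sym (*-identityʳ 1#) ≈≤ *-mono-≤ 0≤1 (0≤^ n (≤.trans 0≤1 1≤x)) 1≤x (1≤^ n 1≤x)

  ^-monoʳ : ∀ {x m n} → 1# ≤ x → m ℕ.≤ n → x ^ m ≤ x ^ n
  ^-monoʳ {n = n} 1≤x ℕ.z≤n = 1≤^ n 1≤x
  ^-monoʳ {x} 1≤x (ℕ.s≤s h) = *-monoˡ-≤ x (≤.trans 0≤1 1≤x) (^-monoʳ 1≤x h)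

  ^-cancel-≤ : ∀ {x y} n → 1 ℕ.≤ n → 0# ≤ x → 0# ≤ y → x ^ n ≤ y ^ n → x ≤ y
  ^-cancel-≤ {x} {y} (suc n) _ 0≤x 0≤y h with x ≤.≤? y
  ... | yes p = p
  ... | no ¬p = *-cancelˡ-≤ (x ^ n) (0<^ n 0<x) (*-comm _ _ ≈≤ ≤.trans h
      (*-monoˡ-≤ y 0≤y (^-mono n 0≤y (proj₁ y<x)) ≤≈ *-comm _ _))
    where
    y<x = ≰⇒> ¬p
    0<x : 0# < x
    0<x = 0≤x , λ e → proj₂ y<x (≤.antisym (proj₁ y<x) (sym e ≈≤ 0≤y))

  ^-cancel-≈ : ∀ {x y} n → 1 ℕ.≤ n → 0# ≤ x → 0# ≤ y → x ^ n ≈ y ^ n → x ≈ y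
  ^-cancel-≈ n 1≤n 0≤x 0≤y e = ≤.antisym (^-cancel-≤ n 1≤n 0≤x 0≤y (≤.reflexive e)) (^-cancel-≤ n 1≤n 0≤y 0≤x (≤.reflexive (sym e)))

  fromℕ-^ : ∀ a n → fromℕ (a ℕ.^ n) ≈ fromℕ a ^ n
  fromℕ-^ a zero    = fromℕ-1
  fromℕ-^ a (suc n) = trans (fromℕ-* a (a ℕ.^ n)) (*-congˡ (fromℕ-^ a n))

  -- An explicit modulus of continuity of the n-th power at s, on both sides; the recursion for E is
  -- the product rule with slack. It replaces continuity in the construction of roots.
  ^-lipschitz : ∀ s n → 0# ≤ s → ∃ λ E → 0# ≤ E
    × (∀ h → 0# ≤ h → h ≤ 1# → (s + h) ^ n ≤ s ^ n + h * E)
    × (∀ h → 0# ≤ h → h ≤ s → s ^ n ≤ (s - h) ^ n + h * E)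
  ^-lipschitz s zero 0≤s = 0# , ≤.refl , (λ h _ _ → ≤.reflexive e) , (λ h _ _ → ≤.reflexive e)
    where
    e : ∀ {h} → 1# ≈ 1# + h * 0#
    e {h} = solve 1 (λ h → κ 1 := κ 1 :+ h :* κ 0) refl h
  ^-lipschitz s (suc n) 0≤s = let E , 0≤E , up , down = ^-lipschitz s n 0≤s in
    s ^ n + (s + 1#) * E , (0≤^ n 0≤s +0 (0≤s +0 0≤1) *0 0≤E) ,
    (λ h 0≤h h≤1 → ≤-cert (solve 5 (λ s h t E a → s :* t :+ h :* (t :+ (s :+ κ 1) :* E) :- (s :+ h) :* a
        := (s :+ h) :* (t :+ h :* E :- a) :+ h :* E :* (κ 1 :- h)) refl s h (s ^ n) E ((s + h) ^ n))
      ((0≤s +0 0≤h) *0 ≤⇒0≤- (up h 0≤h h≤1) +0 0≤h *0 0≤E *0 ≤⇒0≤- h≤1)) ,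
    (λ h 0≤h h≤s → ≤-cert (solve 5 (λ s h t E a → (s :- h) :* a :+ h :* (t :+ (s :+ κ 1) :* E) :- s :* t
        := (s :- h) :* (a :+ h :* E :- t) :+ h :* (h :+ κ 1) :* E) refl s h (s ^ n) E ((s - h) ^ n))
      (≤⇒0≤- h≤s *0 ≤⇒0≤- (down h 0≤h h≤s) +0 0≤h *0 (0≤h +0 0≤1) *0 0≤E))

  root : ∀ {a} n → 1 ℕ.≤ n → 1# ≤ a → ∃ λ z → 0# < z × z ^ n ≈ a
  root {a} n@(suc n-1) 1≤n 1≤a = z , 0<z , ≤.antisym (≮⇒≥ not-above) (≮⇒≥ not-below)
    where
    S : Pred ℝ 0ℓ
    S x = 0# ≤ x × x ^ n ≤ a
    1∈S : S 1#
    1∈S = 0≤1 , (1^ n ≈≤ 1≤a)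
      where
      1^ : ∀ n → 1# ^ n ≈ 1#
      1^ zero    = refl
      1^ (suc n) = trans (*-identityˡ _) (1^ n)
    ≤a : UpperBound S a
    ≤a x (0≤x , xⁿ≤a) with x ≤.≤? a
    ... | yes p = p
    ... | no ¬p = ≤.trans (·1 refl ≈≤ *-monoˡ-≤ x 0≤x (1≤^ n-1 (≤.trans 1≤a (≰⇒≥ ¬p)))) xⁿ≤a
    isSup = complete S (1# , 1∈S) (a , ≤a)
    z = proj₁ isSup
    upper = proj₁ (proj₂ isSup)
    approx = proj₂ (proj₂ isSup)
    1≤z : 1# ≤ z
    1≤z = upper 1# 1∈S
    0<z = 1≤⇒0< 1≤z
    0≤z = proj₁ 0<z
    E = proj₁ (^-lipschitz z n 0≤z)
    0≤E = proj₁ (proj₂ (^-lipschitz z n 0≤z))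
    up = proj₁ (proj₂ (proj₂ (^-lipschitz z n 0≤z)))
    down = proj₂ (proj₂ (proj₂ (^-lipschitz z n 0≤z)))

    module Step {ε : ℝ} (0<ε : 0# < ε) where
      -- The increment h = ε/(1 + ε + E) satisfies h ≤ 1 and h E ≤ ε at once, whatever the sizes of
      -- ε and E.
      w = 1# + ε + E
      0<w : 0# < w
      0<w = 1≤⇒0< (≤-cert (solve 2 (λ ε E → κ 1 :+ ε :+ E :- κ 1 := ε :+ E) refl ε E) (proj₁ 0<ε +0 0≤E))
      h = ε * w ⁻¹
      w*h : w * h ≈ ε
      w*h = trans (solve 3 (λ w e i → w :* (e :* i) := e :* (w :* i)) refl w ε (w ⁻¹)) (sym (·1 (*-inverse 0<w)))
      0≤h : 0# ≤ h
      0≤h = proj₁ 0<ε *0 0≤⁻¹ 0<w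
      h≤1 : h ≤ 1#
      h≤1 = *-cancelˡ-≤ w 0<w (w*h ≈≤ ≤-cert (solve 2 (λ ε E → (κ 1 :+ ε :+ E) :* κ 1 :- ε := κ 1 :+ E) refl ε E) (0≤1 +0 0≤E))
      hE≤ε : h * E ≤ ε
      hE≤ε = ≤-cert (solve 3 (λ h ε E → ε :- h :* E := (ε :- (κ 1 :+ ε :+ E) :* h) :+ (κ 1 :+ ε) :* h) refl h ε E)
        (≤.reflexive (sym (≈⇒-≈0 (sym w*h))) +0 (0≤1 +0 proj₁ 0<ε) *0 0≤h)
      0<h : 0# < h
      0<h = 0≤h , λ e → proj₂ 0<ε (sym (trans (sym w*h) (trans (*-congˡ (sym e)) (zeroʳ _))))

    gap : ∀ {x y} → x < y → 0# < y - x
    gap {x} {y} (x≤y , x≉y) = ≤⇒0≤- x≤y , λ e → x≉y (sym (≈-cert {e = y - x} refl (sym e)))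

    not-below : ¬ (z ^ n < a)
    not-below zⁿ<a = <⇒≱ 0<h (≤-cert (solve 2 (λ z h → κ 0 :- h := z :- (z :+ h)) refl z h)
      (≤⇒0≤- (upper (z + h) (0≤z +0 0≤h , ≤.trans (up h 0≤h h≤1) (≤-cert
        (solve 4 (λ z h E a → a :- (z :+ h :* E) := (a :- z) :- h :* E) refl (z ^ n) h E a) (≤⇒0≤- hE≤ε))))))
      where open Step (gap zⁿ<a)

    not-above : ¬ (a < z ^ n)
    not-above a<zⁿ = let x , (0≤x , xⁿ≤a) , z-h<x = approx (z - h) z-h<z in
      <⇒≱ z-h<x (^-cancel-≤ n 1≤n 0≤x (≤⇒0≤- h≤z) (≤.trans xⁿ≤a (≤-cert
        (solve 5 (λ a z y h E → y :- a := (y :+ h :* E :- z) :+ ((z :- a) :- h :* E)) refl a (z ^ n) ((z - h) ^ n) h E)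
        (≤⇒0≤- (down h 0≤h h≤z) +0 ≤⇒0≤- hE≤ε))))
      where
      open Step (gap a<zⁿ)
      h≤z : h ≤ z
      h≤z = ≤.trans h≤1 1≤z
      z-h<z : z - h < z
      z-h<z = ≤-cert (solve 2 (λ z h → z :- (z :- h) := h) refl z h) 0≤h ,
        λ e → proj₂ 0<h (sym (≈-cert (solve 2 (λ z h → h :- κ 0 := z :- (z :- h)) refl z h) (≈⇒-≈0 (sym e))))

  Powers : ℝ → ℝ → Pred ℝ 0ℓ
  Powers b y z = ∃ λ q → fromℚ q ≤ y × 0# < z × z ^ ℚ.↧ₙ q ≈ b ^ᶻ ℚ.↥ q

  -- Without a bound `sup` would take its default value 0. For b ≥ 1 a power of b with a natural
  -- exponent above y serves, after raising to the denominator of the rational exponent.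
  Powers-bounded : ∀ {b} y → 1# ≤ b → ∃ (UpperBound (Powers b y))
  Powers-bounded {b} y 1≤b = b ^ n , λ z (q , q≤y , 0<z , e) →
      ^-cancel-≤ (ℚ.↧ₙ q) (ℕ.s≤s ℕ.z≤n) (proj₁ 0<z) (0≤^ n (≤.trans 0≤1 1≤b)) (e ≈≤ (bound (ℚ.↥ q) (ℚ.↧ₙ q) (ℕ.s≤s ℕ.z≤n) (≤.trans q≤y y≤n)
        ≤≈ sym (^-assocʳ b n (ℚ.↧ₙ q))))
    where
    n = proj₁ (archimedean y)
    y≤n = proj₂ (archimedean y)
    bound : ∀ i d → 1 ℕ.≤ d → fromℤ i * recip d ≤ fromℕ n → b ^ᶻ i ≤ b ^ (n ℕ.* d)
    bound (+ k) d 1≤d h = ^-monoʳ {m = k} {n ℕ.* d} 1≤b (fromℕ-cancel-≤ {k} {n ℕ.* d} (trans (·1 (recip-inverse 1≤d)) (solve 3 (λ k d i → k :* (d :* i) := k :* i :* d) refl (fromℕ k) (fromℕ d) (recip d))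
      ≈≤ (*-monoʳ-≤ (fromℕ d) (0≤fromℕ d) h ≤≈ sym (fromℕ-* n d))))
    bound -[1+ k ] d _ _ = ≤.trans (*-cancelˡ-≤ (b ^ suc k) (1≤⇒0< (1≤^ (suc k) 1≤b))
      (*-inverse (1≤⇒0< (1≤^ (suc k) 1≤b)) ≈≤ (1≤^ (suc k) 1≤b ≤≈ sym (*-identityʳ _)))) (1≤^ (n ℕ.* d) 1≤b)

  -- A member of a bounded set lies below its supremum. The set speaks of exponents in lowest terms;
  -- the common factor of m and n is removed from z^n = b^m because nonnegative numbers with equal
  -- powers are equal.
  ≤-^ʳ : ∀ {b y z} m n → 1 ℕ.≤ n → 1# ≤ b → fromℕ m * recip n ≤ y → 0# < z → z ^ n ≈ b ^ m → z ≤ b ^ʳ y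
  ≤-^ʳ {b} {y} {z} m n 1≤n 1≤b m/n≤y 0<z e = member (reduce-fraction m n 1≤n)
    where
    member : (∃₂ λ m′ n′ → ∃ λ g → 1 ℕ.≤ g × m ≡ m′ ℕ.* g × n ≡ suc n′ ℕ.* g × Coprime m′ (suc n′)) → z ≤ b ^ʳ y
    member (m′ , n′ , g , 1≤g , ≡.refl , ≡.refl , c) = proj₁ (sup-isSup (Powers b y) (z , inPowers) (Powers-bounded y 1≤b)) z inPowers
      where
      same : fromℕ m′ * recip (suc n′) ≈ fromℕ (m′ ℕ.* g) * recip (suc n′ ℕ.* g)
      same = sym (trans (*-cong (fromℕ-* m′ g) (recip-* {suc n′} (ℕ.s≤s ℕ.z≤n) 1≤g))
        (trans (solve 4 (λ m g i j → m :* g :* (i :* j) := m :* i :* (g :* j)) refl (fromℕ m′) (fromℕ g) (recip (suc n′)) (recip g))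
          (sym (·1 (recip-inverse 1≤g)))))
      inPowers : Powers b y z
      inPowers = mkℚ (+ m′) n′ c , (same ≈≤ m/n≤y) , 0<z ,
        ^-cancel-≈ g 1≤g (0≤^ (suc n′) (proj₁ 0<z)) (0≤^ m′ (≤.trans 0≤1 1≤b))
          (trans (^-assocʳ z (suc n′) g) (trans e (sym (^-assocʳ b m′ g))))

  1≤^ʳ : ∀ {b y} → 1# ≤ b → 0# ≤ y → 1# ≤ b ^ʳ y
  1≤^ʳ 1≤b 0≤y = ≤-^ʳ 0 1 ℕ.≤-refl 1≤b (zeroˡ _ ≈≤ 0≤y) 0<1 (*-identityʳ 1#)

-- The doubly exponential scale in place of the logarithm.

1≤2^ : ∀ n → 1 ℕ.≤ 2 ℕ.^ n
1≤2^ n = ℕ.m^n>0 2 n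

n<2^n : ∀ n → n ℕ.< 2 ℕ.^ n
n<2^n zero    = ℕ.s≤s ℕ.z≤n
n<2^n (suc n) = begin-strict
  suc n                            <⟨ ℕ.s≤s (n<2^n n) ⟩
  suc (2 ℕ.^ n)                    ≤⟨ ℕ.+-monoˡ-≤ (2 ℕ.^ n) (1≤2^ n) ⟩
  2 ℕ.^ n ℕ.+ 2 ℕ.^ n              ≡⟨ ≡.cong (2 ℕ.^ n ℕ.+_) (ℕ.+-identityʳ _) ⟨
  2 ℕ.^ suc n                      ∎
  where open ℕ.≤-Reasoning

n²≤2^[1+n] : ∀ n → n ℕ.* n ℕ.≤ 2 ℕ.* 2 ℕ.^ n
n²≤2^[1+n] zero    = ℕ.z≤n
n²≤2^[1+n] (suc n) = begin
  suc n ℕ.* suc n                              ≡⟨ lem n ⟩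
  n ℕ.* n ℕ.+ suc (2 ℕ.* n)                    ≤⟨ ℕ.+-mono-≤ (n²≤2^[1+n] n) (ℕ.≤-trans (ℕ.n≤1+n _)
                                                    (ℕ.≤-trans (ℕ.≤-reflexive (≡.sym (ℕ.*-suc 2 n))) (ℕ.*-monoʳ-≤ 2 (n<2^n n)))) ⟩
  2 ℕ.* 2 ℕ.^ n ℕ.+ 2 ℕ.* 2 ℕ.^ n              ≡⟨ lem₂ (2 ℕ.* 2 ℕ.^ n) ⟩
  2 ℕ.* 2 ℕ.^ suc n                            ∎
  where
  open ℕ.≤-Reasoning
  lem : ∀ n → suc n ℕ.* suc n ≡ n ℕ.* n ℕ.+ suc (2 ℕ.* n)
  lem = solve-∀
  lem₂ : ∀ x → x ℕ.+ x ≡ 2 ℕ.* x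
  lem₂ = solve-∀

square-cancel-≤ : ∀ {m n} → m ℕ.* m ℕ.≤ n ℕ.* n → m ℕ.≤ n
square-cancel-≤ {m} {n} h with m ℕ.≤? n
... | yes p = p
... | no ¬p = ⊥-elim (ℕ.<⇒≱ (ℕ.*-mono-< (ℕ.≰⇒> ¬p) (ℕ.≰⇒> ¬p)) h)

sqrt : ∀ n → ∃ λ q → q ℕ.* q ℕ.≤ n × n ℕ.< suc q ℕ.* suc q
sqrt zero = 0 , ℕ.z≤n , ℕ.s≤s ℕ.z≤n
sqrt (suc n) with sqrt n
... | q , q²≤n , n<[q+1]² with suc q ℕ.* suc q ℕ.≤? suc n
...   | yes h = suc q , h , ℕ.≤-<-trans n<[q+1]² (ℕ.*-mono-< (ℕ.n<1+n (suc q)) (ℕ.n<1+n (suc q)))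
...   | no ¬h = q , ℕ.m≤n⇒m≤1+n q²≤n , ℕ.≰⇒> ¬h

-- The largest m ≤ n with 16 ^ 2 ^ m ≤ D, or 0.
level : ℕ → ℕ → ℕ
level D zero    = 0
level D (suc n) with 2 ℕ.^ (2 ℕ.^ suc n ℕ.* 4) ℕ.≤? D
... | yes _ = suc n
... | no  _ = level D n

level-≤ : ∀ D n → level D n ≡ 0 ⊎ 2 ℕ.^ (2 ℕ.^ level D n ℕ.* 4) ℕ.≤ D
level-≤ D zero = inj₁ ≡.refl
level-≤ D (suc n) with 2 ℕ.^ (2 ℕ.^ suc n ℕ.* 4) ℕ.≤? D
... | yes h = inj₂ h
... | no  _ = level-≤ D n

level-max : ∀ D n {k} → k ℕ.≤ n → 2 ℕ.^ (2 ℕ.^ k ℕ.* 4) ℕ.≤ D → k ℕ.≤ level D n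
level-max D zero k≤0 _ = k≤0
level-max D (suc n) {k} k≤n h with 2 ℕ.^ (2 ℕ.^ suc n ℕ.* 4) ℕ.≤? D
... | yes _ = k≤n
... | no ¬h with k ℕ.≟ suc n
...   | yes ≡.refl = ⊥-elim (¬h h)
...   | no  k≢     = level-max D n (ℕ.s≤s⁻¹ (ℕ.≤∧≢⇒< k≤n k≢)) h

-- Searching up to D loses nothing, as 16^(2^k) ≤ D forces k ≤ D.
scale : ℕ → ℕ
scale D = level D D

scale-max : ∀ D {k} → 2 ℕ.^ (2 ℕ.^ k ℕ.* 4) ℕ.≤ D → k ℕ.≤ scale D
scale-max D {k} h = level-max D D (begin
  k                              ≤⟨ ℕ.<⇒≤ (n<2^n k) ⟩
  2 ℕ.^ k                        ≤⟨ ℕ.m≤m*n (2 ℕ.^ k) 4 ⟩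
  2 ℕ.^ k ℕ.* 4                  ≤⟨ ℕ.<⇒≤ (n<2^n (2 ℕ.^ k ℕ.* 4)) ⟩
  2 ℕ.^ (2 ℕ.^ k ℕ.* 4)          ≤⟨ h ⟩
  D                              ∎) h
  where open ℕ.≤-Reasoning

-- Otherwise the scale could be raised by one, since 16^(2^(m+1)) = 2^(8 · 2^m).
<-2^8scale : ∀ D → D ℕ.< 2 ℕ.^ (8 ℕ.* 2 ℕ.^ scale D)
<-2^8scale D = ℕ.≰⇒> λ h → ℕ.1+n≰n (scale-max D {suc (scale D)} (≡.subst (λ e → 2 ℕ.^ e ℕ.≤ D) (lem (2 ℕ.^ scale D)) h))
  where
  lem : ∀ x → 8 ℕ.* x ≡ 2 ℕ.* x ℕ.* 4
  lem = solve-∀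

^-distribʳ-* : ∀ n a b → (a ℕ.* b) ℕ.^ n ≡ a ℕ.^ n ℕ.* b ℕ.^ n
^-distribʳ-* zero    a b = ≡.refl
^-distribʳ-* (suc n) a b = ≡.trans (≡.cong (a ℕ.* b ℕ.*_) (^-distribʳ-* n a b)) (lem a b (a ℕ.^ n) (b ℕ.^ n))
  where
  lem : ∀ a b x y → a ℕ.* b ℕ.* (x ℕ.* y) ≡ a ℕ.* x ℕ.* (b ℕ.* y)
  lem = solve-∀

-- r B² ≤ p ^ (1/2 + 2m/B) for B = 2 ^ m, raised to the power 2 B.
power-bound : ∀ {p q} m → q ℕ.* q ℕ.≤ p → m ≡ 0 ⊎ 2 ℕ.^ (2 ℕ.^ m) ℕ.≤ p →
  (q ℕ.* (2 ℕ.^ m ℕ.* 2 ℕ.^ m)) ℕ.^ (2 ℕ.* 2 ℕ.^ m) ℕ.≤ p ℕ.^ (2 ℕ.^ m ℕ.+ 4 ℕ.* m)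
power-bound {p} {q} m q²≤p h = begin
  (q ℕ.* (B ℕ.* B)) ℕ.^ (2 ℕ.* B)                  ≡⟨ ℕ.^-*-assoc (q ℕ.* (B ℕ.* B)) 2 B ⟨
  ((q ℕ.* (B ℕ.* B)) ℕ.^ 2) ℕ.^ B                  ≡⟨ ≡.cong (ℕ._^ B) (lem q B) ⟩
  (q ℕ.* q ℕ.* B ℕ.^ 4) ℕ.^ B                      ≡⟨ ^-distribʳ-* B (q ℕ.* q) (B ℕ.^ 4) ⟩
  (q ℕ.* q) ℕ.^ B ℕ.* (B ℕ.^ 4) ℕ.^ B              ≡⟨ ≡.cong ((q ℕ.* q) ℕ.^ B ℕ.*_) exponents ⟩
  (q ℕ.* q) ℕ.^ B ℕ.* (2 ℕ.^ B) ℕ.^ (4 ℕ.* m)      ≤⟨ ℕ.*-mono-≤ (ℕ.^-monoˡ-≤ B q²≤p) (tail h) ⟩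
  p ℕ.^ B ℕ.* p ℕ.^ (4 ℕ.* m)                      ≡⟨ ℕ.^-distribˡ-+-* p B (4 ℕ.* m) ⟨
  p ℕ.^ (B ℕ.+ 4 ℕ.* m)                            ∎
  where
  open ℕ.≤-Reasoning
  B = 2 ℕ.^ m
  lem : ∀ q B → q ℕ.* (B ℕ.* B) ℕ.* (q ℕ.* (B ℕ.* B) ℕ.* 1) ≡ q ℕ.* q ℕ.* (B ℕ.* (B ℕ.* (B ℕ.* (B ℕ.* 1))))
  lem = solve-∀
  lem₂ : ∀ m B → m ℕ.* 4 ℕ.* B ≡ B ℕ.* (4 ℕ.* m)
  lem₂ = solve-∀
  exponents : (B ℕ.^ 4) ℕ.^ B ≡ (2 ℕ.^ B) ℕ.^ (4 ℕ.* m)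
  exponents = ≡.trans (≡.cong (ℕ._^ B) (ℕ.^-*-assoc 2 m 4)) (≡.trans (ℕ.^-*-assoc 2 (m ℕ.* 4) B)
    (≡.trans (≡.cong (2 ℕ.^_) (lem₂ m B)) (≡.sym (ℕ.^-*-assoc 2 B (4 ℕ.* m)))))
  tail : m ≡ 0 ⊎ 2 ℕ.^ B ℕ.≤ p → (2 ℕ.^ B) ℕ.^ (4 ℕ.* m) ℕ.≤ p ℕ.^ (4 ℕ.* m)
  tail (inj₁ ≡.refl) = ℕ.≤-refl
  tail (inj₂ h)      = ℕ.^-monoˡ-≤ (4 ℕ.* m) h

-- Fourth roots of 16^B ≤ D < p⁴; the base 16 of the scale is matched to the threshold p⁴.
small-order : ∀ {p D m} → D ℕ.< p ℕ.^ 4 → m ≡ 0 ⊎ 2 ℕ.^ (2 ℕ.^ m ℕ.* 4) ℕ.≤ D → m ≡ 0 ⊎ 2 ℕ.^ (2 ℕ.^ m) ℕ.≤ p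
small-order         D<p⁴ (inj₁ m≡0) = inj₁ m≡0
small-order {p} {D} {m} D<p⁴ (inj₂ h) = inj₂ (ℕ.<⇒≤ (ℕ.≰⇒> λ p≤ → ℕ.<⇒≱ D<p⁴ (ℕ.≤-trans (ℕ.^-monoˡ-≤ 4 p≤)
  (ℕ.≤-trans (ℕ.≤-reflexive (ℕ.^-*-assoc 2 (2 ℕ.^ m) 4)) h))))

-- Squared, it reads q² B⁴ p² ≤ p⁴ D ≤ D², where B⁴ ≤ 16^B ≤ D follows from B < 2^B.
large-order : ∀ {p q D} m → 1 ℕ.≤ p → q ℕ.* q ℕ.≤ p → p ℕ.^ 4 ℕ.≤ D → m ≡ 0 ⊎ 2 ℕ.^ (2 ℕ.^ m ℕ.* 4) ℕ.≤ D →
  q ℕ.* (2 ℕ.^ m ℕ.* 2 ℕ.^ m) ℕ.* p ℕ.≤ D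
large-order {p} {q} {D} m 1≤p q²≤p p⁴≤D h = square-cancel-≤ (begin
  q ℕ.* (B ℕ.* B) ℕ.* p ℕ.* (q ℕ.* (B ℕ.* B) ℕ.* p)    ≡⟨ lem q B p ⟩
  q ℕ.* q ℕ.* (1 ℕ.* p ℕ.* p) ℕ.* B ℕ.^ 4              ≤⟨ ℕ.*-mono-≤ (ℕ.*-mono-≤ q²≤p (ℕ.*-monoˡ-≤ p (ℕ.*-monoˡ-≤ p 1≤p))) (B⁴≤D h) ⟩
  p ℕ.* (p ℕ.* p ℕ.* p) ℕ.* D                          ≡⟨ ≡.cong (ℕ._* D) (lem₂ p) ⟩
  p ℕ.^ 4 ℕ.* D                                        ≤⟨ ℕ.*-monoˡ-≤ D p⁴≤D ⟩
  D ℕ.* D                                              ∎)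
  where
  open ℕ.≤-Reasoning
  B = 2 ℕ.^ m
  lem : ∀ q B p → q ℕ.* (B ℕ.* B) ℕ.* p ℕ.* (q ℕ.* (B ℕ.* B) ℕ.* p) ≡ q ℕ.* q ℕ.* (1 ℕ.* p ℕ.* p) ℕ.* (B ℕ.* (B ℕ.* (B ℕ.* (B ℕ.* 1))))
  lem = solve-∀
  lem₂ : ∀ p → p ℕ.* (p ℕ.* p ℕ.* p) ≡ p ℕ.* (p ℕ.* (p ℕ.* (p ℕ.* 1)))
  lem₂ = solve-∀
  B⁴≤D : m ≡ 0 ⊎ 2 ℕ.^ (B ℕ.* 4) ℕ.≤ D → B ℕ.^ 4 ℕ.≤ D
  B⁴≤D (inj₁ ≡.refl) = ℕ.≤-trans (ℕ.^-monoˡ-≤ 4 1≤p) p⁴≤D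
  B⁴≤D (inj₂ h)      = ℕ.≤-trans (ℕ.^-monoˡ-≤ 4 (ℕ.<⇒≤ (n<2^n B))) (ℕ.≤-trans (ℕ.≤-reflexive (ℕ.^-*-assoc 2 B 4)) h)

-- The choice of o(1) and the final estimate.

module FareyCongruences (𝓡 : RealNumbers) where

  open OrderedField 𝓡
  open FiniteSums 𝓡
  open Basel 𝓡 using (harmonic; 0≤harmonic; harmonic-mono; ·1; 6/π²)
  open Farey 𝓡
  open Power 𝓡
  open SetoidReasoning setoid

  -- Each dyadic block from 2^L to 2^(L+1) - 1 has at most 2^L terms, none above 1/2^L, and so adds
  -- at most 1.
  harmonic-log : ∀ L {D} → D ℕ.< 2 ℕ.^ L → harmonic D ≤ fromℕ L
  harmonic-log zero    {zero} _ = ≤.refl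
  harmonic-log zero    {suc D} (ℕ.s≤s ())
  harmonic-log (suc L) {D} D<2^[L+1] with D ℕ.<? 2 ℕ.^ L
  ... | yes h = ≤.trans (harmonic-log L h) (fromℕ-mono (ℕ.n≤1+n L))
  ... | no ¬h with ℕ.m≤n⇒∃[o]m+o≡n (ℕ.≮⇒≥ ¬h)
  ...   | o , ≡.refl = split (ℕ.m≤n⇒∃[o]m+o≡n (1≤2^ L))
    where
    o≤ : suc o ℕ.≤ 2 ℕ.^ L
    o≤ = ℕ.+-cancelˡ-≤ (2 ℕ.^ L) (suc o) (2 ℕ.^ L) (ℕ.≤-trans (ℕ.≤-reflexive (ℕ.+-suc (2 ℕ.^ L) o))
      (ℕ.≤-trans D<2^[L+1] (ℕ.≤-reflexive (≡.cong (2 ℕ.^ L ℕ.+_) (ℕ.+-identityʳ _)))))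
    split : (∃ λ m → suc m ≡ 2 ℕ.^ L) → harmonic (2 ℕ.^ L ℕ.+ o) ≤ fromℕ (suc L)
    split (m , e) = reflexive (≡.cong harmonic (≡.trans (≡.cong (ℕ._+ o) (≡.sym e)) (≡.sym (ℕ.+-suc m o)))) ≈≤
      (Σ-range-+ m (suc o) recip ≈≤ (+-mono-≤ (harmonic-log L (ℕ.≤-reflexive e))
        (≤.trans (Σ-mono (range (suc o)) {g = λ _ → recip (2 ℕ.^ L)} (λ {k} k∈ → recip-antitone (1≤2^ L)
            (≡.subst (ℕ._≤ m ℕ.+ k) (≡.trans (ℕ.+-comm m 1) e) (ℕ.+-monoʳ-≤ m (proj₁ (∈-range⁻ k∈))))))
          (Σ-range-const (suc o) _ ≈≤ (*-monoʳ-≤ _ (0≤recip (1≤2^ L)) (fromℕ-mono o≤) ≤≈ recip-inverse (1≤2^ L)))) ≤≈ +-comm _ _))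

  -- For T ≥ 16 and B = 2 ^ m we have 16 ^ B ≤ T < 16 ^ 2B, so log T is of order
  -- B; if moreover T < p⁴, then 2 ^ B ≤ p and B² = (2 ^ B) ^ (2m/B) ≤ p ^ o.
  o : ℝ → ℕ → ℝ
  o T _ = let m = scale (floor T) in fromℕ (2 ℕ.* m) * recip (2 ℕ.^ m)

  0≤o : ∀ T p → 0# ≤ o T p
  0≤o T p = 0≤fromℕ (2 ℕ.* scale (floor T)) *0 0≤recip (1≤2^ (scale (floor T)))

  o-uniform : IsUniformlyLittleO1 o
  o-uniform δ 0<δ = T₀ , λ T T₀≤T p _ → ∣∣-of-≥0 (0≤o T p) ≈≤ bound T T₀≤T
    where
    -- As m² ≤ 2 · 2^m, the value 2m/2^m is at most 4/m, so m ≥ k ≥ 4/δ suffices; beyond `T₀` the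
    -- scale exceeds k.
    k = proj₁ (archimedean (fromℕ 4 * δ ⁻¹))
    T₀ = fromℕ (2 ℕ.^ (2 ℕ.^ suc k ℕ.* 4))

    4≤kδ : fromℕ 4 ≤ fromℕ k * δ
    4≤kδ = trans (·1 (*-inverse 0<δ)) (solve 3 (λ x d i → x :* (d :* i) := x :* i :* d) refl (fromℕ 4) δ (δ ⁻¹)) ≈≤
      *-monoʳ-≤ δ (proj₁ 0<δ) (proj₂ (archimedean (fromℕ 4 * δ ⁻¹)))

    bound : ∀ T → T₀ ≤ T → o T 0 ≤ δ
    bound T T₀≤T = *-cancelˡ-≤ (fromℕ B) (0<fromℕ (1≤2^ m)) (≤-cert
        (solve 4 (λ B d m i → B :* d :- B :* (m :* i) := (B :* d :- m) :+ m :* (κ 1 :- B :* i)) refl (fromℕ B) δ (fromℕ (2 ℕ.* m)) (recip B))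
        (≤⇒0≤- 2m≤Bδ +0 ≤.reflexive (sym (≈0-* _ (≈⇒-≈0 (sym (recip-inverse (1≤2^ m))))))))
      where
      fl = proj₂ (floor-spec {T} (≤.trans (0≤fromℕ (2 ℕ.^ (2 ℕ.^ suc k ℕ.* 4))) T₀≤T))
      m = scale (floor T)
      B = 2 ℕ.^ m
      T₀≤D : 2 ℕ.^ (2 ℕ.^ suc k ℕ.* 4) ℕ.≤ floor T
      T₀≤D = ℕ.≮⇒≥ λ D<T₀ → beyond-floor fl D<T₀ T₀≤T
      k<m : suc k ℕ.≤ m
      k<m = scale-max (floor T) T₀≤D
      m²≤2B : fromℕ m * fromℕ m ≤ fromℕ 2 * fromℕ B
      m²≤2B = sym (fromℕ-* m m) ≈≤ (fromℕ-mono (n²≤2^[1+n] m) ≤≈ fromℕ-* 2 B)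
      2m≤Bδ : fromℕ (2 ℕ.* m) ≤ fromℕ B * δ
      2m≤Bδ = fromℕ-* 2 m ≈≤ *-cancelˡ-≤ (fromℕ 2) (0<fromℕ {2} (ℕ.s≤s ℕ.z≤n)) (≤-cert
        (solve 4 (λ B d m k → κ 2 :* (B :* d) :- κ 2 :* (κ 2 :* m)
            := (κ 2 :* B :- m :* m) :* d :+ m :* ((m :- k) :* d :+ (k :* d :- κ 4))) refl (fromℕ B) δ (fromℕ m) (fromℕ k))
        (≤⇒0≤- m²≤2B *0 proj₁ 0<δ +0 0≤fromℕ m *0 (≤⇒0≤- (fromℕ-mono (ℕ.<⇒≤ k<m)) *0 proj₁ 0<δ +0 ≤⇒0≤- 4≤kδ)))

  -- The exponent is the rational number (B + 4m)/(2B), so the root of order 2B of p^(B + 4m) is one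
  -- of the powers whose supremum is taken; `power-bound` compares it with the left side after
  -- raising both to the power 2B.
  power-lower-bound : ∀ {p q} m → 1 ℕ.≤ p → q ℕ.* q ℕ.≤ p → m ≡ 0 ⊎ 2 ℕ.^ (2 ℕ.^ m) ℕ.≤ p →
    fromℕ (q ℕ.* (2 ℕ.^ m ℕ.* 2 ℕ.^ m)) ≤ fromℕ p ^ʳ (fromℕ 2 ⁻¹ + fromℕ (2 ℕ.* m) * recip (2 ℕ.^ m))
  power-lower-bound {p} {q} m 1≤p q²≤p h = ≤.trans
    (^-cancel-≤ (2 ℕ.* B) 1≤2B (0≤fromℕ (q ℕ.* (B ℕ.* B))) (proj₁ 0<z)
      (sym (fromℕ-^ (q ℕ.* (B ℕ.* B)) (2 ℕ.* B)) ≈≤ (fromℕ-mono (power-bound {p} {q} m q²≤p h) ≤≈ trans (fromℕ-^ p E) (sym zⁿ))))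
    (≤-^ʳ E (2 ℕ.* B) 1≤2B (1≤fromℕ 1≤p) (≤.reflexive exponent) 0<z zⁿ)
    where
    B = 2 ℕ.^ m
    E = B ℕ.+ 4 ℕ.* m
    1≤2B : 1 ℕ.≤ 2 ℕ.* B
    1≤2B = 1≤2^ (suc m)
    rt = root {fromℕ p ^ E} (2 ℕ.* B) 1≤2B (1≤^ E (1≤fromℕ 1≤p))
    z = proj₁ rt
    0<z = proj₁ (proj₂ rt)
    zⁿ : z ^ (2 ℕ.* B) ≈ fromℕ p ^ E
    zⁿ = proj₂ (proj₂ rt)
    i = recip B
    j = fromℕ 2 ⁻¹
    exponent : fromℕ E * recip (2 ℕ.* B) ≈ j + fromℕ (2 ℕ.* m) * i
    exponent = begin
      fromℕ E * recip (2 ℕ.* B)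
        ≈⟨ *-cong (trans (fromℕ-+ B (4 ℕ.* m)) (+-congˡ (fromℕ-* 4 m))) (recip-* {2} (ℕ.s≤s ℕ.z≤n) (1≤2^ m)) ⟩
      (fromℕ B + fromℕ 4 * fromℕ m) * (j * i)
        ≈⟨ solve 4 (λ B m i j → (B :+ κ 4 :* m) :* (j :* i) := j :* (B :* i) :+ κ 2 :* m :* i :* (κ 2 :* j)) refl (fromℕ B) (fromℕ m) i j ⟩
      j * (fromℕ B * i) + fromℕ 2 * fromℕ m * i * (fromℕ 2 * j)
        ≈⟨ +-cong (·1 (recip-inverse (1≤2^ m))) (·1 (recip-inverse {2} (ℕ.s≤s ℕ.z≤n))) ⟨
      j + fromℕ 2 * fromℕ m * i
        ≈⟨ +-congˡ (*-congʳ (fromℕ-* 2 m)) ⟨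
      j + fromℕ (2 ℕ.* m) * i ∎

  -- `c₀` is the coefficient 40σ + σ² of `collect` at σ = 64; the added 2 accounts for the summand
  -- 2T²/p.
  c₀ c : ℝ
  c₀ = fromℕ 40 * fromℕ 64 + fromℕ 64 * fromℕ 64
  c = c₀ + fromℕ 2

  0≤c₀ : 0# ≤ c₀
  0≤c₀ = 0≤fromℕ 40 *0 0≤fromℕ 64 +0 0≤fromℕ 64 *0 0≤fromℕ 64

  0<c : 0# < c
  0<c = 1≤⇒0< (≤-cert (solve 1 (λ x → x :+ κ 2 :- κ 1 := x :+ κ 1) refl c₀) (0≤c₀ +0 0≤1))

  -- Here σ stands for 64 = 8². In 40σ, the main term takes 21σ, the terms 2TH and 2T take 2·8 + 2 =
  -- 18 ≤ 18σ, and one σ is slack; σ² comes from the quadratic part of the density error.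
  collect : ∀ {T q H b t} σ → 1# ≤ σ → 0# ≤ T → 1# ≤ q → 0# ≤ H → 1# ≤ b → H ≤ fromℕ 8 * b → H * H ≤ σ * (b * b) →
    fromℕ 21 * (T * (q * (H * H))) + fromℕ 2 * t + (fromℕ 2 * T * H + σ * (T * (H * H)) + fromℕ 2 * T)
      ≤ fromℕ 2 * t + (fromℕ 40 * σ + σ * σ) * (T * (q * (b * b)))
  collect {T} {q} {H} {b} {t} σ 1≤σ 0≤T 1≤q 0≤H 1≤b H≤8b H²≤ = ≤-cert
    (solve 6 (λ T q H b t σ → κ 2 :* t :+ (κ 40 :* σ :+ σ :* σ) :* (T :* (q :* (b :* b)))
        :- (κ 21 :* (T :* (q :* (H :* H))) :+ κ 2 :* t :+ (κ 2 :* T :* H :+ σ :* (T :* (H :* H)) :+ κ 2 :* T))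
      := κ 21 :* T :* q :* (σ :* (b :* b) :- H :* H) :+ σ :* T :* (σ :* (b :* b) :- H :* H)
         :+ (σ :* σ :+ κ 18) :* T :* (b :* b) :* (q :- κ 1)
         :+ κ 2 :* T :* (κ 8 :* b :- H) :+ κ 16 :* T :* b :* (b :- κ 1) :+ κ 2 :* T :* (b :- κ 1) :* (b :+ κ 1)
         :+ κ 18 :* T :* (q :* (b :* b)) :* (σ :- κ 1) :+ σ :* T :* (q :* (b :* b))) refl T q H b t σ)
    (0≤fromℕ 21 *0 0≤T *0 0≤q *0 ≤⇒0≤- H²≤ +0 0≤σ *0 0≤T *0 ≤⇒0≤- H²≤
      +0 (0≤σ *0 0≤σ +0 0≤fromℕ 18) *0 0≤T *0 (0≤b *0 0≤b) *0 ≤⇒0≤- 1≤q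
      +0 0≤fromℕ 2 *0 0≤T *0 ≤⇒0≤- H≤8b +0 0≤fromℕ 16 *0 0≤T *0 0≤b *0 ≤⇒0≤- 1≤b +0 0≤fromℕ 2 *0 0≤T *0 ≤⇒0≤- 1≤b *0 (0≤b +0 0≤1)
      +0 0≤fromℕ 18 *0 0≤T *0 (0≤q *0 (0≤b *0 0≤b)) *0 ≤⇒0≤- 1≤σ +0 0≤σ *0 0≤T *0 (0≤q *0 (0≤b *0 0≤b)))
    where
    0≤q = ≤.trans 0≤1 1≤q
    0≤b = ≤.trans 0≤1 1≤b
    0≤σ = ≤.trans 0≤1 1≤σ

  absorb-small : ∀ {T W E t} → 0# ≤ T → 0# ≤ t → 0# ≤ E → W ≤ E → fromℕ 2 * t + c₀ * (T * W) ≤ c * (t + T * E)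
  absorb-small {T} {W} {E} {t} 0≤T 0≤t 0≤E W≤E = ≤-cert
    (solve 5 (λ T W E t c → (c :+ κ 2) :* (t :+ T :* E) :- (κ 2 :* t :+ c :* (T :* W)) := c :* t :+ c :* T :* (E :- W) :+ κ 2 :* (T :* E)) refl T W E t c₀)
    (0≤c₀ *0 0≤t +0 0≤c₀ *0 0≤T *0 ≤⇒0≤- W≤E +0 0≤fromℕ 2 *0 (0≤T *0 0≤E))

  absorb-large : ∀ {T W E t} → 0# ≤ T → 0# ≤ E → T * W ≤ t → fromℕ 2 * t + c₀ * (T * W) ≤ c * (t + T * E)
  absorb-large {T} {W} {E} {t} 0≤T 0≤E TW≤t = ≤-cert
    (solve 5 (λ T W E t c → (c :+ κ 2) :* (t :+ T :* E) :- (κ 2 :* t :+ c :* (T :* W)) := c :* (t :- T :* W) :+ (c :+ κ 2) :* (T :* E)) refl T W E t c₀)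
    (0≤c₀ *0 ≤⇒0≤- TW≤t +0 (0≤c₀ +0 0≤fromℕ 2) *0 (0≤T *0 0≤E))

  module Estimate {p : ℕ} (pp : Prime p) {T : ℝ} (0≤T : 0# ≤ T) where

    private
      D = floor T
      fl = proj₂ (floor-spec {T} 0≤T)
      m = scale D
      B = 2 ℕ.^ m
      q = proj₁ (sqrt p)
      q²≤p = proj₁ (proj₂ (sqrt p))
      p<q² = proj₂ (proj₂ (sqrt p))
      1≤p = 1≤-prime pp
      t = T * T * recip p
      E = fromℕ p ^ʳ (fromℕ 2 ⁻¹ + o T p)
      W = fromℕ q * (fromℕ B * fromℕ B)

      0≤t : 0# ≤ t
      0≤t = 0≤T *0 0≤T *0 0≤recip 1≤p

      0≤E : 0# ≤ E
      0≤E = ≤.trans 0≤1 (1≤^ʳ (1≤fromℕ 1≤p) (0≤recip {2} (ℕ.s≤s ℕ.z≤n) +0 0≤o T p))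

      1<p : 1 ℕ.< p
      1<p = ℕ.nonTrivial⇒n>1 p {{prime⇒nonTrivial pp}}

      q<p : q ℕ.< p
      q<p = ℕ.≰⇒> λ p≤q → ℕ.<⇒≱ (ℕ.<-≤-trans (ℕ.m<m*n p p {{ℕ.>-nonZero 1≤p}} 1<p) (ℕ.*-mono-≤ p≤q p≤q)) q²≤p

      1≤q : 1 ℕ.≤ q
      1≤q = ℕ.n≢0⇒n>0 λ q≡0 → ℕ.<⇒≱ p<q² (≡.subst (λ q → suc q ℕ.* suc q ℕ.≤ p) (≡.sym q≡0) 1≤p)

      fromℕ-W : fromℕ (q ℕ.* (B ℕ.* B)) ≈ W
      fromℕ-W = trans (fromℕ-* q (B ℕ.* B)) (*-congˡ (fromℕ-* B B))

      H≤8B : harmonic D ≤ fromℕ 8 * fromℕ B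
      H≤8B = harmonic-log (8 ℕ.* B) (<-2^8scale D) ≤≈ fromℕ-* 8 B

      H²≤ : harmonic D * harmonic D ≤ fromℕ 64 * (fromℕ B * fromℕ B)
      H²≤ = *-mono-≤ (0≤harmonic D) (0≤fromℕ 8 *0 0≤fromℕ B) H≤8B H≤8B
        ≤≈ solve 1 (λ b → κ 8 :* b :* (κ 8 :* b) := κ 64 :* (b :* b)) refl (fromℕ B)

      dichotomy : fromℕ 2 * t + c₀ * (T * W) ≤ c * (t + T * E)
      dichotomy with D ℕ.<? p ℕ.^ 4
      ... | yes D<p⁴ = absorb-small 0≤T 0≤t 0≤E
            (sym fromℕ-W ≈≤ power-lower-bound {p} {q} m 1≤p q²≤p (small-order {p} {D} {m} D<p⁴ (level-≤ D D)))
      -- For such large T the bound W p ≤ T, multiplied by T/p, places the whole logarithmic term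
      -- below T²/p.
      ... | no  D≮p⁴ = absorb-large {E = E} 0≤T 0≤E (·1 (recip-inverse 1≤p) ≈≤ ≤-cert
            (solve 4 (λ T W p i → T :* T :* i :- T :* W :* (p :* i) := T :* i :* (T :- W :* p)) refl T W (fromℕ p) (recip p))
            (0≤T *0 0≤recip 1≤p *0 ≤⇒0≤- Wp≤T))
        where
        Wp≤T : W * fromℕ p ≤ T
        Wp≤T = ≤.trans (sym (trans (fromℕ-* (q ℕ.* (B ℕ.* B)) p) (*-congʳ fromℕ-W)) ≈≤
          fromℕ-mono (large-order {p} {q} m 1≤p q²≤p (ℕ.≮⇒≥ D≮p⁴) (level-≤ D D))) (proj₁ fl)

    estimate : Σ (range (p ∸ 1)) (λ v → ∣ fromℕ (R T p (+ v)) - 6/π² * t ∣) ≤ c * (t + T * E)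
    estimate = ≤.trans (ErrorBound.error-bound pp q<p q²≤p p<q² 0≤T fl (proj₁ (floor-spec {T} 0≤T)))
      (≤.trans (collect (fromℕ 64) (1≤fromℕ {64} (ℕ.s≤s ℕ.z≤n)) 0≤T (1≤fromℕ 1≤q) (0≤harmonic D) (1≤fromℕ (1≤2^ m)) H≤8B H²≤) dichotomy)

theorem1 : (𝓡 : RealNumbers) → let open RealAnalysis 𝓡 in
    ∃ λ (c : ℝ) → 0# < c ×
    ∃ λ (o : ℝ → ℕ → ℝ) → IsUniformlyLittleO1 o ×
    ((p : ℕ) → Prime p → (T : ℝ) → 0# < T →
    (∑[ i < p ∸ 1 ]
    ∣ fromℕ (R T p (+ suc (toℕ i))) - (fromℕ 6 / π ^ 2) * (T ^ 2 / fromℕ p) ∣)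
    ≤ c * (T ^ 2 / fromℕ p + T * fromℕ p ^ʳ (fromℕ 2 ⁻¹ + o T p)))
theorem1 𝓡 = c , 0<c , o , o-uniform , λ p pp T 0<T →
    let T²/p : T ^ 2 / fromℕ p ≈ T * T * recip p
        T²/p = *-congʳ (*-congˡ (*-identityʳ T))
    in trans (∑-range (p ∸ 1) (λ v → ∣ fromℕ (R T p (+ v)) - (fromℕ 6 / π ^ 2) * (T ^ 2 / fromℕ p) ∣))
         (Σ-cong (range (p ∸ 1)) (λ {v} _ → ∣∣-cong (+-congˡ (-‿cong (*-congˡ T²/p)))))
       ≈≤ (Estimate.estimate pp (proj₁ 0<T) ≤≈ *-congˡ (+-congʳ (sym T²/p)))
  where
  open OrderedField 𝓡
  open FiniteSums 𝓡
  open FareyCongruences 𝓡
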